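{- Let $k\ge3$ be odd and let $n,B\in\mathbb{N}$ with $n\ge kB$ and $k\le B$; let $f_j=1/j$ for $j\in[n]$. Let $h_1,\dots,h_k:[n]\to[B]$ and $s_1,\dots,s_k:[n]\to\{ -1,1\}$ be independent, truly (uniformly) random functions. For $i\in[n]$ define $$\tilde f_i=\mathrm{median}_{\ell\in[k]}\left(s_\ell(i)\sum_{j\in[n]}[h_\ell(j)=h_\ell(i)]\,s_\ell(j)f_j\right).$$ Then for every $i\in[n]$, $$\mathbb{E}[|\tilde f_i-f_i|]=\Omega\left(\frac{1}{B\sqrt k\log k}\right)\quad\text{and}\quad\mathbb{E}[|\tilde f_i-f_i|]=O\left(\frac{1}{B\sqrt k}\right),$$ with absolute implied constants.
   Context: $[E]$ denotes the indicator of the event $E$. For odd $k$, the median of $k$ real numbers is the middle value after sorting. -}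

module Defs where

open import Data.Nat as ℕ using (ℕ; zero; suc)
open import Data.Nat.DivMod using (_/_)
open import Data.Integer using (+_; -[1+_])
open import Data.Bool using (Bool; true; false; if_then_else_)
open import Data.Fin using (Fin; toℕ; _≟_)
open import Data.List using (List; []; _∷_; concatMap; map; foldr; length)
open import Data.Vec using (Vec; []; _∷_; toList; lookup; tabulate)
open import Data.Product using (_×_; _,_)
open import Relation.Nullary.Decidable using (does)
open import Data.Rational as ℚ using (ℚ; 0ℚ; 1ℚ; _+_; _*_; _-_; ∣_∣)
open import Data.Rational.Properties using (≤-decTotalOrder)
open import Data.List.Sort.InsertionSort.Base ≤-decTotalOrder using (sort)

sumℚ : List ℚ → ℚ
sumℚ = foldr _+_ 0ℚ

Σℚ : (n : ℕ) → (Fin n → ℚ) → ℚ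
Σℚ n g = sumℚ (toList (tabulate g))

inv-suc : ℕ → ℚ
inv-suc m = ℚ._/_ (+ 1) (suc m)

-- f_j = 1/j for j ∈ [n] = {1,…,n}; index j : Fin n represents j+1
f : {n : ℕ} → Fin n → ℚ
f j = inv-suc (toℕ j)

sgn : Bool → ℚ
sgn true  = 1ℚ
sgn false = ℚ.- 1ℚ

iverson : {B : ℕ} → Fin B → Fin B → ℚ
iverson a b = if does (a ≟ b) then 1ℚ else 0ℚ

at : List ℚ → ℕ → ℚ
at [] _ = 0ℚ
at (x ∷ xs) zero = x
at (x ∷ xs) (suc m) = at xs m

-- median of k reals (k odd): the middle value after sorting, i.e. index ⌊k/2⌋
median : {k : ℕ} → Vec ℚ k → ℚ
median {k} v = at (sort (toList v)) (k / 2)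

estimate : {n B k : ℕ} → Vec (Fin n → Fin B) k → Vec (Fin n → Bool) k → Fin n → ℚ
estimate {n} {B} {k} h s i =
  median (tabulate λ (ℓ : Fin k) →
    sgn (lookup s ℓ i) * Σℚ n (λ j → iverson (lookup h ℓ j) (lookup h ℓ i) * sgn (lookup s ℓ j) * f j))

allFuns : {A : Set} → List A → (n : ℕ) → List (Fin n → A)
allFuns xs zero = (λ ()) ∷ []
allFuns xs (suc n) =
  concatMap (λ a → map (λ g → λ { Fin.zero → a ; (Fin.suc j) → g j }) (allFuns xs n)) xs

allVecs : {A : Set} → List A → (k : ℕ) → List (Vec A k)
allVecs xs zero = [] ∷ []
allVecs xs (suc k) = concatMap (λ a → map (a ∷_) (allVecs xs k)) xs

allFin : (B : ℕ) → List (Fin B)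
allFin B = toList (tabulate (λ b → b))

allBool : List Bool
allBool = true ∷ false ∷ []

-- sample space: all (h_1..h_k, s_1..s_k), each equally likely (uniform, independent)
Ω : (n B k : ℕ) → List (Vec (Fin n → Fin B) k × Vec (Fin n → Bool) k)
Ω n B k = concatMap (λ h → map (h ,_) (allVecs (allFuns allBool n) k))
                    (allVecs (allFuns (allFin B) n) k)

average : List ℚ → ℚ
average [] = 0ℚ
average (x ∷ xs) = sumℚ (x ∷ xs) * inv-suc (length xs)

expectedError : (n B k : ℕ) → Fin n → ℚ
expectedError n B k i =
  average (map (λ { (h , s) → ∣ estimate h s i - f i ∣ }) (Ω n B k))

ofℕ : ℕ → ℚ
ofℕ m = ℚ._/_ (+ m) 1

{-# OPTIONS --safe #-}
module Submission where

{-
For a row of the sketch, estimate − f_i is a random walk X = Σ_{j≠i} ξ_j/j whose steps ξ_j are 0 with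
probability 1 − 1/B and ±1 otherwise, and the error is the absolute median of k independent copies of X.

Lower bound.  Cut the indices into blocks of length ≈ B/2.  With constant probability exactly one
index of a block is hit, and then 1/j is spread evenly enough that P(|X| ≤ δ) = O(δB + 1/B) plus an
exponentially small term.  For δ = c/(B√k) this is a small multiple of 1/√k, so the number of rows
with |X| ≤ δ is smaller than the fluctuation √k of the sum of the signs of the rows, and with constant
probability the median lies outside [−δ, δ].  For bounded k it suffices that a row exceeds 1/(4B) with
probability at least 1/4.

Upper bound.  A step ξ_j is distributed as c (σ − σ′)/2 with independent signs σ, σ′ and a common
Bernoulli(2/B) variable c.  Given the c's, X is therefore a difference of two independent copies, and
Cauchy–Schwarz gives P(|X| ≤ t) = Ω(tB) for t = O(1/B).  By Chebyshev the median exceeds t with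
probability O(1/(kB²t²)).  For larger t, P(|X| > t) = O(1/(tB)), and the first two moments of the
number of rows beyond t bound the tail of the median.  Summing over geometric levels t gives
O(1/(B√k)).
-}

open import Defs

module CountSketch where

  open import Level using (0ℓ)
  open import Data.Bool using (Bool; true; false)
  open import Data.Empty using (⊥-elim)
  open import Data.Fin using (Fin; toℕ)
  open import Data.Integer as ℤ using ()
  import Data.Integer.Properties as ℤₚ
  open import Data.List using (List; []; _∷_; _++_; map; concatMap; length)
  open import Data.List.Properties using (length-++; length-map)
  open import Data.List.Relation.Binary.Permutation.Propositional as Perm using (_↭_)
  open import Data.List.Relation.Binary.Permutation.Propositional.Properties using (↭-length)
  open import Data.List.Relation.Unary.All as All using (All; []; _∷_)
  open import Data.List.Relation.Unary.AllPairs using (AllPairs; []; _∷_)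
  open import Data.List.Relation.Unary.Linked.Properties using (Linked⇒AllPairs)
  open import Data.Nat as ℕ using (ℕ; zero; suc)
  open import Data.Nat.DivMod using (m≡m%n+[m/n]*n; m%n<n; m/n*n≤m; +-distrib-/-∣ʳ; m*n/n≡m)
  open import Data.Nat.Divisibility using (_∣_; divides)
  open import Data.Nat.Logarithm using (⌊log₂_⌋; ⌊log₂⌋-mono-≤)
  import Data.Nat.Properties as ℕₚ
  open import Data.Product using (Σ; _×_; _,_; proj₁; proj₂)
  open import Data.Rational as ℚ using (ℚ; 0ℚ; 1ℚ; ½; _+_; _*_; _-_; -_; _≤_; _<_; ∣_∣; _⊓_; _⊔_)
  open import Data.Rational.Properties
  open import Data.List.Sort.InsertionSort.Base ≤-decTotalOrder using (sort)
  open import Data.List.Sort.InsertionSort.Properties ≤-decTotalOrder using (sort-↭; sort-↗)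
  open import Data.Rational.Unnormalised as ℚᵘ using (mkℚᵘ)
  import Data.Rational.Unnormalised.Properties as ℚᵘₚ
  open import Data.Sum using (_⊎_; inj₁; inj₂)
  open import Data.Vec as Vec using (Vec; []; _∷_; toList; lookup; tabulate)
  open import Data.Vec.Functional using () renaming (_∷_ to _◂_)
  open import Data.Vec.Properties using (length-toList)
  open import Function using (_∘_)
  open import Relation.Binary.PropositionalEquality using (_≡_; _≢_; refl; sym; trans; cong; cong₂; subst; subst₂)
  open import Relation.Nullary using (¬_; Dec; yes; no)
  open import Relation.Nullary.Decidable using (dec⇒maybe)
  open import Tactic.RingSolver using (solve-∀)
  open import Tactic.RingSolver.Core.AlmostCommutativeRing using (AlmostCommutativeRing; fromCommutativeRing)

  -- Rational arithmetic

  ring : AlmostCommutativeRing 0ℓ 0ℓ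
  ring = fromCommutativeRing +-*-commutativeRing (λ x → dec⇒maybe (0ℚ ≟ x))

  ≤-by : ∀ {x y e} → y ≡ x + e → 0ℚ ≤ e → x ≤ y
  ≤-by {x} {y} {e} eq 0≤e = subst₂ _≤_ (+-identityʳ x) (sym eq) (+-monoʳ-≤ x 0≤e)

  0≤- : ∀ {x y} → x ≤ y → 0ℚ ≤ y - x
  0≤- {x} {y} h = subst (_≤ y - x) (+-inverseʳ x) (+-monoˡ-≤ (- x) h)

  0<- : ∀ {x y} → x < y → 0ℚ < y - x
  0<- {x} {y} h = subst (_< y - x) (+-inverseʳ x) (+-monoˡ-< (- x) h)

  *-monoˡ : ∀ {r x y} → 0ℚ ≤ r → x ≤ y → r * x ≤ r * y
  *-monoˡ {r} 0≤r = *-monoˡ-≤-nonNeg r {{ℚ.nonNegative 0≤r}}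

  *-monoʳ : ∀ {r x y} → 0ℚ ≤ r → x ≤ y → x * r ≤ y * r
  *-monoʳ {r} 0≤r = *-monoʳ-≤-nonNeg r {{ℚ.nonNegative 0≤r}}

  *-mono : ∀ {a b c d} → 0ℚ ≤ a → 0ℚ ≤ d → a ≤ b → c ≤ d → a * c ≤ b * d
  *-mono 0≤a 0≤d a≤b c≤d = ≤-trans (*-monoˡ 0≤a c≤d) (*-monoʳ 0≤d a≤b)

  *-cancel : ∀ {r x y} → 0ℚ < r → r * x ≤ r * y → x ≤ y
  *-cancel {r} 0<r = *-cancelˡ-≤-pos r {{ℚ.positive 0<r}}

  infixl 6 _0≤+_
  infixl 7 _0≤*_
  _0≤+_ : ∀ {x y} → 0ℚ ≤ x → 0ℚ ≤ y → 0ℚ ≤ x + y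
  p 0≤+ q = +-mono-≤ p q

  _0≤*_ : ∀ {x y} → 0ℚ ≤ x → 0ℚ ≤ y → 0ℚ ≤ x * y
  _0≤*_ {x} {y} p q = subst (_≤ x * y) (*-zeroʳ x) (*-monoˡ p q)

  0<* : ∀ {x y} → 0ℚ < x → 0ℚ < y → 0ℚ < x * y
  0<* {x} {y} p q = positive⁻¹ (x * y) {{pos*pos⇒pos x {{ℚ.positive p}} y {{ℚ.positive q}}}}

  neg-sq : ∀ x → - x * - x ≡ x * x
  neg-sq = solve-∀ ring

  neg-neg : ∀ x → - (- x) ≡ x
  neg-neg = solve-∀ ring

  ½-double : ∀ x → ½ * (x + x) ≡ x
  ½-double = solve-∀ ring

  0≤sq : ∀ x → 0ℚ ≤ x * x
  0≤sq x with ≤-total 0ℚ x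
  ... | inj₁ h = h 0≤* h
  ... | inj₂ h = subst (0ℚ ≤_) (neg-sq x) (0≤-x 0≤* 0≤-x)
    where
    0≤-x : 0ℚ ≤ - x
    0≤-x = neg-antimono-≤ h

  0≤1 : 0ℚ ≤ 1ℚ
  0≤1 = nonNegative⁻¹ 1ℚ

  0≤½ : 0ℚ ≤ ½
  0≤½ = nonNegative⁻¹ ½

  ≰⇒≥ : ∀ {x y} → ¬ (x ≤ y) → y ≤ x
  ≰⇒≥ h = <⇒≤ (≰⇒> h)

  sq-mono : ∀ {x y} → 0ℚ ≤ x → x ≤ y → x * x ≤ y * y
  sq-mono 0≤x x≤y = *-mono 0≤x (≤-trans 0≤x x≤y) x≤y x≤y

  ∣∣-sq : ∀ x → ∣ x ∣ * ∣ x ∣ ≡ x * x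
  ∣∣-sq x with ∣p∣≡p∨∣p∣≡-p x
  ... | inj₁ e rewrite e = refl
  ... | inj₂ e rewrite e = neg-sq x

  x≤∣x∣ : ∀ x → x ≤ ∣ x ∣
  x≤∣x∣ x with ≤-total 0ℚ x
  ... | inj₁ h = ≤-reflexive (sym (0≤p⇒∣p∣≡p h))
  ... | inj₂ h = ≤-trans h (0≤∣p∣ x)

  -x≤∣x∣ : ∀ x → - x ≤ ∣ x ∣
  -x≤∣x∣ x = subst (- x ≤_) (∣-p∣≡∣p∣ x) (x≤∣x∣ (- x))

  ∣∣-≤ : ∀ {x t} → x ≤ t → - x ≤ t → ∣ x ∣ ≤ t
  ∣∣-≤ {x} p q with ∣p∣≡p∨∣p∣≡-p x
  ... | inj₁ e rewrite e = p
  ... | inj₂ e rewrite e = q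

  fromℚᵘ-+ : ∀ u v → ℚ.fromℚᵘ u + ℚ.fromℚᵘ v ≡ ℚ.fromℚᵘ (u ℚᵘ.+ v)
  fromℚᵘ-+ u v = toℚᵘ-injective (ℚᵘₚ.≃-trans (toℚᵘ-homo-+ (ℚ.fromℚᵘ u) (ℚ.fromℚᵘ v))
    (ℚᵘₚ.≃-trans (ℚᵘₚ.+-cong (toℚᵘ-fromℚᵘ u) (toℚᵘ-fromℚᵘ v)) (ℚᵘₚ.≃-sym (toℚᵘ-fromℚᵘ (u ℚᵘ.+ v)))))

  fromℚᵘ-* : ∀ u v → ℚ.fromℚᵘ u * ℚ.fromℚᵘ v ≡ ℚ.fromℚᵘ (u ℚᵘ.* v)
  fromℚᵘ-* u v = toℚᵘ-injective (ℚᵘₚ.≃-trans (toℚᵘ-homo-* (ℚ.fromℚᵘ u) (ℚ.fromℚᵘ v))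
    (ℚᵘₚ.≃-trans (ℚᵘₚ.*-cong (toℚᵘ-fromℚᵘ u) (toℚᵘ-fromℚᵘ v)) (ℚᵘₚ.≃-sym (toℚᵘ-fromℚᵘ (u ℚᵘ.* v)))))

  ofℕ-+ : ∀ m n → ofℕ (m ℕ.+ n) ≡ ofℕ m + ofℕ n
  ofℕ-+ m n = sym (trans (fromℚᵘ-+ (mkℚᵘ (ℤ.+ m) 0) (mkℚᵘ (ℤ.+ n) 0)) (cong (λ z → ℚ.fromℚᵘ (mkℚᵘ z 0))
    (cong₂ ℤ._+_ (ℤₚ.*-identityʳ (ℤ.+ m)) (ℤₚ.*-identityʳ (ℤ.+ n)))))

  ofℕ-* : ∀ m n → ofℕ (m ℕ.* n) ≡ ofℕ m * ofℕ n
  ofℕ-* m n = sym (trans (fromℚᵘ-* (mkℚᵘ (ℤ.+ m) 0) (mkℚᵘ (ℤ.+ n) 0)) (cong (λ z → ℚ.fromℚᵘ (mkℚᵘ z 0))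
    (sym (ℤₚ.pos-* m n))))

  0≤ofℕ : ∀ m → 0ℚ ≤ ofℕ m
  0≤ofℕ m = nonNegative⁻¹ (ofℕ m) {{normalize-nonNeg m 1}}

  0<ofℕ-suc : ∀ m → 0ℚ < ofℕ (suc m)
  0<ofℕ-suc m = positive⁻¹ (ofℕ (suc m)) {{normalize-pos (suc m) 1}}

  0<ofℕ : ∀ {m} → 1 ℕ.≤ m → 0ℚ < ofℕ m
  0<ofℕ {suc m} _ = 0<ofℕ-suc m

  ofℕ-mono : ∀ {m n} → m ℕ.≤ n → ofℕ m ≤ ofℕ n
  ofℕ-mono {m} {n} m≤n = ≤-by (trans (cong ofℕ (sym (ℕₚ.m+[n∸m]≡n m≤n))) (ofℕ-+ m (n ℕ.∸ m))) (0≤ofℕ (n ℕ.∸ m))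

  ofℕ-suc : ∀ m → ofℕ (suc m) ≡ 1ℚ + ofℕ m
  ofℕ-suc m = ofℕ-+ 1 m

  inv : ℕ → ℚ
  inv zero    = 0ℚ
  inv (suc m) = inv-suc m

  ofℕ*inv-suc : ∀ m → ofℕ (suc m) * inv-suc m ≡ 1ℚ
  ofℕ*inv-suc m = trans (fromℚᵘ-* (mkℚᵘ (ℤ.+ suc m) 0) (mkℚᵘ (ℤ.+ 1) m))
    (fromℚᵘ-cong {mkℚᵘ (ℤ.+ suc m) 0 ℚᵘ.* mkℚᵘ (ℤ.+ 1) m} {ℚᵘ.1ℚᵘ}
      (ℚᵘ.*≡* (trans (ℤₚ.*-identityʳ (ℤ.+ suc m ℤ.* (ℤ.+ 1))) (trans (ℤₚ.*-identityʳ (ℤ.+ suc m))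
        (trans (cong (λ z → ℤ.+ suc z) (sym (ℕₚ.+-identityʳ m))) (sym (ℤₚ.*-identityˡ (ℤ.+ suc (m ℕ.+ 0)))))))))

  ofℕ*inv : ∀ {m} → 1 ℕ.≤ m → ofℕ m * inv m ≡ 1ℚ
  ofℕ*inv {suc m} _ = ofℕ*inv-suc m

  0<inv-suc : ∀ m → 0ℚ < inv-suc m
  0<inv-suc m = positive⁻¹ (inv-suc m) {{normalize-pos 1 (suc m)}}

  0≤inv : ∀ m → 0ℚ ≤ inv m
  0≤inv zero    = ≤-refl
  0≤inv (suc m) = <⇒≤ (0<inv-suc m)

  0<inv : ∀ {m} → 1 ℕ.≤ m → 0ℚ < inv m
  0<inv {suc m} _ = 0<inv-suc m

  inverse-unique : ∀ {r x y} → r * x ≡ 1ℚ → r * y ≡ 1ℚ → x ≡ y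
  inverse-unique {r} {x} {y} p q = trans (sym (*-identityʳ x)) (trans (cong (x *_) (sym q))
    (trans (lem r x y) (trans (cong (_* y) p) (*-identityˡ y))))
    where
    lem : ∀ r x y → x * (r * y) ≡ r * x * y
    lem = solve-∀ ring

  inv-* : ∀ m n → inv (m ℕ.* n) ≡ inv m * inv n
  inv-* zero n = sym (*-zeroˡ (inv n))
  inv-* (suc m) zero = trans (cong inv (ℕₚ.*-zeroʳ m)) (sym (*-zeroʳ (inv-suc m)))
  inv-* (suc m) (suc n) = inverse-unique {ofℕ (suc m ℕ.* suc n)} (ofℕ*inv-suc (n ℕ.+ m ℕ.* suc n))
    (trans (cong (_* (inv-suc m * inv-suc n)) (ofℕ-* (suc m) (suc n)))
    (trans (lem (ofℕ (suc m)) (ofℕ (suc n)) (inv-suc m) (inv-suc n))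
    (trans (cong₂ _*_ (ofℕ*inv-suc m) (ofℕ*inv-suc n)) (*-identityˡ 1ℚ))))
    where
    lem : ∀ a b c d → a * b * (c * d) ≡ (a * c) * (b * d)
    lem = solve-∀ ring

  inv-antitone : ∀ {m n} → 1 ℕ.≤ m → m ℕ.≤ n → inv n ≤ inv m
  inv-antitone {m} {n} 1≤m m≤n = *-cancel (0<* (0<ofℕ 1≤m) (0<ofℕ 1≤n))
    (subst₂ _≤_ (lem₁ (ofℕ m) (ofℕ n) (inv n) (ofℕ*inv 1≤n)) (lem₂ (ofℕ m) (ofℕ n) (inv m) (ofℕ*inv 1≤m)) (ofℕ-mono m≤n))
    where
    1≤n = ℕₚ.≤-trans 1≤m m≤n
    lem₁ : ∀ a b x → b * x ≡ 1ℚ → a ≡ a * b * x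
    lem₁ a b x e = trans (sym (*-identityʳ a)) (trans (cong (a *_) (sym e)) (sym (*-assoc a b x)))
    lem₂ : ∀ a b x → a * x ≡ 1ℚ → b ≡ a * b * x
    lem₂ a b x e = trans (lem₁ b a x e) (cong (_* x) (*-comm b a))

  ⟦_⟧ : ∀ {P : Set} → Dec P → ℚ
  ⟦ yes _ ⟧ = 1ℚ
  ⟦ no _ ⟧  = 0ℚ

  ⟦⟧-yes : ∀ {P : Set} (d : Dec P) → P → ⟦ d ⟧ ≡ 1ℚ
  ⟦⟧-yes (yes _) p = refl
  ⟦⟧-yes (no ¬p) p = ⊥-elim (¬p p)

  ⟦⟧-no : ∀ {P : Set} (d : Dec P) → ¬ P → ⟦ d ⟧ ≡ 0ℚ
  ⟦⟧-no (yes p) ¬p = ⊥-elim (¬p p)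
  ⟦⟧-no (no _) ¬p = refl

  0≤⟦⟧ : ∀ {P : Set} (d : Dec P) → 0ℚ ≤ ⟦ d ⟧
  0≤⟦⟧ (yes _) = 0≤1
  0≤⟦⟧ (no _)  = ≤-refl

  ⟦⟧≤1 : ∀ {P : Set} (d : Dec P) → ⟦ d ⟧ ≤ 1ℚ
  ⟦⟧≤1 (yes _) = ≤-refl
  ⟦⟧≤1 (no _)  = 0≤1

  ∑ : ℕ → (ℕ → ℚ) → ℚ
  ∑ zero g    = 0ℚ
  ∑ (suc n) g = g 0 + ∑ n (g ∘ suc)

  ∑-mono : ∀ n {g h : ℕ → ℚ} → (∀ j → g j ≤ h j) → ∑ n g ≤ ∑ n h
  ∑-mono zero le    = ≤-refl
  ∑-mono (suc n) le = +-mono-≤ (le 0) (∑-mono n (le ∘ suc))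

  ∑-cong : ∀ n {g h : ℕ → ℚ} → (∀ j → g j ≡ h j) → ∑ n g ≡ ∑ n h
  ∑-cong zero eq    = refl
  ∑-cong (suc n) eq = cong₂ _+_ (eq 0) (∑-cong n (eq ∘ suc))

  -- Random walks

  infixr 8 _^_
  _^_ : ℚ → ℕ → ℚ
  x ^ zero  = 1ℚ
  x ^ suc n = x * x ^ n

  0≤^ : ∀ {x} n → 0ℚ ≤ x → 0ℚ ≤ x ^ n
  0≤^ zero h    = 0≤1
  0≤^ (suc n) h = h 0≤* 0≤^ n h

  avg± : ℚ → (ℚ → ℚ) → ℚ → ℚ
  avg± w F y = ½ * (F (y + w) + F (y - w))

  avg±-mono : ∀ w {F G : ℚ → ℚ} → (∀ y → F y ≤ G y) → ∀ y → avg± w F y ≤ avg± w G y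
  avg±-mono w le y = *-monoˡ 0≤½ (+-mono-≤ (le _) (le _))

  module RandomWalk (p : ℚ) (0≤p : 0ℚ ≤ p) (2p≤1 : p + p ≤ 1ℚ) where

    q : ℚ
    q = 1ℚ - p

    0≤q : 0ℚ ≤ q
    0≤q = subst (0ℚ ≤_) (lem p) (0≤- 2p≤1 0≤+ 0≤p)
      where
      lem : ∀ p → 1ℚ - (p + p) + p ≡ 1ℚ - p
      lem = solve-∀ ring

    step : ℚ → (ℚ → ℚ) → ℚ → ℚ
    step w F y = q * F y + p * avg± w F y

    -- walk w n F y is the expectation of F(y + Σ_{j<n} w_j ξ_j) for independent ξ_j taking the
    -- value 0 with probability 1 − p and ±1 with probability p/2 each.
    walk : (ℕ → ℚ) → ℕ → (ℚ → ℚ) → ℚ → ℚ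
    walk w zero F      = F
    walk w (suc n) F y = step (w 0) (walk (w ∘ suc) n F) y

    step-mono : ∀ w {F G : ℚ → ℚ} → (∀ y → F y ≤ G y) → ∀ y → step w F y ≤ step w G y
    step-mono w le y = +-mono-≤ (*-monoˡ 0≤q (le y)) (*-monoˡ 0≤p (avg±-mono w le y))

    walk-mono : ∀ w n {F G : ℚ → ℚ} → (∀ y → F y ≤ G y) → ∀ y → walk w n F y ≤ walk w n G y
    walk-mono w zero le    = le
    walk-mono w (suc n) le = step-mono (w 0) (walk-mono (w ∘ suc) n le)

    walk-cong : ∀ w n {F G : ℚ → ℚ} → (∀ y → F y ≡ G y) → ∀ y → walk w n F y ≡ walk w n G y
    walk-cong w n eq y = ≤-antisym (walk-mono w n (λ z → ≤-reflexive (eq z)) y)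
                                   (walk-mono w n (λ z → ≤-reflexive (sym (eq z))) y)

    step-cong : ∀ w {F G : ℚ → ℚ} → (∀ y → F y ≡ G y) → ∀ y → step w F y ≡ step w G y
    step-cong w = walk-cong (λ _ → w) 1

    walk-linear : ∀ w n a b (F G : ℚ → ℚ) y →
      walk w n (λ z → a * F z + b * G z) y ≡ a * walk w n F y + b * walk w n G y
    walk-linear w zero a b F G y    = refl
    walk-linear w (suc n) a b F G y =
      trans (step-cong (w 0) (walk-linear (w ∘ suc) n a b F G) y)
            (lem p a b (F′ y) (F′ (y + w 0)) (F′ (y - w 0)) (G′ y) (G′ (y + w 0)) (G′ (y - w 0)))
      where
      F′ = walk (w ∘ suc) n F
      G′ = walk (w ∘ suc) n G
      lem : ∀ p a b x x₁ x₂ y y₁ y₂ →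
        (1ℚ - p) * (a * x + b * y) + p * (½ * ((a * x₁ + b * y₁) + (a * x₂ + b * y₂)))
        ≡ a * ((1ℚ - p) * x + p * (½ * (x₁ + x₂))) + b * ((1ℚ - p) * y + p * (½ * (y₁ + y₂)))
      lem = solve-∀ ring

    walk-const : ∀ w n c y → walk w n (λ _ → c) y ≡ c
    walk-const w zero c y    = refl
    walk-const w (suc n) c y = trans (step-cong (w 0) (walk-const (w ∘ suc) n c) y) (lem p c)
      where
      lem : ∀ p c → (1ℚ - p) * c + p * (½ * (c + c)) ≡ c
      lem = solve-∀ ring

    walk-+ : ∀ w n (F G : ℚ → ℚ) y → walk w n (λ z → F z + G z) y ≡ walk w n F y + walk w n G y
    walk-+ w n F G y =
      trans (walk-cong w n (λ z → sym (cong₂ _+_ (*-identityˡ (F z)) (*-identityˡ (G z)))) y)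
      (trans (walk-linear w n 1ℚ 1ℚ F G y) (cong₂ _+_ (*-identityˡ (walk w n F y)) (*-identityˡ (walk w n G y))))

    walk-* : ∀ w n a (F : ℚ → ℚ) y → walk w n (λ z → a * F z) y ≡ a * walk w n F y
    walk-* w n a F y =
      trans (walk-cong w n (λ z → lem a (F z)) y) (trans (walk-linear w n a 0ℚ F F y) (sym (lem a _)))
      where
      lem : ∀ a x → a * x ≡ a * x + 0ℚ * x
      lem = solve-∀ ring

    walk-∑ : ∀ w n l (F : ℕ → ℚ → ℚ) y → walk w n (λ z → ∑ l (λ j → F j z)) y ≡ ∑ l (λ j → walk w n (F j) y)
    walk-∑ w n zero F y    = walk-const w n 0ℚ y
    walk-∑ w n (suc l) F y = trans (walk-+ w n (F 0) (λ z → ∑ l (λ j → F (suc j) z)) y)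
                                   (cong (walk w n (F 0) y +_) (walk-∑ w n l (F ∘ suc) y))

    walk-≤ : ∀ w n {F : ℚ → ℚ} {c} → (∀ y → F y ≤ c) → ∀ y → walk w n F y ≤ c
    walk-≤ w n {F} {c} le y = ≤-trans (walk-mono w n le y) (≤-reflexive (walk-const w n c y))

    ≤-walk : ∀ w n {F : ℚ → ℚ} {c} → (∀ y → c ≤ F y) → ∀ y → c ≤ walk w n F y
    ≤-walk w n {F} {c} le y = ≤-trans (≤-reflexive (sym (walk-const w n c y))) (walk-mono w n le y)

    walk-weights : ∀ {w w′ : ℕ → ℚ} n → (∀ j → w j ≡ w′ j) → ∀ F y → walk w n F y ≡ walk w′ n F y
    walk-weights zero eq F y = refl
    walk-weights {w} {w′} (suc n) eq F y rewrite eq 0 = step-cong (w′ 0) (walk-weights n (eq ∘ suc) F) y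

    walk-shift : ∀ w n (F : ℚ → ℚ) a y → walk w n (λ z → F (z + a)) y ≡ walk w n F (y + a)
    walk-shift w zero F a y    = refl
    walk-shift w (suc n) F a y =
      trans (step-cong (w 0) (walk-shift (w ∘ suc) n F a) y)
            (cong (λ s → q * F′ (y + a) + p * (½ * s))
              (cong₂ (λ u v → F′ u + F′ v) (lem y (w 0) a) (lem y (- w 0) a)))
      where
      F′ = walk (w ∘ suc) n F
      lem : ∀ y b a → y + b + a ≡ y + a + b
      lem = solve-∀ ring

    walk-neg : ∀ w n (F : ℚ → ℚ) y → walk w n (λ z → F (- z)) y ≡ walk w n F (- y)
    walk-neg w zero F y    = refl
    walk-neg w (suc n) F y =
      trans (step-cong (w 0) (walk-neg (w ∘ suc) n F) y)
            (cong (λ s → q * F′ (- y) + p * (½ * s))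
              (trans (+-comm (F′ (- (y + w 0))) (F′ (- (y - w 0))))
                     (cong₂ (λ u v → F′ u + F′ v) (lem₁ y (w 0)) (lem₂ y (w 0)))))
      where
      F′ = walk (w ∘ suc) n F
      lem₁ : ∀ y a → - (y - a) ≡ - y + a
      lem₁ = solve-∀ ring
      lem₂ : ∀ y a → - (y + a) ≡ - y - a
      lem₂ = solve-∀ ring

    walk-avg± : ∀ w n a (F : ℚ → ℚ) y → walk w n (avg± a F) y ≡ avg± a (walk w n F) y
    walk-avg± w n a F y =
      trans (walk-* w n ½ (λ z → F (z + a) + F (z - a)) y) (cong (½ *_)
      (trans (walk-+ w n (λ z → F (z + a)) (λ z → F (z - a)) y)
             (cong₂ _+_ (walk-shift w n F a y) (walk-shift w n F (- a) y))))

    walk-step : ∀ w n a (F : ℚ → ℚ) y → walk w n (step a F) y ≡ step a (walk w n F) y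
    walk-step w n a F y = trans (walk-linear w n q p F (avg± a F) y)
                                (cong (λ s → q * walk w n F y + p * s) (walk-avg± w n a F y))

    walk-split : ∀ w l n (F : ℚ → ℚ) y →
      walk w (l ℕ.+ n) F y ≡ walk w l (walk (λ j → w (l ℕ.+ j)) n F) y
    walk-split w zero n F y    = refl
    walk-split w (suc l) n F y = step-cong (w 0) (walk-split (w ∘ suc) l n F) y

    walk-near : ∀ w l {g : ℚ → ℚ} {M} → (∀ y → 0ℚ ≤ g y) → (∀ y → g y ≤ M) →
      ∀ y → walk w l g y ≤ g y + ofℕ l * p * M
    walk-near w zero {g} {M} 0≤g g≤M y = ≤-reflexive (lem (g y) p M)
      where
      lem : ∀ x p M → x ≡ x + 0ℚ * p * M
      lem = solve-∀ ring
    walk-near w (suc l) {g} {M} 0≤g g≤M y rewrite ofℕ-suc l =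
      lem (g y) p M (ofℕ l) (g′ y) (g′ (y + w 0)) (g′ (y - w 0)) (0≤ofℕ l) (≤-trans (0≤g y) (g≤M y))
          (walk-near (w ∘ suc) l 0≤g g≤M y) (0≤g y) (walk-≤ _ l g≤M _) (walk-≤ _ l g≤M _) 0≤q
      where
      g′ = walk (w ∘ suc) l g
      alg : ∀ x p M l a b c → x + (1ℚ + l) * p * M ≡ ((1ℚ - p) * a + p * (½ * (b + c))) +
         ((1ℚ - p) * (x + l * p * M - a) + p * (½ * ((M - b) + (M - c))) + p * x + p * p * l * M)
      alg = solve-∀ ring
      lem : ∀ x p′ M l a b c → 0ℚ ≤ l → 0ℚ ≤ M → a ≤ x + l * p * M → 0ℚ ≤ x → b ≤ M → c ≤ M → 0ℚ ≤ q →
         q * a + p * (½ * (b + c)) ≤ x + (1ℚ + l) * p * M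
      lem x _ M l a b c 0≤l 0≤M h 0≤x b≤M c≤M 0≤q = ≤-by (alg x p M l a b c)
        (0≤q 0≤* 0≤- h 0≤+ 0≤p 0≤* (0≤½ 0≤* (0≤- b≤M 0≤+ 0≤- c≤M)) 0≤+ 0≤p 0≤* 0≤x 0≤+ 0≤p 0≤* 0≤p 0≤* 0≤l 0≤* 0≤M)

    -- Split according to whether exactly one of the l steps moves: the sum accounts for that event,
    -- and the remaining probability is at most 1 − lp + (lp)².
    walk-one-move : ∀ w l {g : ℚ → ℚ} {M} → (∀ y → 0ℚ ≤ g y) → (∀ y → g y ≤ M) → ∀ y →
      walk w l g y ≤ p * ∑ l (λ j → avg± (w j) g y) + (1ℚ - ofℕ l * p + ofℕ l * p * (ofℕ l * p)) * M
    walk-one-move w zero {g} {M} 0≤g g≤M y = ≤-trans (g≤M y) (≤-reflexive (lem p M))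
      where
      lem : ∀ p M → M ≡ p * 0ℚ + (1ℚ - 0ℚ * p + 0ℚ * p * (0ℚ * p)) * M
      lem = solve-∀ ring
    walk-one-move w (suc l) {g} {M} 0≤g g≤M y rewrite ofℕ-suc l =
      ≤-by (alg p M (ofℕ l) (walk (w ∘ suc) l g y) (avg± (w 0) g′ y) (avg± (w 0) g y) S)
        (0≤q 0≤* 0≤- (walk-one-move (w ∘ suc) l 0≤g g≤M y) 0≤+ 0≤p 0≤* 0≤- near
         0≤+ 0≤p 0≤* 0≤p 0≤* 0≤S 0≤+ 0≤p 0≤* 0≤p 0≤* 0≤M 0≤+ 0≤p 0≤* 0≤p 0≤* 0≤p 0≤* (0≤l 0≤* 0≤l) 0≤* 0≤M)
      where
      g′ = walk (w ∘ suc) l g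
      S = ∑ l (λ j → avg± (w (suc j)) g y)
      0≤l = 0≤ofℕ l
      0≤M = ≤-trans (0≤g y) (g≤M y)
      0≤∑ : ∀ n (v : ℕ → ℚ) → 0ℚ ≤ ∑ n (λ j → avg± (v j) g y)
      0≤∑ zero v    = ≤-refl
      0≤∑ (suc n) v = 0≤½ 0≤* (0≤g _ 0≤+ 0≤g _) 0≤+ 0≤∑ n (v ∘ suc)
      0≤S = 0≤∑ l (w ∘ suc)
      near : avg± (w 0) g′ y ≤ avg± (w 0) g y + ofℕ l * p * M
      near = ≤-trans (avg±-mono (w 0) (walk-near (w ∘ suc) l 0≤g g≤M) y)
                     (≤-reflexive (lem (g (y + w 0)) (g (y - w 0)) (ofℕ l * p * M)))
        where
        lem : ∀ a b c → ½ * (a + c + (b + c)) ≡ ½ * (a + b) + c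
        lem = solve-∀ ring
      alg : ∀ p M l a b c S →
        p * (c + S) + (1ℚ - (1ℚ + l) * p + (1ℚ + l) * p * ((1ℚ + l) * p)) * M
        ≡ (1ℚ - p) * a + p * b
          + ((1ℚ - p) * (p * S + (1ℚ - l * p + l * p * (l * p)) * M - a) + p * (c + l * p * M - b)
             + p * p * S + p * p * M + p * p * p * (l * l) * M)
      alg = solve-∀ ring

    -- Every block of L steps either moves exactly once, which spreads the mass as recorded by D,
    -- or loses a constant factor; U is a potential that sums up the resulting recursion.
    walk-blocks : ∀ L ρ → 0ℚ ≤ ρ → 1ℚ - ofℕ L * p + ofℕ L * p * (ofℕ L * p) ≤ ρ →
      ∀ {F : ℚ → ℚ} → (∀ y → 0ℚ ≤ F y) → (∀ y → F y ≤ 1ℚ) →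
      ∀ t rest w (D U : ℕ → ℚ) →
      (∀ a y → p * ∑ L (λ j → avg± (w (a ℕ.* L ℕ.+ j)) F y) ≤ D a) →
      (∀ a → 0ℚ ≤ U a) → (∀ a → D a + ρ * U (suc a) ≤ U a) →
      ∀ y → walk w (t ℕ.* L ℕ.+ rest) F y ≤ U 0 + ρ ^ t
    walk-blocks L ρ 0≤ρ con {F} 0≤F F≤1 zero rest w D U hD 0≤U hU y =
      ≤-trans (walk-≤ w rest F≤1 y) (≤-by (+-comm (U 0) 1ℚ) (0≤U 0))
    walk-blocks L ρ 0≤ρ con {F} 0≤F F≤1 (suc t) rest w D U hD 0≤U hU y =
      subst (λ n → walk w n F y ≤ U 0 + ρ * ρ ^ t) (sym (ℕₚ.+-assoc L (t ℕ.* L) rest))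
      (≤-trans (≤-reflexive (walk-split w L n F y))
      (≤-trans (walk-one-move w L {g} {M} 0≤g g≤M y)
      (≤-trans (+-mono-≤ spread (*-monoʳ 0≤M con))
        (≤-by (alg (D 0) (U 0) (U 1) ρ (ρ ^ t)) (0≤- (hU 0))))))
      where
      n = t ℕ.* L ℕ.+ rest
      w′ : ℕ → ℚ
      w′ j = w (L ℕ.+ j)
      g = walk w′ n F
      M = U 1 + ρ ^ t
      0≤M : 0ℚ ≤ M
      0≤M = 0≤U 1 0≤+ 0≤^ t 0≤ρ
      0≤g : ∀ y → 0ℚ ≤ g y
      0≤g = ≤-walk w′ n 0≤F
      hD′ : ∀ a y → p * ∑ L (λ j → avg± (w′ (a ℕ.* L ℕ.+ j)) F y) ≤ D (suc a)
      hD′ a y = ≤-trans (≤-reflexive (cong (p *_) (∑-cong L λ j →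
        cong (λ i → avg± (w i) F y) (sym (ℕₚ.+-assoc L (a ℕ.* L) j))))) (hD (suc a) y)
      g≤M : ∀ y → g y ≤ M
      g≤M = walk-blocks L ρ 0≤ρ con 0≤F F≤1 t rest w′ (D ∘ suc) (U ∘ suc) hD′ (0≤U ∘ suc) (hU ∘ suc)
      spread : p * ∑ L (λ j → avg± (w j) g y) ≤ D 0
      spread = ≤-trans (≤-reflexive (trans
        (cong (p *_) (trans (∑-cong L (λ j → sym (walk-avg± w′ n (w j) F y))) (sym (walk-∑ w′ n L (λ j → avg± (w j) F) y))))
        (sym (walk-* w′ n p (λ z → ∑ L (λ j → avg± (w j) F z)) y)))) (walk-≤ w′ n (hD 0) y)
      alg : ∀ d u u₁ ρ r → u + ρ * r ≡ d + ρ * (u₁ + r) + (u - (d + ρ * u₁))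
      alg = solve-∀ ring

    walk-drop : ∀ w m {F : ℚ → ℚ} → (∀ y → 0ℚ ≤ F y) → ∀ y → q ^ m * F y ≤ walk w m F y
    walk-drop w zero {F} 0≤F y    = ≤-reflexive (*-identityˡ (F y))
    walk-drop w (suc m) {F} 0≤F y =
      ≤-by (alg q p (walk (w ∘ suc) m F y) (avg± (w 0) (walk (w ∘ suc) m F) y) (F y) (q ^ m))
        (0≤q 0≤* 0≤- (walk-drop (w ∘ suc) m 0≤F y)
         0≤+ 0≤p 0≤* (0≤½ 0≤* (≤-walk (w ∘ suc) m 0≤F _ 0≤+ ≤-walk (w ∘ suc) m 0≤F _)))
      where
      alg : ∀ q p a b x c → q * a + p * b ≡ q * c * x + (q * (a - c * x) + p * b)
      alg = solve-∀ ring

    walk-union : ∀ w m {F : ℚ → ℚ} → (∀ y → 0ℚ ≤ F y) → (∀ y → F y ≤ 1ℚ) → ∀ y → walk w m F y ≤ F y + ofℕ m * p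
    walk-union w m {F} 0≤F F≤1 y = ≤-trans (walk-near w m 0≤F F≤1 y) (≤-reflexive (cong (F y +_) (*-identityʳ _)))

    walk-half : ∀ w m {F : ℚ → ℚ} → (∀ y → F y ≤ 1ℚ) → (∀ j → j ℕ.< m → ∀ y → avg± (w j) F y ≤ ½) →
      ∀ y → walk w m F y ≤ ½ + ½ * q ^ m
    walk-half w zero F≤1 h y = F≤1 y
    walk-half w (suc m) {F} F≤1 h y =
      ≤-by (alg p (walk (w ∘ suc) m F y) (avg± (w 0) (walk (w ∘ suc) m F) y) (q ^ m))
        (0≤q 0≤* 0≤- (walk-half (w ∘ suc) m F≤1 (λ j j<m → h (suc j) (ℕ.s≤s j<m)) y)
         0≤+ 0≤p 0≤* 0≤- (≤-trans (≤-reflexive (sym (walk-avg± (w ∘ suc) m (w 0) F y))) (walk-≤ (w ∘ suc) m (h 0 (ℕ.s≤s ℕ.z≤n)) y)))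
      where
      alg : ∀ p a b r → ½ + ½ * ((1ℚ - p) * r) ≡ (1ℚ - p) * a + p * b + ((1ℚ - p) * (½ + ½ * r - a) + p * (½ - b))
      alg = solve-∀ ring

  -- Small-ball lower bound

  ∑-telescope : ∀ n (h : ℕ → ℚ) → ∑ n (λ j → h j - h (suc j)) ≡ h 0 - h n
  ∑-telescope zero h    = sym (+-inverseʳ (h 0))
  ∑-telescope (suc n) h = trans (cong (h 0 - h 1 +_) (∑-telescope n (h ∘ suc))) (lem (h 0) (h 1) (h (suc n)))
    where
    lem : ∀ a b c → a - b + (b - c) ≡ a - c
    lem = solve-∀ ring

  ∑-+ : ∀ n (g h : ℕ → ℚ) → ∑ n (λ j → g j + h j) ≡ ∑ n g + ∑ n h
  ∑-+ zero g h    = refl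
  ∑-+ (suc n) g h = trans (cong (g 0 + h 0 +_) (∑-+ n (g ∘ suc) (h ∘ suc))) (lem (g 0) (h 0) _ _)
    where
    lem : ∀ a b c d → a + b + (c + d) ≡ a + c + (b + d)
    lem = solve-∀ ring

  ∑-* : ∀ n c (g : ℕ → ℚ) → ∑ n (λ j → c * g j) ≡ c * ∑ n g
  ∑-* zero c g    = sym (*-zeroʳ c)
  ∑-* (suc n) c g = trans (cong (c * g 0 +_) (∑-* n c (g ∘ suc))) (sym (*-distribˡ-+ c (g 0) _))

  ∑-const : ∀ n c → ∑ n (λ _ → c) ≡ ofℕ n * c
  ∑-const zero c    = sym (*-zeroˡ c)
  ∑-const (suc n) c = trans (cong (c +_) (∑-const n c)) (trans (lem c (ofℕ n)) (cong (_* c) (sym (ofℕ-suc n))))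
    where
    lem : ∀ c n → c + n * c ≡ (1ℚ + n) * c
    lem = solve-∀ ring

  0≤∑ : ∀ n {g : ℕ → ℚ} → (∀ j → 0ℚ ≤ g j) → 0ℚ ≤ ∑ n g
  0≤∑ zero h    = ≤-refl
  0≤∑ (suc n) h = h 0 0≤+ 0≤∑ n (h ∘ suc)

  cell : ℚ → ℚ → ℚ → ℚ
  cell s s′ y = ⟦ s ≤? y ⟧ - ⟦ s′ ≤? y ⟧

  cell-cases : ∀ {s s′} → s ≤ s′ → ∀ y → (cell s s′ y ≡ 1ℚ × s ≤ y × y ≤ s′) ⊎ cell s s′ y ≡ 0ℚ
  cell-cases {s} {s′} s≤s′ y with s ≤? y | s′ ≤? y
  ... | yes a | yes b = inj₂ refl
  ... | yes a | no b  = inj₁ (refl , a , ≰⇒≥ b)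
  ... | no a  | yes b = ⊥-elim (a (≤-trans s≤s′ b))
  ... | no a  | no b  = inj₂ refl

  cell≤1 : ∀ {s s′} → s ≤ s′ → ∀ y → cell s s′ y ≤ 1ℚ
  cell≤1 s≤s′ y with cell-cases s≤s′ y
  ... | inj₁ (e , _) = ≤-reflexive e
  ... | inj₂ e       = ≤-trans (≤-reflexive e) 0≤1

  cell-pair : ∀ {s s′ t} {F : ℚ → ℚ} → s ≤ s′ → s′ ≤ s + t → (∀ x → 0ℚ ≤ F x) → (∀ x → ∣ x ∣ ≤ t → 1ℚ ≤ F x) →
    ∀ y y′ → cell s s′ y * cell s s′ y′ ≤ cell s s′ y * F (y - y′)
  cell-pair {s} {s′} {t} {F} s≤s′ w 0≤F 1≤F y y′ with cell-cases s≤s′ y | cell-cases s≤s′ y′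
  ... | inj₂ e | _ rewrite e = ≤-reflexive (trans (*-zeroˡ (cell s s′ y′)) (sym (*-zeroˡ (F (y - y′)))))
  ... | inj₁ (e , _) | inj₂ e′ rewrite e | e′ = subst (0ℚ ≤_) (sym (*-identityˡ (F (y - y′)))) (0≤F (y - y′))
  ... | inj₁ (e , s≤y , y≤s′) | inj₁ (e′ , s≤y′ , y′≤s′) rewrite e | e′ =
    *-monoˡ 0≤1 (1≤F (y - y′) (∣∣-≤ (close s≤y′ y≤s′) (subst (_≤ t) (flip y y′) (close s≤y y′≤s′))))
    where
    alg : ∀ s s′ t a b → t ≡ (b - a) + ((a - s) + (s′ - b) + (s + t - s′))
    alg = solve-∀ ring
    close : ∀ {a b} → s ≤ a → b ≤ s′ → b - a ≤ t
    close {a} {b} p r = ≤-by (alg s s′ t a b) (0≤- p 0≤+ 0≤- r 0≤+ 0≤- w)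
    flip : ∀ y y′ → y′ - y ≡ - (y - y′)
    flip = solve-∀ ring

  outside : ∀ {R ρ y} → ρ * (R * R) ≡ 1ℚ → 0ℚ ≤ ρ → R * R ≤ y * y → 1ℚ - ρ * (y * y) ≤ 0ℚ
  outside {R} {ρ} {y} ρR 0≤ρ h = ≤-by (sym (trans (cong (λ o → o - ρ * (y * y) + ρ * (y * y - R * R)) (sym ρR)) (alg ρ (y * y) (R * R))))
    (0≤ρ 0≤* 0≤- h)
    where
    alg : ∀ ρ y r → ρ * r - ρ * y + ρ * (y - r) ≡ 0ℚ
    alg = solve-∀ ring

  window : ∀ {R ρ} → 0ℚ ≤ R → ρ * (R * R) ≡ 1ℚ → 0ℚ ≤ ρ → ∀ y → 1ℚ - ρ * (y * y) ≤ cell (- R) R y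
  window {R} {ρ} 0≤R ρR 0≤ρ y with - R ≤? y | R ≤? y
  ... | yes a | yes b = outside {R} {ρ} {y} ρR 0≤ρ (sq-mono 0≤R b)
  ... | yes a | no b  = ≤-by (alg (ρ * (y * y))) (0≤ρ 0≤* 0≤sq y)
    where
    alg : ∀ z → 1ℚ - 0ℚ ≡ 1ℚ - z + z
    alg = solve-∀ ring
  ... | no a  | yes b = ⊥-elim (a (≤-trans (≤-trans (neg-antimono-≤ 0≤R) 0≤R) b))
  ... | no a  | no b  = outside {R} {ρ} {y} ρR 0≤ρ (subst (R * R ≤_) (neg-sq y) (sq-mono 0≤R (subst (_≤ - y) (neg-neg R) (neg-antimono-≤ (≰⇒≥ a)))))

  module Cells (p : ℚ) (0≤p : 0ℚ ≤ p) (2p≤1 : p + p ≤ 1ℚ) where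
    open RandomWalk p 0≤p 2p≤1

    ¼ : ℚ
    ¼ = ½ * ½

    0≤¼ : 0ℚ ≤ ¼
    0≤¼ = nonNegative⁻¹ ¼

    -- The increment w ξ of a step is distributed as w (c σ − c σ′)/2 with σ, σ′ independent signs
    -- and c a common Bernoulli(2p) variable.  Hence, conditionally on all the c's, the walk is the
    -- difference of two independent copies, and pairWalk follows the two copies.
    step₂ : ℚ → (ℚ → ℚ → ℚ) → ℚ → ℚ → ℚ
    step₂ w H y y′ = (1ℚ - (p + p)) * H y y′
      + (p + p) * (¼ * (H (y + ½ * w) (y′ + ½ * w) + H (y + ½ * w) (y′ - ½ * w)
                       + H (y - ½ * w) (y′ + ½ * w) + H (y - ½ * w) (y′ - ½ * w)))

    pairWalk : (ℕ → ℚ) → ℕ → (ℚ → ℚ → ℚ) → ℚ → ℚ → ℚ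
    pairWalk w zero H    = H
    pairWalk w (suc n) H = pairWalk (w ∘ suc) n (step₂ (w 0) H)

    0≤1-2p : 0ℚ ≤ 1ℚ - (p + p)
    0≤1-2p = 0≤- 2p≤1

    pairWalk-mono : ∀ w n {H K : ℚ → ℚ → ℚ} → (∀ y y′ → H y y′ ≤ K y y′) → ∀ y y′ → pairWalk w n H y y′ ≤ pairWalk w n K y y′
    pairWalk-mono w zero le    = le
    pairWalk-mono w (suc n) le = pairWalk-mono (w ∘ suc) n λ y y′ →
      +-mono-≤ (*-monoˡ 0≤1-2p (le y y′)) (*-monoˡ (0≤p 0≤+ 0≤p) (*-monoˡ 0≤¼
        (+-mono-≤ (+-mono-≤ (+-mono-≤ (le _ _) (le _ _)) (le _ _)) (le _ _))))

    pairWalk-cong : ∀ w n {H K : ℚ → ℚ → ℚ} → (∀ y y′ → H y y′ ≡ K y y′) → ∀ y y′ → pairWalk w n H y y′ ≡ pairWalk w n K y y′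
    pairWalk-cong w n eq y y′ = ≤-antisym (pairWalk-mono w n (λ a b → ≤-reflexive (eq a b)) y y′)
                                          (pairWalk-mono w n (λ a b → ≤-reflexive (sym (eq a b))) y y′)

    pairWalk-linear : ∀ w n a b (H K : ℚ → ℚ → ℚ) y y′ →
      pairWalk w n (λ z z′ → a * H z z′ + b * K z z′) y y′ ≡ a * pairWalk w n H y y′ + b * pairWalk w n K y y′
    pairWalk-linear w zero a b H K y y′    = refl
    pairWalk-linear w (suc n) a b H K y y′ =
      trans (pairWalk-cong (w ∘ suc) n (λ z z′ → alg p a b
              (H z z′) (H (z + u) (z′ + u)) (H (z + u) (z′ - u)) (H (z - u) (z′ + u)) (H (z - u) (z′ - u))
              (K z z′) (K (z + u) (z′ + u)) (K (z + u) (z′ - u)) (K (z - u) (z′ + u)) (K (z - u) (z′ - u))) y y′)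
            (pairWalk-linear (w ∘ suc) n a b (step₂ (w 0) H) (step₂ (w 0) K) y y′)
      where
      u = ½ * w 0
      alg : ∀ p a b h h₁ h₂ h₃ h₄ k k₁ k₂ k₃ k₄ →
        (1ℚ - (p + p)) * (a * h + b * k) + (p + p) * (½ * ½ * (a * h₁ + b * k₁ + (a * h₂ + b * k₂) + (a * h₃ + b * k₃) + (a * h₄ + b * k₄)))
        ≡ a * ((1ℚ - (p + p)) * h + (p + p) * (½ * ½ * (h₁ + h₂ + h₃ + h₄))) + b * ((1ℚ - (p + p)) * k + (p + p) * (½ * ½ * (k₁ + k₂ + k₃ + k₄)))
      alg = solve-∀ ring

    pairWalk-difference : ∀ w n (F : ℚ → ℚ) y y′ → pairWalk w n (λ z z′ → F (z - z′)) y y′ ≡ walk w n F (y - y′)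
    pairWalk-difference w zero F y y′    = refl
    pairWalk-difference w (suc n) F y y′ =
      trans (pairWalk-cong (w ∘ suc) n merge y y′)
      (trans (pairWalk-difference (w ∘ suc) n (step (w 0) F) y y′) (walk-step (w ∘ suc) n (w 0) F (y - y′)))
      where
      e₁ : ∀ z z′ w → z + ½ * w - (z′ + ½ * w) ≡ z - z′
      e₁ = solve-∀ ring
      e₂ : ∀ z z′ w → z + ½ * w - (z′ - ½ * w) ≡ z - z′ + w
      e₂ = solve-∀ ring
      e₃ : ∀ z z′ w → z - ½ * w - (z′ + ½ * w) ≡ z - z′ - w
      e₃ = solve-∀ ring
      e₄ : ∀ z z′ w → z - ½ * w - (z′ - ½ * w) ≡ z - z′
      e₄ = solve-∀ ring
      alg : ∀ p a b c → (1ℚ - (p + p)) * a + (p + p) * (½ * ½ * (a + b + c + a)) ≡ (1ℚ - p) * a + p * (½ * (b + c))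
      alg = solve-∀ ring
      merge : ∀ z z′ → step₂ (w 0) (λ z z′ → F (z - z′)) z z′ ≡ step (w 0) F (z - z′)
      merge z z′ = trans
        (cong₂ (λ a b → (1ℚ - (p + p)) * F (z - z′) + (p + p) * (¼ * (a + b)))
          (cong₂ _+_ (cong₂ _+_ (cong F (e₁ z z′ (w 0))) (cong F (e₂ z z′ (w 0)))) (cong F (e₃ z z′ (w 0))))
          (cong F (e₄ z z′ (w 0))))
        (alg p (F (z - z′)) (F (z - z′ + w 0)) (F (z - z′ - w 0)))

    pairWalk-diagonal : ∀ w n (ψ : ℚ → ℚ) y → 0ℚ ≤ pairWalk w n (λ z z′ → ψ z * ψ z′) y y
    pairWalk-diagonal w zero ψ y    = 0≤sq (ψ y)
    pairWalk-diagonal w (suc n) ψ y = subst (0ℚ ≤_) (sym (trans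
      (pairWalk-cong (w ∘ suc) n (λ z z′ → alg p (ψ z) (ψ z′) (ψ (z + ½ * w 0)) (ψ (z - ½ * w 0)) (ψ (z′ + ½ * w 0)) (ψ (z′ - ½ * w 0))) y y)
      (pairWalk-linear (w ∘ suc) n (1ℚ - (p + p)) (p + p) (λ z z′ → ψ z * ψ z′) (λ z z′ → ψ₀ z * ψ₀ z′) y y)))
      (0≤1-2p 0≤* pairWalk-diagonal (w ∘ suc) n ψ y 0≤+ (0≤p 0≤+ 0≤p) 0≤* pairWalk-diagonal (w ∘ suc) n ψ₀ y)
      where
      ψ₀ = avg± (½ * w 0) ψ
      alg : ∀ p a a′ b c b′ c′ → (1ℚ - (p + p)) * (a * a′) + (p + p) * (½ * ½ * (b * b′ + b * c′ + c * b′ + c * c′))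
        ≡ (1ℚ - (p + p)) * (a * a′) + (p + p) * (½ * (b + c) * (½ * (b′ + c′)))
      alg = solve-∀ ring

    pairWalk-∑ : ∀ w n l (H : ℕ → ℚ → ℚ → ℚ) {y y′} → (∀ j → 0ℚ ≤ pairWalk w n (H j) y y′) →
      0ℚ ≤ pairWalk w n (λ z z′ → ∑ l (λ j → H j z z′)) y y′
    pairWalk-∑ w n zero H {y} {y′} h = subst (0ℚ ≤_)
      (trans (alg (pairWalk w n (λ _ _ → 0ℚ) y y′)) (sym (trans (pairWalk-cong w n (λ _ _ → refl) y y′) (pairWalk-linear w n 0ℚ 0ℚ (λ _ _ → 0ℚ) (λ _ _ → 0ℚ) y y′)))) ≤-refl
      where
      alg : ∀ a → 0ℚ ≡ 0ℚ * a + 0ℚ * a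
      alg = solve-∀ ring
    pairWalk-∑ w n (suc l) H {y} {y′} h = subst (0ℚ ≤_)
      (sym (trans (pairWalk-cong w n (λ z z′ → alg (H 0 z z′) (∑ l (λ j → H (suc j) z z′))) y y′)
           (pairWalk-linear w n 1ℚ 1ℚ (H 0) (λ z z′ → ∑ l (λ j → H (suc j) z z′)) y y′)))
      (0≤1 0≤* h 0 0≤+ 0≤1 0≤* pairWalk-∑ w n l (H ∘ suc) (h ∘ suc))
      where
      alg : ∀ a b → a + b ≡ 1ℚ * a + 1ℚ * b
      alg = solve-∀ ring

    pairWalk-quadratic : ∀ w n c b y y′ →
      pairWalk w n (λ z z′ → c + b * (z * z + z′ * z′)) y y′ ≡ c + b * (y * y + y′ * y′) + b * (p * ∑ n (λ j → w j * w j))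
    pairWalk-quadratic w zero c b y y′    = alg (c + b * (y * y + y′ * y′)) b p
      where
      alg : ∀ x b p → x ≡ x + b * (p * 0ℚ)
      alg = solve-∀ ring
    pairWalk-quadratic w (suc n) c b y y′ =
      trans (pairWalk-cong (w ∘ suc) n (λ z z′ → alg p c b (w 0) z z′) y y′)
      (trans (pairWalk-quadratic (w ∘ suc) n (c + b * (p * (w 0 * w 0))) b y y′) (alg₂ c b p (y * y + y′ * y′) (w 0 * w 0) (∑ n (λ j → w (suc j) * w (suc j)))))
      where
      alg : ∀ p c b w z z′ →
        (1ℚ - (p + p)) * (c + b * (z * z + z′ * z′)) + (p + p) * (½ * ½ *
          (c + b * ((z + ½ * w) * (z + ½ * w) + (z′ + ½ * w) * (z′ + ½ * w))
          + (c + b * ((z + ½ * w) * (z + ½ * w) + (z′ - ½ * w) * (z′ - ½ * w)))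
          + (c + b * ((z - ½ * w) * (z - ½ * w) + (z′ + ½ * w) * (z′ + ½ * w)))
          + (c + b * ((z - ½ * w) * (z - ½ * w) + (z′ - ½ * w) * (z′ - ½ * w)))))
        ≡ c + b * (p * (w * w)) + b * (z * z + z′ * z′)
      alg = solve-∀ ring
      alg₂ : ∀ c b p x s S → c + b * (p * s) + b * x + b * (p * S) ≡ c + b * x + b * (p * (s + S))
      alg₂ = solve-∀ ring

    -- Cauchy–Schwarz over N cells of width t that partition [−R, R): the two conditionally
    -- independent copies share a cell with probability of order at least 1/N.
    small-ball : ∀ w n {F : ℚ → ℚ} N {t R ρ} μ → 0ℚ ≤ t → 0ℚ ≤ R → ofℕ N * t ≡ R + R → ρ * (R * R) ≡ 1ℚ → 0ℚ ≤ ρ → 0ℚ ≤ μ →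
      (∀ x → 0ℚ ≤ F x) → (∀ x → ∣ x ∣ ≤ t → 1ℚ ≤ F x) → (∀ x → F x ≤ 1ℚ) →
      μ + μ - ofℕ N * (μ * μ) - μ * ρ * (p * ∑ n (λ j → w j * w j)) ≤ walk w n F 0ℚ
    small-ball w n {F} N {t} {R} {ρ} μ 0≤t 0≤R Nt ρR 0≤ρ 0≤μ 0≤F 1≤F F≤1 =
      ≤-trans bound (≤-reflexive (pairWalk-difference w n F 0ℚ 0ℚ))
      where
      s : ℕ → ℚ
      s j = ofℕ j * t - R
      φ : ℕ → ℚ → ℚ
      φ j = cell (s j) (s (suc j))
      s-suc : ∀ j → s (suc j) ≡ s j + t
      s-suc j = trans (cong (λ i → i * t - R) (ofℕ-suc j)) (alg (ofℕ j) t R)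
        where
        alg : ∀ j t R → (1ℚ + j) * t - R ≡ j * t - R + t
        alg = solve-∀ ring
      s≤s : ∀ j → s j ≤ s (suc j)
      s≤s j = ≤-by (s-suc j) 0≤t
      s0 : s 0 ≡ - R
      s0 = alg t R
        where
        alg : ∀ t R → 0ℚ * t - R ≡ - R
        alg = solve-∀ ring
      sN : s N ≡ R
      sN = trans (cong (_- R) Nt) (alg R)
        where
        alg : ∀ R → R + R - R ≡ R
        alg = solve-∀ ring
      ∑φ : ∀ y → ∑ N (λ j → φ j y) ≡ cell (- R) R y
      ∑φ y = trans (∑-telescope N (λ j → ⟦ s j ≤? y ⟧)) (cong₂ (λ a b → cell a b y) s0 sN)
      -R≤R : - R ≤ R
      -R≤R = ≤-trans (neg-antimono-≤ 0≤R) 0≤R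
      ∑φ≤1 : ∀ y → ∑ N (λ j → φ j y) ≤ 1ℚ
      ∑φ≤1 y = ≤-trans (≤-reflexive (∑φ y)) (cell≤1 -R≤R y)
      ∑φ-lower : ∀ y → 1ℚ - ρ * (y * y) ≤ ∑ N (λ j → φ j y)
      ∑φ-lower y = ≤-trans (window 0≤R ρR 0≤ρ y) (≤-reflexive (sym (∑φ y)))
      same-cell : ∀ y y′ → ∑ N (λ j → φ j y * φ j y′) ≤ F (y - y′)
      same-cell y y′ = ≤-trans (∑-mono N (λ j → cell-pair (s≤s j) (≤-reflexive (s-suc j)) 0≤F 1≤F y y′))
        (≤-trans (≤-reflexive (trans (∑-cong N (λ j → *-comm (φ j y) (F (y - y′)))) (∑-* N (F (y - y′)) (λ j → φ j y))))
          (≤-trans (*-monoˡ (0≤F (y - y′)) (∑φ≤1 y)) (≤-reflexive (*-identityʳ (F (y - y′))))))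
      ψ : ℕ → ℚ → ℚ
      ψ j y = φ j y - μ
      c = μ + μ - ofℕ N * (μ * μ)
      b = - (μ * ρ)
      expand : ∀ y y′ → ∑ N (λ j → φ j y * φ j y′) ≡ ∑ N (λ j → ψ j y * ψ j y′) +
                 (μ * ∑ N (λ j → φ j y) + μ * ∑ N (λ j → φ j y′) - ofℕ N * (μ * μ))
      expand y y′ = trans (∑-cong N (λ j → alg μ (φ j y) (φ j y′)))
        (trans (∑-+ N (λ j → ψ j y * ψ j y′) (λ j → μ * φ j y + μ * φ j y′ + - (μ * μ)))
        (cong (∑ N (λ j → ψ j y * ψ j y′) +_) (trans (∑-+ N (λ j → μ * φ j y + μ * φ j y′) (λ _ → - (μ * μ)))
          (cong₂ _+_ (trans (∑-+ N (λ j → μ * φ j y) (λ j → μ * φ j y′)) (cong₂ _+_ (∑-* N μ (λ j → φ j y)) (∑-* N μ (λ j → φ j y′))))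
            (trans (∑-const N (- (μ * μ))) (alg₂ (ofℕ N) (μ * μ)))))))
        where
        alg : ∀ μ a b → a * b ≡ (a - μ) * (b - μ) + (μ * a + μ * b + - (μ * μ))
        alg = solve-∀ ring
        alg₂ : ∀ n a → n * - a ≡ - (n * a)
        alg₂ = solve-∀ ring
      pointwise : ∀ y y′ → 1ℚ * ∑ N (λ j → ψ j y * ψ j y′) + 1ℚ * (c + b * (y * y + y′ * y′)) ≤ F (y - y′)
      pointwise y y′ = ≤-trans (≤-by (alg μ (ofℕ N) ρ (y * y) (y′ * y′) (∑ N (λ j → φ j y)) (∑ N (λ j → φ j y′)) (∑ N (λ j → ψ j y * ψ j y′)))
        (0≤μ 0≤* 0≤- (∑φ-lower y) 0≤+ 0≤μ 0≤* 0≤- (∑φ-lower y′)))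
        (subst (_≤ F (y - y′)) (expand y y′) (same-cell y y′))
        where
        alg : ∀ μ n ρ u v a b S → S + (μ * a + μ * b - n * (μ * μ)) ≡
          1ℚ * S + 1ℚ * (μ + μ - n * (μ * μ) + - (μ * ρ) * (u + v)) + (μ * (a - (1ℚ - ρ * u)) + μ * (b - (1ℚ - ρ * v)))
        alg = solve-∀ ring
      bound : c - μ * ρ * (p * ∑ n (λ j → w j * w j)) ≤ pairWalk w n (λ z z′ → F (z - z′)) 0ℚ 0ℚ
      bound = ≤-trans
        (≤-by (alg P c (μ * ρ) (p * ∑ n (λ j → w j * w j)) (pairWalk w n (λ y y′ → c + b * (y * y + y′ * y′)) 0ℚ 0ℚ) (pairWalk-quadratic w n c b 0ℚ 0ℚ))
              (pairWalk-∑ w n N (λ j y y′ → ψ j y * ψ j y′) (λ j → pairWalk-diagonal w n (ψ j) 0ℚ)))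
        (≤-trans (≤-reflexive (sym (pairWalk-linear w n 1ℚ 1ℚ (λ y y′ → ∑ N (λ j → ψ j y * ψ j y′)) (λ y y′ → c + b * (y * y + y′ * y′)) 0ℚ 0ℚ)))
          (pairWalk-mono w n pointwise 0ℚ 0ℚ))
        where
        P = pairWalk w n (λ y y′ → ∑ N (λ j → ψ j y * ψ j y′)) 0ℚ 0ℚ
        alg₀ : ∀ P c m s → 1ℚ * P + 1ℚ * (c + - m * (0ℚ * 0ℚ + 0ℚ * 0ℚ) + - m * s) ≡ c - m * s + P
        alg₀ = solve-∀ ring
        alg : ∀ P c m s K → K ≡ c + - m * (0ℚ * 0ℚ + 0ℚ * 0ℚ) + - m * s → 1ℚ * P + 1ℚ * K ≡ c - m * s + P
        alg P c m s K refl = alg₀ P c m s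

    walk-sq : ∀ w n y → walk w n (λ x → x * x) y ≡ y * y + p * ∑ n (λ j → w j * w j)
    walk-sq w zero y    = alg (y * y) p
      where
      alg : ∀ x p → x ≡ x + p * 0ℚ
      alg = solve-∀ ring
    walk-sq w (suc n) y = trans (step-cong (w 0) (walk-sq (w ∘ suc) n) y) (alg p y (w 0) (∑ n (λ j → w (suc j) * w (suc j))))
      where
      alg : ∀ p y w S → (1ℚ - p) * (y * y + p * S) + p * (½ * ((y + w) * (y + w) + p * S + ((y - w) * (y - w) + p * S)))
        ≡ y * y + p * (w * w + S)
      alg = solve-∀ ring

    walk-tail : ∀ w m n {F : ℚ → ℚ} {τ} → 0ℚ ≤ τ → (∀ x → 0ℚ ≤ F x) → (∀ x → F x ≤ 1ℚ) → (∀ x → F x ≤ τ * (x * x)) →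
      walk w (m ℕ.+ n) F 0ℚ ≤ τ * (p * ∑ n (λ j → w (m ℕ.+ j) * w (m ℕ.+ j))) + ofℕ m * p
    walk-tail w m n {F} {τ} 0≤τ 0≤F F≤1 F≤τ = ≤-trans (≤-reflexive (walk-split w m n F 0ℚ))
      (≤-trans (walk-union w m (≤-walk w′ n 0≤F) (walk-≤ w′ n F≤1) 0ℚ)
      (+-monoˡ-≤ (ofℕ m * p) (≤-trans (walk-mono w′ n F≤τ 0ℚ) (≤-reflexive
        (trans (walk-* w′ n τ (λ x → x * x) 0ℚ) (cong (τ *_) (trans (walk-sq w′ n 0ℚ) (+-identityˡ (p * ∑ n (λ j → w′ j * w′ j))))))))))
      where
      w′ : ℕ → ℚ
      w′ j = w (m ℕ.+ j)

  -- Counting harmonic weights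

  inv-gap : ∀ m → inv-suc m - inv-suc (suc m) ≡ inv-suc m * inv-suc (suc m)
  inv-gap m = trans (cong₂ _-_ (sym (trans (cong (x *_) e₂) (*-identityʳ x))) (sym (trans (cong (y *_) e₁) (*-identityʳ y))))
                    (alg (ofℕ (suc m)) x y)
    where
    x = inv-suc m
    y = inv-suc (suc m)
    e₁ : ofℕ (suc m) * x ≡ 1ℚ
    e₁ = ofℕ*inv-suc m
    e₂ : (1ℚ + ofℕ (suc m)) * y ≡ 1ℚ
    e₂ = trans (cong (_* y) (sym (ofℕ-suc (suc m)))) (ofℕ*inv-suc (suc m))
    alg : ∀ n x y → x * ((1ℚ + n) * y) - y * (n * x) ≡ x * y
    alg = solve-∀ ring

  ∑-inv-sq : ∀ n m → ∑ n (λ j → inv-suc (m ℕ.+ j) * inv-suc (m ℕ.+ j)) ≤ inv-suc m + inv-suc m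
  ∑-inv-sq zero m    = 0≤inv (suc m) 0≤+ 0≤inv (suc m)
  ∑-inv-sq (suc n) m = ≤-trans
    (+-mono-≤ (≤-reflexive (cong (λ k → inv-suc k * inv-suc k) (ℕₚ.+-identityʳ m)))
      (≤-trans (≤-reflexive (∑-cong n (λ j → cong (λ k → inv-suc k * inv-suc k) (ℕₚ.+-suc m j)))) (∑-inv-sq n (suc m))))
    (≤-by (trans (sym (cancel x y)) (cong (λ d → x * x + (y + y) + (d + d - x * x)) (inv-gap m)))
      (subst (0ℚ ≤_) (sym (alg x y)) (0≤inv (suc m) 0≤* 0≤- x≤2y)))
    where
    x = inv-suc m
    y = inv-suc (suc m)
    alg : ∀ x y → x * y + x * y - x * x ≡ x * (y + y - x)
    alg = solve-∀ ring
    cancel : ∀ x y → x * x + (y + y) + (x - y + (x - y) - x * x) ≡ x + x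
    cancel = solve-∀ ring
    x≤1 : x ≤ 1ℚ
    x≤1 = inv-antitone {1} {suc m} (ℕ.s≤s ℕ.z≤n) (ℕ.s≤s ℕ.z≤n)
    alg₂ : ∀ x y d → d ≡ x - y → y + y ≡ x + (y - d)
    alg₂ x y d refl = lem x y
      where
      lem : ∀ x y → y + y ≡ x + (y - (x - y))
      lem = solve-∀ ring
    x≤2y : x ≤ y + y
    x≤2y = ≤-by (alg₂ x y (x * y) (sym (inv-gap m)))
      (subst (0ℚ ≤_) (alg₃ x y) (0≤inv (suc (suc m)) 0≤* 0≤- x≤1))
      where
      alg₃ : ∀ x y → y * (1ℚ - x) ≡ y - x * y
      alg₃ = solve-∀ ring

  -- The clamped values of a sequence with gaps ≥ γ drop by at least γ at each visit to [a, b].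
  count-visits : ∀ L (v : ℕ → ℚ) (G : ℚ → ℚ) {a b γ} → 0ℚ ≤ γ → a ≤ b → (∀ z → G z ≤ 1ℚ) →
    (∀ z → (a ≤ z × z ≤ b) ⊎ G z ≤ 0ℚ) → (∀ j → j ℕ.< L → v (suc j) + γ ≤ v j) →
    γ * ∑ L (G ∘ v) ≤ (v 0 ⊓ b ⊔ (a - γ)) - (v L ⊓ b ⊔ (a - γ))
  count-visits zero v G {a} {b} {γ} 0≤γ a≤b G≤1 supp gap =
    ≤-reflexive (trans (*-zeroʳ γ) (sym (+-inverseʳ (v 0 ⊓ b ⊔ (a - γ)))))
  count-visits (suc L) v G {a} {b} {γ} 0≤γ a≤b G≤1 supp gap =
    ≤-by (alg γ (G (v 0)) (∑ L (G ∘ v ∘ suc)) (clamp (v 0)) (clamp (v 1)) (clamp (v (suc L))))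
      (0≤- (first (supp (v 0))) 0≤+ 0≤- (count-visits L (v ∘ suc) G 0≤γ a≤b G≤1 supp (λ j j<L → gap (suc j) (ℕ.s≤s j<L))))
    where
    clamp : ℚ → ℚ
    clamp z = z ⊓ b ⊔ (a - γ)
    clamp-mono : ∀ {y z} → y ≤ z → clamp y ≤ clamp z
    clamp-mono y≤z = ⊔-mono-≤ (⊓-mono-≤ y≤z ≤-refl) ≤-refl
    alg : ∀ γ g S x y z → x - z ≡ γ * (g + S) + (x - y - γ * g + (y - z - γ * S))
    alg = solve-∀ ring
    v₁≤ : v 1 ≤ v 0 - γ
    v₁≤ = ≤-by (lem (v 0) (v 1) γ) (0≤- (gap 0 (ℕ.s≤s ℕ.z≤n)))
      where
      lem : ∀ x y γ → x - γ ≡ y + (x - (y + γ))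
      lem = solve-∀ ring
    clamp-inside : ∀ {z} → a - γ ≤ z → z ≤ b → clamp z ≡ z
    clamp-inside {z} p r = trans (cong (_⊔ (a - γ)) (p≤q⇒p⊓q≡p r)) (p≥q⇒p⊔q≡p p)
    sub≤ : ∀ {z} → z - γ ≤ z
    sub≤ {z} = ≤-by (lem z γ) 0≤γ
      where
      lem : ∀ z γ → z ≡ z - γ + γ
      lem = solve-∀ ring
    first : (a ≤ v 0 × v 0 ≤ b) ⊎ G (v 0) ≤ 0ℚ → γ * G (v 0) ≤ clamp (v 0) - clamp (v 1)
    first (inj₂ G≤0) = ≤-trans (≤-trans (*-monoˡ 0≤γ G≤0) (≤-reflexive (*-zeroʳ γ)))
      (0≤- (clamp-mono (≤-trans v₁≤ (sub≤ {v 0}))))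
    first (inj₁ (a≤v , v≤b)) = ≤-trans (≤-trans (*-monoˡ 0≤γ (G≤1 (v 0))) (≤-reflexive (*-identityʳ γ)))
      (≤-by (lem γ (v 0) (clamp (v 0)) (clamp (v 1)))
        (0≤- (≤-reflexive (sym (clamp-inside (≤-trans (sub≤ {a}) a≤v) v≤b)))
         0≤+ 0≤- (≤-trans (clamp-mono v₁≤) (≤-reflexive (clamp-inside (+-monoˡ-≤ (- γ) a≤v) (≤-trans (sub≤ {v 0}) v≤b))))))
      where
      lem : ∀ γ v x y → x - y ≡ γ + (x - v + (v - γ - y))
      lem = solve-∀ ring

  count-bound : ∀ L (v : ℕ → ℚ) (G : ℚ → ℚ) {a b γ Γ} → 0ℚ ≤ γ → γ * Γ ≡ 1ℚ → 0ℚ ≤ Γ → a ≤ b → (∀ z → G z ≤ 1ℚ) →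
    (∀ z → (a ≤ z × z ≤ b) ⊎ G z ≤ 0ℚ) → (∀ j → j ℕ.< L → v (suc j) + γ ≤ v j) →
    ∑ L (G ∘ v) ≤ (b - a) * Γ + 1ℚ
  count-bound L v G {a} {b} {γ} {Γ} 0≤γ γΓ 0≤Γ a≤b G≤1 supp gap = subst₂ _≤_
    (trans (alg₁ Γ γ _) (trans (cong (_* ∑ L (G ∘ v)) γΓ) (*-identityˡ _)))
    (trans (alg₂ Γ γ a b) (cong ((b - a) * Γ +_) γΓ))
    (*-monoˡ 0≤Γ (≤-trans (count-visits L v G 0≤γ a≤b G≤1 supp gap)
      (≤-by (lem (v 0 ⊓ b ⊔ (a - γ)) (v L ⊓ b ⊔ (a - γ)) a b γ) (0≤- top 0≤+ 0≤- (p≤q⊔p (v L ⊓ b) (a - γ))))))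
    where
    alg₁ : ∀ Γ γ S → Γ * (γ * S) ≡ γ * Γ * S
    alg₁ = solve-∀ ring
    alg₂ : ∀ Γ γ a b → Γ * (b - (a - γ)) ≡ (b - a) * Γ + γ * Γ
    alg₂ = solve-∀ ring
    lem : ∀ x y a b γ → b - (a - γ) ≡ x - y + (b - x + (y - (a - γ)))
    lem = solve-∀ ring
    top : v 0 ⊓ b ⊔ (a - γ) ≤ b
    top = ⊔-lub (p⊓q≤q (v 0) b) (≤-trans (≤-by (alg a γ) 0≤γ) a≤b)
      where
      alg : ∀ a γ → a ≡ a - γ + γ
      alg = solve-∀ ring

  ∑-except-one : ∀ L i {v u : ℕ → ℚ} {G : ℚ → ℚ} → (∀ j → j ≢ i → v j ≡ u j) → (∀ z → 0ℚ ≤ G z) → (∀ z → G z ≤ 1ℚ) →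
    ∑ L (G ∘ v) ≤ ∑ L (G ∘ u) + 1ℚ
  ∑-except-one zero i eq 0≤G G≤1 = 0≤1
  ∑-except-one (suc L) zero {v} {u} {G} eq 0≤G G≤1 =
    subst (λ s → G (v 0) + s ≤ G (u 0) + ∑ L (G ∘ u ∘ suc) + 1ℚ)
      (∑-cong L (λ j → cong G (sym (eq (suc j) (λ ())))))
      (≤-by (alg (G (v 0)) (G (u 0)) (∑ L (G ∘ u ∘ suc))) (0≤G (u 0) 0≤+ 0≤- (G≤1 (v 0))))
    where
    alg : ∀ a b S → b + S + 1ℚ ≡ a + S + (b + (1ℚ - a))
    alg = solve-∀ ring
  ∑-except-one (suc L) (suc i) {v} {u} {G} eq 0≤G G≤1 =
    ≤-trans (+-mono-≤ (≤-reflexive (cong G (eq 0 (λ ())))) (∑-except-one L i (λ j j≢i → eq (suc j) (j≢i ∘ ℕₚ.suc-injective)) 0≤G G≤1))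
            (≤-reflexive (sym (+-assoc (G (u 0)) (∑ L (G ∘ u ∘ suc)) 1ℚ)))

  -- The noise of one row

  ^-bernoulli : ∀ {p} m → 0ℚ ≤ p → p ≤ 1ℚ → 1ℚ - ofℕ m * p ≤ (1ℚ - p) ^ m
  ^-bernoulli {p} zero 0≤p p≤1    = ≤-reflexive (alg p)
    where
    alg : ∀ p → 1ℚ - 0ℚ * p ≡ 1ℚ
    alg = solve-∀ ring
  ^-bernoulli {p} (suc m) 0≤p p≤1 = ≤-trans (≤-reflexive (cong (λ k → 1ℚ - k * p) (ofℕ-suc m)))
    (≤-by (alg p (ofℕ m) ((1ℚ - p) ^ m)) (0≤- p≤1 0≤* 0≤- (^-bernoulli m 0≤p p≤1) 0≤+ 0≤ofℕ m 0≤* 0≤p 0≤* 0≤p))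
    where
    alg : ∀ p m x → (1ℚ - p) * x ≡ 1ℚ - (1ℚ + m) * p + ((1ℚ - p) * (x - (1ℚ - m * p)) + m * p * p)
    alg = solve-∀ ring

  ^-decay : ∀ {p} m → 0ℚ ≤ p → p ≤ 1ℚ → (1ℚ + ofℕ m * p) * (1ℚ - p) ^ m ≤ 1ℚ
  ^-decay {p} zero 0≤p p≤1    = ≤-reflexive (alg p)
    where
    alg : ∀ p → (1ℚ + 0ℚ * p) * 1ℚ ≡ 1ℚ
    alg = solve-∀ ring
  ^-decay {p} (suc m) 0≤p p≤1 = ≤-trans (≤-reflexive (cong (λ k → (1ℚ + k * p) * ((1ℚ - p) * x)) (ofℕ-suc m)))
    (≤-trans (≤-by (alg p (ofℕ m) x) (0≤ofℕ m 0≤* (0≤p 0≤* 0≤p) 0≤* 0≤x 0≤+ 0≤p 0≤* 0≤p 0≤* 0≤x)) (^-decay m 0≤p p≤1))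
    where
    x = (1ℚ - p) ^ m
    0≤x = 0≤^ m (0≤- p≤1)
    alg : ∀ p m x → (1ℚ + m * p) * x ≡ (1ℚ + (1ℚ + m) * p) * ((1ℚ - p) * x) + (m * (p * p) * x + p * p * x)
    alg = solve-∀ ring

  euclid : ∀ a K → 1 ℕ.≤ K → Σ ℕ λ m → m ℕ.* K ℕ.≤ a × a ℕ.≤ suc m ℕ.* K
  euclid a (suc K) _ = a ℕ./ suc K , m/n*n≤m a (suc K) ,
    subst (ℕ._≤ suc (a ℕ./ suc K) ℕ.* suc K) (sym (m≡m%n+[m/n]*n a (suc K)))
          (ℕₚ.+-monoˡ-≤ _ (ℕₚ.<⇒≤ (m%n<n a (suc K))))

  harmonic-count : ∀ s L {δ} (F : ℚ → ℚ) → 1 ℕ.≤ L → 0ℚ ≤ δ → (∀ x → F x ≤ 1ℚ) → (∀ x → ∣ x ∣ ≤ δ ⊎ F x ≤ 0ℚ) → ∀ y →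
    ∑ L (λ j → F (y + inv-suc (s ℕ.+ j))) ≤ (δ + δ) * (ofℕ (s ℕ.+ L) * ofℕ (suc (s ℕ.+ L))) + 1ℚ
  harmonic-count s L {δ} F 1≤L 0≤δ F≤1 supp y =
    ≤-trans (count-bound L (λ j → inv-suc (s ℕ.+ j)) (λ z → F (y + z)) {(- δ) - y} {δ - y} {γ} {Γ} 0≤γ γΓ 0≤Γ
       (≤-by (alg₁ δ y) (0≤δ 0≤+ 0≤δ)) (λ z → F≤1 (y + z)) supp′ gap)
      (≤-reflexive (cong (λ d → d * Γ + 1ℚ) (alg₂ δ y)))
    where
    M = s ℕ.+ L
    1≤M : 1 ℕ.≤ M
    1≤M = ℕₚ.≤-trans 1≤L (ℕₚ.m≤n+m L s)
    γ = inv M * inv (suc M)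
    Γ = ofℕ M * ofℕ (suc M)
    0≤γ = 0≤inv M 0≤* 0≤inv (suc M)
    0≤Γ = 0≤ofℕ M 0≤* 0≤ofℕ (suc M)
    alg₀ : ∀ a b c d → a * b * (c * d) ≡ c * a * (d * b)
    alg₀ = solve-∀ ring
    γΓ : γ * Γ ≡ 1ℚ
    γΓ = trans (alg₀ (inv M) (inv (suc M)) (ofℕ M) (ofℕ (suc M)))
      (trans (cong₂ _*_ (ofℕ*inv 1≤M) (ofℕ*inv-suc M)) (*-identityˡ 1ℚ))
    alg₁ : ∀ δ y → δ - y ≡ - δ - y + (δ + δ)
    alg₁ = solve-∀ ring
    alg₂ : ∀ δ y → δ - y - (- δ - y) ≡ δ + δ
    alg₂ = solve-∀ ring
    alg₃ : ∀ δ y z → z ≡ - δ - y + (δ - - (y + z))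
    alg₃ = solve-∀ ring
    alg₄ : ∀ δ y z → δ - y ≡ z + (δ - (y + z))
    alg₄ = solve-∀ ring
    supp′ : ∀ z → (- δ - y ≤ z × z ≤ δ - y) ⊎ F (y + z) ≤ 0ℚ
    supp′ z with supp (y + z)
    ... | inj₁ h = inj₁ (≤-by (alg₃ δ y z) (0≤- (≤-trans (-x≤∣x∣ (y + z)) h)) , ≤-by (alg₄ δ y z) (0≤- (≤-trans (x≤∣x∣ (y + z)) h)))
    ... | inj₂ h = inj₂ h
    alg₅ : ∀ a b c → a ≡ b + c + (a - b - c)
    alg₅ = solve-∀ ring
    gap : ∀ j → j ℕ.< L → inv-suc (s ℕ.+ suc j) + γ ≤ inv-suc (s ℕ.+ j)
    gap j j<L = subst (λ k → inv-suc k + γ ≤ inv-suc m) (sym (ℕₚ.+-suc s j))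
      (≤-by (alg₅ (inv-suc m) (inv-suc (suc m)) γ)
        (0≤- (≤-trans (*-mono (0≤inv M) (0≤inv (suc (suc m))) (inv-antitone (ℕ.s≤s ℕ.z≤n) m<M) (inv-antitone (ℕ.s≤s ℕ.z≤n) (ℕ.s≤s m<M)))
                      (≤-reflexive (sym (inv-gap m))))))
      where
      m = s ℕ.+ j
      m<M : m ℕ.< M
      m<M = ℕₚ.+-monoʳ-< s j<L

  block-bound : ∀ {p b l δ a} → 0ℚ ≤ p → 0ℚ ≤ b → 0ℚ ≤ l → 0ℚ ≤ δ → 0ℚ ≤ a → b * p ≡ 1ℚ → l + l ≤ b → 1ℚ + l ≤ b →
    p * ((δ + δ) * ((1ℚ + a) * l * (1ℚ + (1ℚ + a) * l)) + 1ℚ + 1ℚ) ≤ δ * b * ((1ℚ + a) * (1ℚ + a)) + (p + p)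
  block-bound {p} {b} {l} {δ} {a} 0≤p 0≤b 0≤l 0≤δ 0≤a bp l+l≤b 1+l≤b = ≤-by
    (trans (cong (λ z → z * ((1ℚ + a) * (1ℚ + a)) + (p + p)) (sym (trans (cong (δ * b *_) bp) (*-identityʳ (δ * b)))))
           (alg p b l δ a))
    (0≤p 0≤* 0≤δ 0≤* 0≤1+a 0≤* (0≤1+a 0≤* 0≤b 0≤* 0≤- l+l≤b 0≤+ (0≤l 0≤+ 0≤l) 0≤* (0≤1+a 0≤* 0≤- 1+l≤b 0≤+ 0≤a)))
    where
    0≤1+a : 0ℚ ≤ 1ℚ + a
    0≤1+a = 0≤1 0≤+ 0≤a
    alg : ∀ p b l δ a → δ * b * (b * p) * ((1ℚ + a) * (1ℚ + a)) + (p + p) ≡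
      p * ((δ + δ) * ((1ℚ + a) * l * (1ℚ + (1ℚ + a) * l)) + 1ℚ + 1ℚ)
      + p * δ * (1ℚ + a) * ((1ℚ + a) * b * (b - (l + l)) + (l + l) * ((1ℚ + a) * (b - (1ℚ + l)) + a))
    alg = solve-∀ ring

  -- The queried item i adds no noise to its own row, whence the weight 0.
  module Noise (B L : ℕ) (2≤B : 2 ℕ.≤ B) (1≤L : 1 ℕ.≤ L) (2L≤B : L ℕ.+ L ℕ.≤ B) (B≤2L+1 : B ℕ.≤ suc (L ℕ.+ L))
               (w : ℕ → ℚ) (i : ℕ) (wᵢ≡0 : w i ≡ 0ℚ) (w≡inv : ∀ j → j ≢ i → w j ≡ inv-suc j) where

    p b l : ℚ
    p = inv B
    b = ofℕ B
    l = ofℕ L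

    1≤B : 1 ℕ.≤ B
    1≤B = ℕₚ.≤-trans (ℕ.s≤s ℕ.z≤n) 2≤B

    0≤p : 0ℚ ≤ p
    0≤p = 0≤inv B

    0≤b : 0ℚ ≤ b
    0≤b = 0≤ofℕ B

    bp : b * p ≡ 1ℚ
    bp = ofℕ*inv 1≤B

    2p≤1 : p + p ≤ 1ℚ
    2p≤1 = +-mono-≤ p≤½ p≤½
      where
      p≤½ : p ≤ ½
      p≤½ = inv-antitone {2} {B} (ℕ.s≤s ℕ.z≤n) 2≤B

    p≤1 : p ≤ 1ℚ
    p≤1 = inv-antitone {1} {B} (ℕ.s≤s ℕ.z≤n) 1≤B

    l+l≤b : l + l ≤ b
    l+l≤b = subst (_≤ b) (ofℕ-+ L L) (ofℕ-mono 2L≤B)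

    1+l≤b : 1ℚ + l ≤ b
    1+l≤b = subst (_≤ b) (ofℕ-suc L) (ofℕ-mono (ℕₚ.≤-trans (ℕₚ.+-monoˡ-≤ L 1≤L) 2L≤B))

    b≤1+2l : b ≤ 1ℚ + (l + l)
    b≤1+2l = subst (b ≤_) (trans (ofℕ-suc (L ℕ.+ L)) (cong (1ℚ +_) (ofℕ-+ L L))) (ofℕ-mono B≤2L+1)

    1≤l : 1ℚ ≤ l
    1≤l = ofℕ-mono {1} {L} 1≤L

    0≤l : 0ℚ ≤ l
    0≤l = 0≤ofℕ L

    open RandomWalk p 0≤p 2p≤1 public
    open Cells p 0≤p 2p≤1 public

    ρ : ℚ
    ρ = 1ℚ - ofℕ 2 * inv-suc 8

    lp≤½ : l * p ≤ ½
    lp≤½ = ≤-by (trans (cong (½ *_) (sym bp)) (alg l b p)) (0≤½ 0≤* (0≤- l+l≤b 0≤* 0≤p))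
      where
      alg : ∀ l b p → ½ * (b * p) ≡ l * p + ½ * ((b - (l + l)) * p)
      alg = solve-∀ ring

    one-move-prob : 1ℚ - l * p + l * p * (l * p) ≤ ρ
    one-move-prob = ≤-by (alg (l * p)) (0≤- ⅓≤lp 0≤* (0≤- lp≤½ 0≤+ nonNegative⁻¹ ⅙))
      where
      ⅓ = inv-suc 2
      ⅙ = inv-suc 5
      alg : ∀ x → 1ℚ - ofℕ 2 * inv-suc 8 ≡ 1ℚ - x + x * x + (x - inv-suc 2) * (½ - x + inv-suc 5)
      alg = solve-∀ ring
      ⅓≤lp : ⅓ ≤ l * p
      ⅓≤lp = ≤-trans (≤-reflexive (sym (trans (cong (⅓ *_) bp) (*-identityʳ ⅓))))
        (≤-by (alg₁ l b p) (nonNegative⁻¹ ⅓ 0≤* (0≤- 1≤l 0≤+ 0≤- b≤1+2l) 0≤* 0≤p))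
        where
        alg₁ : ∀ l b p → l * p ≡ inv-suc 2 * (b * p) + inv-suc 2 * (l - 1ℚ + (1ℚ + (l + l) - b)) * p
        alg₁ = solve-∀ ring

    block-count : ∀ {δ F} → 0ℚ ≤ δ → (∀ x → 0ℚ ≤ F x) → (∀ x → F x ≤ 1ℚ) → (∀ x → ∣ x ∣ ≤ δ ⊎ F x ≤ 0ℚ) → ∀ s y →
      ∑ L (λ j → avg± (w (s ℕ.+ j)) F y) ≤ (δ + δ) * (ofℕ (s ℕ.+ L) * ofℕ (suc (s ℕ.+ L))) + 1ℚ + 1ℚ
    block-count {δ} {F} 0≤δ 0≤F F≤1 supp s y = ≤-trans
      (≤-reflexive (trans (∑-* L ½ (λ j → F (y + w (s ℕ.+ j)) + F (y - w (s ℕ.+ j))))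
        (cong (½ *_) (∑-+ L (λ j → F (y + w (s ℕ.+ j))) (λ j → F (y - w (s ℕ.+ j)))))))
      (≤-trans (*-monoˡ 0≤½ (+-mono-≤ (side F 0≤F F≤1 supp y)
        (≤-trans (≤-reflexive (∑-cong L (λ j → cong F (sym (reflect y (w (s ℕ.+ j)))))))
          (side (λ x → F (- x)) (λ x → 0≤F (- x)) (λ x → F≤1 (- x)) supp⁻ (- y)))))
        (≤-reflexive (½-double _)))
      where
      reflect : ∀ y w → - (- y + w) ≡ y - w
      reflect = solve-∀ ring
      supp⁻ : ∀ x → ∣ x ∣ ≤ δ ⊎ F (- x) ≤ 0ℚ
      supp⁻ x with supp (- x)
      ... | inj₁ h = inj₁ (subst (_≤ δ) (∣-p∣≡∣p∣ x) h)
      ... | inj₂ h = inj₂ h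
      agree : ∀ j → j ≢ i ℕ.∸ s → w (s ℕ.+ j) ≡ inv-suc (s ℕ.+ j)
      agree j h = w≡inv (s ℕ.+ j) (λ e → h (trans (sym (ℕₚ.m+n∸m≡n s j)) (cong (ℕ._∸ s) e)))
      side : ∀ F → (∀ x → 0ℚ ≤ F x) → (∀ x → F x ≤ 1ℚ) → (∀ x → ∣ x ∣ ≤ δ ⊎ F x ≤ 0ℚ) → ∀ y →
        ∑ L (λ j → F (y + w (s ℕ.+ j))) ≤ (δ + δ) * (ofℕ (s ℕ.+ L) * ofℕ (suc (s ℕ.+ L))) + 1ℚ + 1ℚ
      side F 0≤F F≤1 supp y = ≤-trans
        (∑-except-one L (i ℕ.∸ s) {λ j → w (s ℕ.+ j)} {λ j → inv-suc (s ℕ.+ j)} {λ z → F (y + z)} agree (λ z → 0≤F (y + z)) (λ z → F≤1 (y + z)))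
        (+-monoˡ-≤ 1ℚ (harmonic-count s L F 1≤L 0≤δ F≤1 supp y))

    anti-concentration : ∀ {δ F} → 0ℚ ≤ δ → (∀ x → 0ℚ ≤ F x) → (∀ x → F x ≤ 1ℚ) → (∀ x → ∣ x ∣ ≤ δ ⊎ F x ≤ 0ℚ) →
      ∀ t n → t ℕ.* L ℕ.≤ n → ∀ y → walk w n F y ≤ ofℕ 1458 * (δ * b) + ofℕ 9 * p + ρ ^ t
    anti-concentration {δ} {F} 0≤δ 0≤F F≤1 supp t n tL≤n y =
      subst (λ n → walk w n F y ≤ ofℕ 1458 * (δ * b) + ofℕ 9 * p + ρ ^ t) (ℕₚ.m+[n∸m]≡n tL≤n)
        (≤-trans (walk-blocks L ρ (nonNegative⁻¹ ρ) one-move-prob 0≤F F≤1 t (n ℕ.∸ t ℕ.* L) w D U hD 0≤U hU y)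
          (≤-reflexive (cong (_+ ρ ^ t) (alg₀ (δ * b) p))))
      where
      D U : ℕ → ℚ
      D a = δ * b * ((1ℚ + ofℕ a) * (1ℚ + ofℕ a)) + (p + p)
      U a = ofℕ 18 * (δ * b) * ((ofℕ a + ofℕ 9) * (ofℕ a + ofℕ 9)) + ofℕ 9 * p
      0≤δb = 0≤δ 0≤* 0≤b
      alg₀ : ∀ x p → ofℕ 18 * x * ((0ℚ + ofℕ 9) * (0ℚ + ofℕ 9)) + ofℕ 9 * p ≡ ofℕ 1458 * x + ofℕ 9 * p
      alg₀ = solve-∀ ring
      0≤U : ∀ a → 0ℚ ≤ U a
      0≤U a = 0≤ofℕ 18 0≤* 0≤δb 0≤* 0≤sq (ofℕ a + ofℕ 9) 0≤+ 0≤ofℕ 9 0≤* 0≤p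
      hU : ∀ a → D a + ρ * U (suc a) ≤ U a
      hU a = subst (λ a′ → D a + ρ * (ofℕ 18 * (δ * b) * ((a′ + ofℕ 9) * (a′ + ofℕ 9)) + ofℕ 9 * p) ≤ U a) (sym (ofℕ-suc a))
        (≤-by (alg (δ * b) p (ofℕ a)) (0≤δb 0≤* (0≤ofℕ 3 0≤* 0≤sq (ofℕ a) 0≤+ 0≤ofℕ 42 0≤* 0≤ofℕ a 0≤+ 0≤ofℕ 57)))
        where
        alg : ∀ x p a → ofℕ 18 * x * ((a + ofℕ 9) * (a + ofℕ 9)) + ofℕ 9 * p ≡
          x * ((1ℚ + a) * (1ℚ + a)) + (p + p) + (1ℚ - ofℕ 2 * inv-suc 8) * (ofℕ 18 * x * ((1ℚ + a + ofℕ 9) * (1ℚ + a + ofℕ 9)) + ofℕ 9 * p)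
          + x * (ofℕ 3 * (a * a) + ofℕ 42 * a + ofℕ 57)
        alg = solve-∀ ring
      hD : ∀ a y → p * ∑ L (λ j → avg± (w (a ℕ.* L ℕ.+ j)) F y) ≤ D a
      hD a y = ≤-trans (*-monoˡ 0≤p (block-count 0≤δ 0≤F F≤1 supp (a ℕ.* L) y))
        (≤-trans (≤-reflexive (cong₂ (λ M M′ → p * ((δ + δ) * (M * M′) + 1ℚ + 1ℚ)) eM (trans (ofℕ-suc M) (cong (1ℚ +_) eM))))
          (block-bound 0≤p 0≤b 0≤l 0≤δ (0≤ofℕ a) bp l+l≤b 1+l≤b))
        where
        M = a ℕ.* L ℕ.+ L
        eM : ofℕ M ≡ (1ℚ + ofℕ a) * l
        eM = trans (ofℕ-+ (a ℕ.* L) L) (trans (cong (_+ l) (ofℕ-* a L)) (alg (ofℕ a) l))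
          where
          alg : ∀ a l → a * l + l ≡ (1ℚ + a) * l
          alg = solve-∀ ring

    w≤inv : ∀ j → w j * w j ≤ inv-suc j * inv-suc j
    w≤inv j with j ℕ.≟ i
    ... | yes refl = subst (λ z → z * z ≤ inv-suc j * inv-suc j) (sym wᵢ≡0) (0≤sq (inv-suc j))
    ... | no h     = ≤-reflexive (cong (λ z → z * z) (w≡inv j h))

    ∑-w-sq : ∀ m n → ∑ n (λ j → w (m ℕ.+ j) * w (m ℕ.+ j)) ≤ inv-suc m + inv-suc m
    ∑-w-sq m n = ≤-trans (∑-mono n (λ j → w≤inv (m ℕ.+ j))) (∑-inv-sq n m)

    second-moment : ∀ n → walk w n (λ x → x * x) 0ℚ ≤ p + p
    second-moment n = ≤-trans (≤-reflexive (trans (walk-sq w n 0ℚ) (+-identityˡ (p * ∑ n (λ j → w j * w j)))))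
      (≤-trans (*-monoˡ 0≤p (∑-w-sq 0 n)) (≤-reflexive (alg p)))
      where
      alg : ∀ p → p * (1ℚ + 1ℚ) ≡ p + p
      alg = solve-∀ ring

    small-ball-tail : ∀ N {t F} → 1 ℕ.≤ N → 0ℚ ≤ t → ofℕ N * t ≡ ofℕ 4 * p → (∀ x → 0ℚ ≤ F x) → (∀ x → F x ≤ 1ℚ) → (∀ x → ∣ x ∣ ≤ t → 1ℚ ≤ F x) →
      ∀ n → L ℕ.≤ n → inv-suc 7 * inv N ≤ walk w n F 0ℚ
    small-ball-tail N {t} {F} 1≤N 0≤t Nt 0≤F F≤1 1≤F n L≤n = subst (λ n → inv-suc 7 * inv N ≤ walk w n F 0ℚ) (ℕₚ.m+[n∸m]≡n L≤n)
      (≤-trans combine (≤-trans (walk-drop w L (≤-walk w′ n′ 0≤F) 0ℚ) (≤-reflexive (sym (walk-split w L n′ F 0ℚ)))))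
      where
      n′ = n ℕ.∸ L
      w′ : ℕ → ℚ
      w′ j = w (L ℕ.+ j)
      R = p + p
      σ = inv-suc 3 * (b * b)
      μ = ½ * inv N
      N⁻ = inv N
      S = ∑ n′ (λ j → w′ j * w′ j)
      0≤N⁻ = 0≤inv N
      0≤μ : 0ℚ ≤ μ
      0≤μ = 0≤½ 0≤* 0≤N⁻
      0≤σ : 0ℚ ≤ σ
      0≤σ = nonNegative⁻¹ (inv-suc 3) 0≤* (0≤b 0≤* 0≤b)
      RR : ofℕ N * t ≡ R + R
      RR = trans Nt (alg p)
        where
        alg : ∀ p → ofℕ 4 * p ≡ p + p + (p + p)
        alg = solve-∀ ring
      σR : σ * (R * R) ≡ 1ℚ
      σR = trans (alg b p) (cong₂ _*_ bp bp)
        where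
        alg : ∀ b p → inv-suc 3 * (b * b) * ((p + p) * (p + p)) ≡ b * p * (b * p)
        alg = solve-∀ ring
      σpS≤1 : σ * (p * S) ≤ 1ℚ
      σpS≤1 = ≤-trans (*-monoˡ 0≤σ (*-monoˡ 0≤p (∑-w-sq L n′)))
        (≤-trans (≤-reflexive (trans (alg b p (inv-suc L)) (trans (cong (λ z → ½ * (z * b) * inv-suc L) bp) (cong (λ z → ½ * z * inv-suc L) (*-identityˡ b)))))
        (≤-trans (≤-by (alg₂ b l (inv-suc L)) (0≤½ 0≤* ((0≤- b≤1+2l 0≤+ 0≤1) 0≤* 0≤inv (suc L)))) (≤-reflexive (trans (cong (_* inv-suc L) (sym (ofℕ-suc L))) (ofℕ*inv-suc L)))))
        where
        alg : ∀ b p x → inv-suc 3 * (b * b) * (p * (x + x)) ≡ ½ * (b * p * b) * x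
        alg = solve-∀ ring
        alg₂ : ∀ b l x → (1ℚ + l) * x ≡ ½ * b * x + ½ * ((1ℚ + (l + l) - b + 1ℚ) * x)
        alg₂ = solve-∀ ring
      Nμμ : ofℕ N * (μ * μ) ≡ inv-suc 3 * N⁻
      Nμμ = trans (alg (ofℕ N) N⁻) (trans (cong (λ z → inv-suc 3 * (z * N⁻)) (ofℕ*inv 1≤N)) (cong (inv-suc 3 *_) (*-identityˡ N⁻)))
        where
        alg : ∀ n x → n * (½ * x * (½ * x)) ≡ inv-suc 3 * (n * x * x)
        alg = solve-∀ ring
      tail≥ : inv-suc 3 * N⁻ ≤ walk w′ n′ F 0ℚ
      tail≥ = ≤-trans (≤-by (trans (cong (λ z → μ + μ - z - μ * σ * (p * S)) Nμμ) (alg N⁻ σ (p * S))) (0≤μ 0≤* 0≤- σpS≤1))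
        (small-ball w′ n′ N {t} {R} {σ} μ 0≤t (0≤p 0≤+ 0≤p) RR σR 0≤σ 0≤μ 0≤F 1≤F F≤1)
        where
        alg : ∀ x σ s → ½ * x + ½ * x - inv-suc 3 * x - ½ * x * σ * s ≡ inv-suc 3 * x + ½ * x * (1ℚ - σ * s)
        alg = solve-∀ ring
      combine : inv-suc 7 * N⁻ ≤ q ^ L * walk w′ n′ F 0ℚ
      combine = ≤-trans (≤-reflexive (alg N⁻)) (*-mono 0≤½ (≤-walk w′ n′ 0≤F 0ℚ) ½≤ tail≥)
        where
        alg : ∀ x → inv-suc 7 * x ≡ ½ * (inv-suc 3 * x)
        alg = solve-∀ ring
        ½≤ : ½ ≤ q ^ L
        ½≤ = ≤-trans (≤-by (alg₂ (l * p)) (0≤- lp≤½)) (^-bernoulli L 0≤p p≤1)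
          where
          alg₂ : ∀ x → 1ℚ - x ≡ ½ + (½ - x)
          alg₂ = solve-∀ ring

    tail-bound-at : ∀ m K {F} → m ℕ.* K ℕ.≤ B → B ℕ.≤ suc m ℕ.* K → 1 ℕ.≤ K → (∀ x → 0ℚ ≤ F x) → (∀ x → F x ≤ 1ℚ) →
      (∀ x → F x ≤ b * inv K * (b * inv K) * (x * x)) → ∀ n → B ℕ.≤ n → walk w n F 0ℚ ≤ ofℕ 3 * inv K
    tail-bound-at m K {F} mK≤B B≤[1+m]K 1≤K 0≤F F≤1 F≤τ n B≤n = subst (λ n → walk w n F 0ℚ ≤ ofℕ 3 * inv K) (ℕₚ.m+[n∸m]≡n m≤n)
      (≤-trans (walk-tail w m n′ (0≤sq (b * x)) 0≤F F≤1 F≤τ)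
        (≤-trans (+-mono-≤ (≤-trans (*-monoˡ (0≤sq (b * x)) (*-monoˡ 0≤p (∑-w-sq m n′))) variance) moves)
                 (≤-reflexive (alg₀ x))))
      where
      n′ = n ℕ.∸ m
      x = inv K
      y = inv-suc m
      m≤B : m ℕ.≤ B
      m≤B = ℕₚ.≤-trans (ℕₚ.m≤m*n m K {{ℕ.>-nonZero 1≤K}}) mK≤B
      m≤n : m ℕ.≤ n
      m≤n = ℕₚ.≤-trans m≤B B≤n
      alg₀ : ∀ x → x + x + x ≡ ofℕ 3 * x
      alg₀ = solve-∀ ring
      Kx : ofℕ K * x ≡ 1ℚ
      Kx = ofℕ*inv 1≤K
      moves : ofℕ m * p ≤ x
      moves = ≤-trans (≤-reflexive (trans (sym (*-identityʳ (ofℕ m * p))) (trans (cong (ofℕ m * p *_) (sym Kx)) (alg (ofℕ m) p (ofℕ K) x))))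
        (≤-trans (*-monoʳ (0≤p 0≤* 0≤inv K) (subst (_≤ b) (ofℕ-* m K) (ofℕ-mono mK≤B)))
          (≤-reflexive (trans (sym (*-assoc b p x)) (trans (cong (_* x) bp) (*-identityˡ x)))))
        where
        alg : ∀ m p k x → m * p * (k * x) ≡ m * k * (p * x)
        alg = solve-∀ ring
      bxy≤1 : b * (x * y) ≤ 1ℚ
      bxy≤1 = ≤-trans (*-monoʳ (0≤inv K 0≤* 0≤inv (suc m)) (subst (b ≤_) (ofℕ-* (suc m) K) (ofℕ-mono B≤[1+m]K)))
        (≤-reflexive (trans (alg (ofℕ (suc m)) (ofℕ K) x y) (trans (cong₂ _*_ (ofℕ*inv-suc m) Kx) (*-identityˡ 1ℚ))))
        where
        alg : ∀ m k x y → m * k * (x * y) ≡ m * y * (k * x)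
        alg = solve-∀ ring
      variance : b * x * (b * x) * (p * (y + y)) ≤ x + x
      variance = ≤-trans (≤-reflexive (trans (alg b p x y) (trans (cong (λ z → z * (x + x) * (b * (x * y))) bp) (cong (_* (b * (x * y))) (*-identityˡ (x + x))))))
        (≤-trans (*-monoˡ (0≤inv K 0≤+ 0≤inv K) bxy≤1) (≤-reflexive (*-identityʳ (x + x))))
        where
        alg : ∀ b p x y → b * x * (b * x) * (p * (y + y)) ≡ b * p * (x + x) * (b * (x * y))
        alg = solve-∀ ring

    tail-bound : ∀ K {F} → 1 ℕ.≤ K → (∀ x → 0ℚ ≤ F x) → (∀ x → F x ≤ 1ℚ) →
      (∀ x → F x ≤ b * inv K * (b * inv K) * (x * x)) → ∀ n → B ℕ.≤ n → walk w n F 0ℚ ≤ ofℕ 3 * inv K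
    tail-bound K 1≤K 0≤F F≤1 F≤τ n B≤n =
      tail-bound-at (proj₁ m) K (proj₁ (proj₂ m)) (proj₂ (proj₂ m)) 1≤K 0≤F F≤1 F≤τ n B≤n
      where
      m = euclid B K 1≤K

    escape : ∀ {δ F} → δ < inv (B ℕ.+ B) → (∀ x → F x ≤ 1ℚ) → (∀ x → ∣ x ∣ ≤ δ ⊎ F x ≤ 0ℚ) →
      ∀ n → B ℕ.+ B ℕ.≤ n → ∀ y → walk w n F y ≤ ½ + inv-suc 3
    escape {δ} {F} δ< F≤1 supp n 2B≤n y = answer
      where
      far : ∀ j → δ < w j → ∀ y → avg± (w j) F y ≤ ½
      far j δ<w y = ≤-trans (*-monoˡ 0≤½ (one-side (supp (y + w j)) (supp (y - w j)))) (≤-reflexive (*-identityʳ ½))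
        where
        alg : ∀ y w δ → 0ℚ ≡ w - δ + w - δ + ((δ - (y + w)) + (δ - (- (y - w))))
        alg = solve-∀ ring
        one-side : ∣ y + w j ∣ ≤ δ ⊎ F (y + w j) ≤ 0ℚ → ∣ y - w j ∣ ≤ δ ⊎ F (y - w j) ≤ 0ℚ → F (y + w j) + F (y - w j) ≤ 1ℚ
        one-side (inj₂ h) _ = +-mono-≤ h (F≤1 (y - w j))
        one-side (inj₁ _) (inj₂ h) = ≤-trans (+-mono-≤ (F≤1 (y + w j)) h) (≤-reflexive (+-identityʳ 1ℚ))
        one-side (inj₁ g) (inj₁ h) = ⊥-elim (<-irrefl refl (<-≤-trans (positive-gap (0<- δ<w))
          (≤-by (alg y (w j) δ) (0≤- (≤-trans (x≤∣x∣ (y + w j)) g) 0≤+ 0≤- (≤-trans (-x≤∣x∣ (y - w j)) h)))))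
          where
          positive-gap : 0ℚ < w j - δ → 0ℚ < w j - δ + w j - δ
          positive-gap h = subst (0ℚ <_) (lem (w j) δ) (+-mono-< h h)
            where
            lem : ∀ w δ → w - δ + (w - δ) ≡ w - δ + w - δ
            lem = solve-∀ ring
      half : ∀ s r → s ℕ.+ B ℕ.≤ B ℕ.+ B → (∀ j → j ℕ.< B → s ℕ.+ j ≢ i) → ∀ y → walk w (s ℕ.+ (B ℕ.+ r)) F y ≤ ½ + inv-suc 3
      half s r s≤B avoid y = ≤-trans (≤-reflexive (walk-split w s (B ℕ.+ r) F y)) (walk-≤ w s (λ z →
        ≤-trans (≤-reflexive (walk-split ws B r F z)) (≤-trans (walk-half ws B (walk-≤ wr r F≤1) steps z) decay)) y)
        where
        ws wr : ℕ → ℚ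
        ws j = w (s ℕ.+ j)
        wr j = ws (B ℕ.+ j)
        δ<ws : ∀ j → j ℕ.< B → δ < ws j
        δ<ws j j<B = <-≤-trans δ< (≤-trans (inv-antitone (ℕ.s≤s ℕ.z≤n) (ℕₚ.≤-trans (ℕₚ.+-monoʳ-< s j<B) s≤B))
          (≤-reflexive (sym (w≡inv (s ℕ.+ j) (avoid j j<B)))))
        steps : ∀ j → j ℕ.< B → ∀ y → avg± (ws j) (walk wr r F) y ≤ ½
        steps j j<B y = ≤-trans (≤-reflexive (sym (walk-avg± wr r (ws j) F y))) (walk-≤ wr r (far (s ℕ.+ j) (δ<ws j j<B)) y)
        alg : ∀ x → inv-suc 3 ≡ ½ * x + inv-suc 3 * (1ℚ - (1ℚ + 1ℚ) * x)
        alg = solve-∀ ring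
        decay : ½ + ½ * q ^ B ≤ ½ + inv-suc 3
        decay = +-monoʳ-≤ ½ (≤-by {½ * q ^ B} {inv-suc 3} (alg (q ^ B)) (nonNegative⁻¹ (inv-suc 3) 0≤* 0≤- (subst (λ z → (1ℚ + z) * q ^ B ≤ 1ℚ) bp (^-decay B 0≤p p≤1))))
      r = n ℕ.∸ (B ℕ.+ B)
      n≡ : B ℕ.+ (B ℕ.+ r) ≡ n
      n≡ = trans (sym (ℕₚ.+-assoc B B r)) (ℕₚ.m+[n∸m]≡n 2B≤n)
      answer : walk w n F y ≤ ½ + inv-suc 3
      by-cases : Dec (i ℕ.< B) → walk w (B ℕ.+ (B ℕ.+ r)) F y ≤ ½ + inv-suc 3
      by-cases (yes i<B) = half B r ℕₚ.≤-refl (λ j _ e → ℕₚ.<⇒≱ i<B (subst (B ℕ.≤_) e (ℕₚ.m≤m+n B j))) y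
      by-cases (no i≮B)  = half 0 (B ℕ.+ r) (ℕₚ.m≤n+m B B) (λ j j<B e → i≮B (subst (ℕ._< B) e j<B)) y
      answer = subst (λ n → walk w n F y ≤ ½ + inv-suc 3) n≡ (by-cases (i ℕ.<? B))

  -- Independent rows and order statistics

  record Mean (A : Set) : Set where
    field
      E        : (A → ℚ) → ℚ
      E-mono   : ∀ {F G : A → ℚ} → (∀ a → F a ≤ G a) → E F ≤ E G
      E-linear : ∀ a b (F G : A → ℚ) → E (λ x → a * F x + b * G x) ≡ a * E F + b * E G
      E-const  : ∀ c → E (λ _ → c) ≡ c

    E-cong : ∀ {F G : A → ℚ} → (∀ a → F a ≡ G a) → E F ≡ E G
    E-cong eq = ≤-antisym (E-mono (λ a → ≤-reflexive (eq a))) (E-mono (λ a → ≤-reflexive (sym (eq a))))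

    E-+ : ∀ (F G : A → ℚ) → E (λ x → F x + G x) ≡ E F + E G
    E-+ F G = trans (E-cong (λ x → sym (cong₂ _+_ (*-identityˡ (F x)) (*-identityˡ (G x)))))
      (trans (E-linear 1ℚ 1ℚ F G) (cong₂ _+_ (*-identityˡ (E F)) (*-identityˡ (E G))))

    E-* : ∀ c (F : A → ℚ) → E (λ x → c * F x) ≡ c * E F
    E-* c F = trans (E-cong (λ x → alg c (F x))) (trans (E-linear c 0ℚ F F) (sym (alg c (E F))))
      where
      alg : ∀ c x → c * x ≡ c * x + 0ℚ * x
      alg = solve-∀ ring

    ≤-E : ∀ {F : A → ℚ} {c} → (∀ a → c ≤ F a) → c ≤ E F
    ≤-E {c = c} h = ≤-trans (≤-reflexive (sym (E-const c))) (E-mono h)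

    E-quadratic : ∀ a b c (F : A → ℚ) → E (λ x → a + b * F x + c * (F x * F x)) ≡ a + b * E F + c * E (λ x → F x * F x)
    E-quadratic a b c F = trans (E-+ (λ x → a + b * F x) (λ x → c * (F x * F x)))
      (cong₂ _+_ (trans (E-+ (λ _ → a) (λ x → b * F x)) (cong₂ _+_ (E-const a) (E-* b F))) (E-* c (λ x → F x * F x)))

  open Mean

  power : ∀ {A} → Mean A → ∀ k → Mean (Vec A k)
  power M zero    = record
    { E = λ Φ → Φ [] ; E-mono = λ h → h [] ; E-linear = λ a b F G → refl ; E-const = λ c → refl }
  power M (suc k) = record
    { E        = λ Φ → E M (λ x → E Mᵏ (λ v → Φ (x ∷ v)))
    ; E-mono   = λ h → E-mono M (λ x → E-mono Mᵏ (λ v → h (x ∷ v)))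
    ; E-linear = λ a b F G → trans (E-cong M (λ x → E-linear Mᵏ a b (λ v → F (x ∷ v)) (λ v → G (x ∷ v))))
                                   (E-linear M a b (λ x → E Mᵏ (λ v → F (x ∷ v))) (λ x → E Mᵏ (λ v → G (x ∷ v))))
    ; E-const  = λ c → trans (E-cong M (λ x → E-const Mᵏ c)) (E-const M c)
    }
    where Mᵏ = power M k

  ∑ᵛ : ∀ {A : Set} {k} → (A → ℚ) → Vec A k → ℚ
  ∑ᵛ φ []      = 0ℚ
  ∑ᵛ φ (x ∷ v) = φ x + ∑ᵛ φ v

  ∏ᵛ : ∀ {A : Set} {k} → (A → ℚ) → Vec A k → ℚ
  ∏ᵛ φ []      = 1ℚ
  ∏ᵛ φ (x ∷ v) = φ x * ∏ᵛ φ v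

  ∑ᵛ-mono : ∀ {A : Set} {k} {φ ψ : A → ℚ} → (∀ x → φ x ≤ ψ x) → (v : Vec A k) → ∑ᵛ φ v ≤ ∑ᵛ ψ v
  ∑ᵛ-mono h []      = ≤-refl
  ∑ᵛ-mono h (x ∷ v) = +-mono-≤ (h x) (∑ᵛ-mono h v)

  0≤∑ᵛ : ∀ {A : Set} {k} {φ : A → ℚ} → (∀ x → 0ℚ ≤ φ x) → (v : Vec A k) → 0ℚ ≤ ∑ᵛ φ v
  0≤∑ᵛ h []      = ≤-refl
  0≤∑ᵛ h (x ∷ v) = h x 0≤+ 0≤∑ᵛ h v

  0≤∏ᵛ : ∀ {A : Set} {k} {φ : A → ℚ} → (∀ x → 0ℚ ≤ φ x) → (v : Vec A k) → 0ℚ ≤ ∏ᵛ φ v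
  0≤∏ᵛ h []      = 0≤1
  0≤∏ᵛ h (x ∷ v) = h x 0≤* 0≤∏ᵛ h v

  ∏ᵛ≤1 : ∀ {A : Set} {k} {φ : A → ℚ} → (∀ x → 0ℚ ≤ φ x) → (∀ x → φ x ≤ 1ℚ) → (v : Vec A k) → ∏ᵛ φ v ≤ 1ℚ
  ∏ᵛ≤1 h g []      = ≤-refl
  ∏ᵛ≤1 h g (x ∷ v) = *-mono (h x) 0≤1 (g x) (∏ᵛ≤1 h g v)

  ∑ᵛ-partition : ∀ {A : Set} {k} {φ ψ χ : A → ℚ} → (∀ x → φ x + ψ x + χ x ≡ 1ℚ) → (v : Vec A k) →
    ∑ᵛ φ v + ∑ᵛ ψ v + ∑ᵛ χ v ≡ ofℕ k
  ∑ᵛ-partition h [] = refl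
  ∑ᵛ-partition {k = suc k} {φ} {ψ} {χ} h (x ∷ v) =
    trans (alg (φ x) (ψ x) (χ x) (∑ᵛ φ v) (∑ᵛ ψ v) (∑ᵛ χ v))
      (trans (cong₂ _+_ (h x) (∑ᵛ-partition h v)) (sym (ofℕ-suc k)))
    where
    alg : ∀ a b c d e f → a + d + (b + e) + (c + f) ≡ a + b + c + (d + e + f)
    alg = solve-∀ ring

  ∑ᵛ-difference : ∀ {A : Set} {k} (φ ψ : A → ℚ) (v : Vec A k) → ∑ᵛ (λ x → φ x - ψ x) v ≡ ∑ᵛ φ v - ∑ᵛ ψ v
  ∑ᵛ-difference φ ψ []      = refl
  ∑ᵛ-difference φ ψ (x ∷ v) = trans (cong (φ x - ψ x +_) (∑ᵛ-difference φ ψ v)) (alg (φ x) (ψ x) (∑ᵛ φ v) (∑ᵛ ψ v))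
    where
    alg : ∀ a b c d → a - b + (c - d) ≡ a + c - (b + d)
    alg = solve-∀ ring

  ∏ᵛ*∑ᵛ≡0 : ∀ {A : Set} {k} {φ ψ : A → ℚ} → (∀ x → φ x * ψ x ≡ 0ℚ) → (v : Vec A k) → ∏ᵛ φ v * ∑ᵛ ψ v ≡ 0ℚ
  ∏ᵛ*∑ᵛ≡0 h [] = refl
  ∏ᵛ*∑ᵛ≡0 {φ = φ} {ψ} h (x ∷ v) = trans (alg (φ x) (ψ x) (∏ᵛ φ v) (∑ᵛ ψ v))
    (trans (cong₂ (λ a b → a * ∏ᵛ φ v + φ x * b) (h x) (∏ᵛ*∑ᵛ≡0 h v)) (alg₂ (∏ᵛ φ v) (φ x)))
    where
    alg : ∀ a b c d → a * c * (b + d) ≡ a * b * c + a * (c * d)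
    alg = solve-∀ ring
    alg₂ : ∀ a b → 0ℚ * a + b * 0ℚ ≡ 0ℚ
    alg₂ = solve-∀ ring

  ∑ᵛ-integral : ∀ {A : Set} {k} {φ : A → ℚ} → (∀ x → 0ℚ ≤ φ x) → (∀ x → φ x * φ x ≡ φ x) → (v : Vec A k) →
    0ℚ ≤ ∑ᵛ φ v * ∑ᵛ φ v - ∑ᵛ φ v
  ∑ᵛ-integral 0≤φ idem [] = ≤-refl
  ∑ᵛ-integral {φ = φ} 0≤φ idem (x ∷ v) = subst (0ℚ ≤_)
    (trans (cong (λ z → (∑ᵛ φ v * ∑ᵛ φ v - ∑ᵛ φ v) + (φ x + φ x) * ∑ᵛ φ v + (φ x * φ x - z)) (idem x)) (alg (φ x) (∑ᵛ φ v)))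
    (∑ᵛ-integral 0≤φ idem v 0≤+ (0≤φ x 0≤+ 0≤φ x) 0≤* 0≤∑ᵛ 0≤φ v 0≤+ 0≤- {φ x * φ x} ≤-refl)
    where
    alg : ∀ a s → s * s - s + (a + a) * s + (a * a - a) ≡ (a + s) * (a + s) - (a + s)
    alg = solve-∀ ring

  module Moments {A : Set} (M : Mean A) where

    E-∑ᵛ : ∀ k φ → E (power M k) (∑ᵛ φ) ≡ ofℕ k * E M φ
    E-∑ᵛ zero φ    = sym (*-zeroˡ (E M φ))
    E-∑ᵛ (suc k) φ = trans (E-cong M (λ x → trans (E-+ (power M k) (λ _ → φ x) (∑ᵛ φ))
        (cong₂ _+_ (E-const (power M k) (φ x)) (E-∑ᵛ k φ))))
      (trans (E-+ M φ (λ _ → ofℕ k * E M φ)) (trans (cong (E M φ +_) (E-const M (ofℕ k * E M φ)))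
        (trans (alg (ofℕ k) (E M φ)) (cong (_* E M φ) (sym (ofℕ-suc k))))))
      where
      alg : ∀ k m → m + k * m ≡ (1ℚ + k) * m
      alg = solve-∀ ring

    E-∑ᵛ-sq : ∀ k φ a → E (power M k) (λ v → (a + ∑ᵛ φ v) * (a + ∑ᵛ φ v)) ≡
      (a + ofℕ k * E M φ) * (a + ofℕ k * E M φ) + ofℕ k * (E M (λ x → φ x * φ x) - E M φ * E M φ)
    E-∑ᵛ-sq zero φ a = alg a (E M φ) (E M (λ x → φ x * φ x))
      where
      alg : ∀ a m n → (a + 0ℚ) * (a + 0ℚ) ≡ (a + 0ℚ * m) * (a + 0ℚ * m) + 0ℚ * (n - m * m)
      alg = solve-∀ ring
    E-∑ᵛ-sq (suc k) φ a = trans (E-cong M (λ x → trans (E-cong (power M k) (λ v → assoc a (φ x) (∑ᵛ φ v)))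
        (trans (E-∑ᵛ-sq k φ (a + φ x)) (expand a (φ x) K μ ν))))
      (trans (E-quadratic M ((a + K * μ) * (a + K * μ) + K * (ν - μ * μ)) (a + K * μ + (a + K * μ)) 1ℚ φ)
        (trans (collect a K μ ν) (cong (λ K → (a + K * μ) * (a + K * μ) + K * (ν - μ * μ)) (sym (ofℕ-suc k)))))
      where
      μ = E M φ
      ν = E M (λ x → φ x * φ x)
      K = ofℕ k
      assoc : ∀ a x s → (a + (x + s)) * (a + (x + s)) ≡ (a + x + s) * (a + x + s)
      assoc = solve-∀ ring
      expand : ∀ a x k m n → (a + x + k * m) * (a + x + k * m) + k * (n - m * m) ≡
        (a + k * m) * (a + k * m) + k * (n - m * m) + (a + k * m + (a + k * m)) * x + 1ℚ * (x * x)
      expand = solve-∀ ring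
      collect : ∀ a k m n → (a + k * m) * (a + k * m) + k * (n - m * m) + (a + k * m + (a + k * m)) * m + 1ℚ * n ≡
        (a + (1ℚ + k) * m) * (a + (1ℚ + k) * m) + (1ℚ + k) * (n - m * m)
      collect = solve-∀ ring

    variance : ∀ k φ → E (power M k) (λ v → (∑ᵛ φ v - ofℕ k * E M φ) * (∑ᵛ φ v - ofℕ k * E M φ)) ≡
      ofℕ k * (E M (λ x → φ x * φ x) - E M φ * E M φ)
    variance k φ = trans (E-cong (power M k) (λ v → comm (∑ᵛ φ v) m)) (trans (E-∑ᵛ-sq k φ (- m)) (alg m _))
      where
      m = ofℕ k * E M φ
      comm : ∀ s m → (s - m) * (s - m) ≡ (- m + s) * (- m + s)
      comm = solve-∀ ring
      alg : ∀ m x → (- m + m) * (- m + m) + x ≡ x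
      alg = solve-∀ ring

    second : ∀ k φ → E (power M k) (λ v → ∑ᵛ φ v * ∑ᵛ φ v) ≡
      ofℕ k * E M φ * (ofℕ k * E M φ) + ofℕ k * (E M (λ x → φ x * φ x) - E M φ * E M φ)
    second k φ = trans (E-cong (power M k) (λ v → alg (∑ᵛ φ v))) (trans (E-∑ᵛ-sq k φ 0ℚ) (alg₂ (ofℕ k * E M φ) _))
      where
      alg : ∀ s → s * s ≡ (0ℚ + s) * (0ℚ + s)
      alg = solve-∀ ring
      alg₂ : ∀ m x → (0ℚ + m) * (0ℚ + m) + x ≡ m * m + x
      alg₂ = solve-∀ ring

    E-∏ᵛ : ∀ k φ → E (power M k) (∏ᵛ φ) ≡ E M φ ^ k
    E-∏ᵛ zero φ    = refl
    E-∏ᵛ (suc k) φ = trans (E-cong M (λ x → trans (E-* (power M k) (φ x) (∏ᵛ φ)) (trans (cong (φ x *_) (E-∏ᵛ k φ)) (*-comm (φ x) (E M φ ^ k)))))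
      (trans (E-* M (E M φ ^ k) φ) (*-comm (E M φ ^ k) (E M φ)))

    fourth : ∀ k σ → E M σ ≡ 0ℚ → E M (λ x → σ x * σ x) ≤ 1ℚ → (∀ x → σ x * σ x * σ x ≡ σ x) → ∀ a →
      E (power M k) (λ v → (a + ∑ᵛ σ v) * (a + ∑ᵛ σ v) * ((a + ∑ᵛ σ v) * (a + ∑ᵛ σ v)))
      ≤ a * a * (a * a) + ofℕ 6 * ofℕ k * (a * a) + ofℕ 3 * (ofℕ k * ofℕ k)
    fourth zero σ mean var cube a = ≤-reflexive (alg a)
      where
      alg : ∀ a → (a + 0ℚ) * (a + 0ℚ) * ((a + 0ℚ) * (a + 0ℚ)) ≡ a * a * (a * a) + ofℕ 6 * 0ℚ * (a * a) + ofℕ 3 * (0ℚ * 0ℚ)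
      alg = solve-∀ ring
    fourth (suc k) σ mean var cube a = ≤-trans
      (E-mono M (λ x → ≤-trans (≤-reflexive (E-cong (power M k) (λ v → assoc a (σ x) (∑ᵛ σ v)))) (fourth k σ mean var cube (a + σ x))))
      (≤-trans (≤-reflexive (E-cong M (λ x → reduce (σ x) (cube x))))
      (≤-trans (≤-reflexive (trans (E-quadratic M c₀ c₁ c₂ σ) (cong (λ m → c₀ + c₁ * m + c₂ * ν) mean)))
      (subst (λ K′ → c₀ + c₁ * 0ℚ + c₂ * ν ≤ a * a * (a * a) + ofℕ 6 * K′ * (a * a) + ofℕ 3 * (K′ * K′)) (sym (ofℕ-suc k))
        (≤-by (alg a K c₁ ν) ((0≤ofℕ 6 0≤* 0≤sq a 0≤+ 0≤1 0≤+ 0≤ofℕ 6 0≤* 0≤ofℕ k) 0≤* 0≤- var 0≤+ 0≤ofℕ 2)))))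
      where
      K = ofℕ k
      ν = E M (λ x → σ x * σ x)
      c₀ c₁ c₂ : ℚ
      c₀ = a * a * (a * a) + ofℕ 6 * K * (a * a) + ofℕ 3 * (K * K)
      c₁ = ofℕ 4 * (a * a * a) + ofℕ 12 * K * a + ofℕ 4 * a
      c₂ = ofℕ 6 * (a * a) + 1ℚ + ofℕ 6 * K
      assoc : ∀ a x s → (a + (x + s)) * (a + (x + s)) * ((a + (x + s)) * (a + (x + s))) ≡
        (a + x + s) * (a + x + s) * ((a + x + s) * (a + x + s))
      assoc = solve-∀ ring
      expand : ∀ a K x → (a + x) * (a + x) * ((a + x) * (a + x)) + ofℕ 6 * K * ((a + x) * (a + x)) + ofℕ 3 * (K * K) ≡
        a * a * (a * a) + ofℕ 6 * K * (a * a) + ofℕ 3 * (K * K) + (ofℕ 4 * (a * a * a) + ofℕ 12 * K * a) * x + ofℕ 4 * a * (x * x * x)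
        + (ofℕ 6 * (a * a) + ofℕ 6 * K) * (x * x) + x * x * x * x
      expand = solve-∀ ring
      collect : ∀ a K x c → c + (ofℕ 4 * (a * a * a) + ofℕ 12 * K * a) * x + ofℕ 4 * a * x
        + (ofℕ 6 * (a * a) + ofℕ 6 * K) * (x * x) + x * x ≡
        c + (ofℕ 4 * (a * a * a) + ofℕ 12 * K * a + ofℕ 4 * a) * x + (ofℕ 6 * (a * a) + 1ℚ + ofℕ 6 * K) * (x * x)
      collect = solve-∀ ring
      reduce : ∀ x → x * x * x ≡ x →
        (a + x) * (a + x) * ((a + x) * (a + x)) + ofℕ 6 * K * ((a + x) * (a + x)) + ofℕ 3 * (K * K) ≡ c₀ + c₁ * x + c₂ * (x * x)
      reduce x x³ = trans (expand a K x)
        (trans (cong (λ z → c₀ + (ofℕ 4 * (a * a * a) + ofℕ 12 * K * a) * x + ofℕ 4 * a * z + (ofℕ 6 * (a * a) + ofℕ 6 * K) * (x * x) + z * x) x³)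
               (collect a K x c₀))
      alg : ∀ a K c ν → a * a * (a * a) + ofℕ 6 * (1ℚ + K) * (a * a) + ofℕ 3 * ((1ℚ + K) * (1ℚ + K)) ≡
        a * a * (a * a) + ofℕ 6 * K * (a * a) + ofℕ 3 * (K * K) + c * 0ℚ + (ofℕ 6 * (a * a) + 1ℚ + ofℕ 6 * K) * ν
        + ((ofℕ 6 * (a * a) + 1ℚ + ofℕ 6 * K) * (1ℚ - ν) + ofℕ 2)
      alg = solve-∀ ring

  ∑ˡ : (ℚ → ℚ) → List ℚ → ℚ
  ∑ˡ φ []       = 0ℚ
  ∑ˡ φ (y ∷ ys) = φ y + ∑ˡ φ ys

  ∑ˡ-↭ : ∀ φ {xs ys} → xs ↭ ys → ∑ˡ φ xs ≡ ∑ˡ φ ys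
  ∑ˡ-↭ φ Perm.refl         = refl
  ∑ˡ-↭ φ (Perm.prep x p)   = cong (φ x +_) (∑ˡ-↭ φ p)
  ∑ˡ-↭ φ (Perm.swap x y p) = trans (cong (λ s → φ x + (φ y + s)) (∑ˡ-↭ φ p)) (alg (φ x) (φ y) _)
    where
    alg : ∀ a b s → a + (b + s) ≡ b + (a + s)
    alg = solve-∀ ring
  ∑ˡ-↭ φ (Perm.trans p q)  = trans (∑ˡ-↭ φ p) (∑ˡ-↭ φ q)

  at-All : ∀ {P : ℚ → Set} {ys} → All P ys → ∀ {m} → m ℕ.< length ys → P (at ys m)
  at-All (p ∷ ps) {zero} _              = p
  at-All (p ∷ ps) {suc m} (ℕ.s≤s m<len) = at-All ps m<len

  ∑ˡ-All : ∀ {φ c} ys → All (λ y → c ≤ φ y) ys → c * ofℕ (length ys) ≤ ∑ˡ φ ys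
  ∑ˡ-All {φ} {c} [] []             = ≤-reflexive (*-zeroʳ c)
  ∑ˡ-All {φ} {c} (y ∷ ys) (h ∷ hs) = ≤-trans (≤-reflexive (trans (cong (c *_) (ofℕ-suc (length ys))) (alg c (ofℕ (length ys)))))
    (+-mono-≤ h (∑ˡ-All ys hs))
    where
    alg : ∀ c n → c * (1ℚ + n) ≡ c + c * n
    alg = solve-∀ ring

  sorted-above : ∀ {ys φ c} → AllPairs _≤_ ys → (∀ y → 0ℚ ≤ φ y) → ∀ m r → length ys ≡ m ℕ.+ r →
    (∀ y → at ys m ≤ y → c ≤ φ y) → c * ofℕ r ≤ ∑ˡ φ ys
  sorted-above {[]} {φ} {c} [] 0≤φ zero .0 refl h = ≤-reflexive (*-zeroʳ c)
  sorted-above {y ∷ ys} {φ} {c} (y≤ ∷ pairs) 0≤φ zero r len h =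
    subst (λ r → c * ofℕ r ≤ ∑ˡ φ (y ∷ ys)) len (∑ˡ-All (y ∷ ys) (h y ≤-refl ∷ All.map (h _) y≤))
  sorted-above {y ∷ ys} {φ} {c} (y≤ ∷ pairs) 0≤φ (suc m) r len h =
    ≤-trans (sorted-above {c = c} pairs 0≤φ m r (ℕₚ.suc-injective len) h)
            (≤-by (+-comm (φ y) (∑ˡ φ ys)) (0≤φ y))

  sorted-below : ∀ {ys φ c} → AllPairs _≤_ ys → (∀ y → 0ℚ ≤ φ y) → ∀ m r → length ys ≡ suc m ℕ.+ r →
    (∀ y → y ≤ at ys m → c ≤ φ y) → c * ofℕ (suc m) ≤ ∑ˡ φ ys
  sorted-below {y ∷ ys} {φ} {c} (y≤ ∷ pairs) 0≤φ zero r len h = ≤-trans (≤-reflexive (*-identityʳ c))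
    (≤-by (alg (φ y) c (∑ˡ φ ys)) (0≤- (h y ≤-refl) 0≤+ 0≤∑ˡ ys))
    where
    alg : ∀ x c s → x + s ≡ c + (x - c + s)
    alg = solve-∀ ring
    0≤∑ˡ : ∀ ys → 0ℚ ≤ ∑ˡ φ ys
    0≤∑ˡ []       = ≤-refl
    0≤∑ˡ (y ∷ ys) = 0≤φ y 0≤+ 0≤∑ˡ ys
  sorted-below {y ∷ ys} {φ} {c} (y≤ ∷ pairs) 0≤φ (suc m) r len h = ≤-trans
    (≤-reflexive (trans (cong (c *_) (ofℕ-suc (suc m))) (alg c (ofℕ (suc m)))))
    (+-mono-≤ (h y (at-All y≤ m<len)) (sorted-below {c = c} pairs 0≤φ m r (ℕₚ.suc-injective len) h))
    where
    alg : ∀ c n → c * (1ℚ + n) ≡ c + c * n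
    alg = solve-∀ ring
    m<len : m ℕ.< length ys
    m<len = subst (m ℕ.<_) (sym (ℕₚ.suc-injective len)) (ℕ.s≤s (ℕₚ.m≤m+n m r))

  half-odd : ∀ m → suc (m ℕ.+ m) ℕ./ 2 ≡ m
  half-odd m = trans (cong (λ n → suc n ℕ./ 2) (trans (cong (m ℕ.+_) (sym (ℕₚ.+-identityʳ m))) (ℕₚ.*-comm 2 m)))
    (trans (+-distrib-/-∣ʳ 1 {m ℕ.* 2} {2} (divides m refl)) (m*n/n≡m m 2))

  deviation : ∀ {k} → ℚ → Vec ℚ k → ℚ
  deviation f v = median (Vec.map (f +_) v) - f

  ∑ˡ-shift : ∀ {k} f φ (v : Vec ℚ k) → ∑ˡ (λ y → φ (y - f)) (toList (Vec.map (f +_) v)) ≡ ∑ᵛ φ v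
  ∑ˡ-shift f φ []      = refl
  ∑ˡ-shift f φ (x ∷ v) = cong₂ _+_ (cong φ (alg f x)) (∑ˡ-shift f φ v)
    where
    alg : ∀ f x → f + x - f ≡ x
    alg = solve-∀ ring

  module Deviation (m : ℕ) (f : ℚ) (v : Vec ℚ (suc (m ℕ.+ m))) where

    ys : List ℚ
    ys = sort (toList (Vec.map (f +_) v))

    len : length ys ≡ suc m ℕ.+ m
    len = trans (↭-length (sort-↭ (toList (Vec.map (f +_) v)))) (length-toList (Vec.map (f +_) v))

    pairs : AllPairs _≤_ ys
    pairs = Linked⇒AllPairs ≤-trans (sort-↗ (toList (Vec.map (f +_) v)))

    deviation≡ : deviation f v ≡ at ys m - f
    deviation≡ = cong (λ i → at ys i - f) (half-odd m)

    total : ∀ φ → ∑ˡ (λ y → φ (y - f)) ys ≡ ∑ᵛ φ v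
    total φ = trans (∑ˡ-↭ (λ y → φ (y - f)) (sort-↭ (toList (Vec.map (f +_) v)))) (∑ˡ-shift f φ v)

    ∑-above : ∀ {φ c} → (∀ x → 0ℚ ≤ φ x) → (∀ x → deviation f v ≤ x → c ≤ φ x) → c * ofℕ (suc m) ≤ ∑ᵛ φ v
    ∑-above {φ} {c} 0≤φ h = ≤-trans
      (sorted-above {ys} {λ y → φ (y - f)} {c} pairs (λ y → 0≤φ (y - f)) m (suc m) (trans len (sym (ℕₚ.+-suc m m)))
        (λ y le → h (y - f) (≤-trans (≤-reflexive deviation≡) (+-monoˡ-≤ (- f) le))))
      (≤-reflexive (total φ))

    ∑-below : ∀ {φ c} → (∀ x → 0ℚ ≤ φ x) → (∀ x → x ≤ deviation f v → c ≤ φ x) → c * ofℕ (suc m) ≤ ∑ᵛ φ v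
    ∑-below {φ} {c} 0≤φ h = ≤-trans
      (sorted-below {ys} {λ y → φ (y - f)} {c} pairs (λ y → 0≤φ (y - f)) m m len
        (λ y le → h (y - f) (≤-trans (+-monoˡ-≤ (- f) le) (≤-reflexive (sym deviation≡)))))
      (≤-reflexive (total φ))

  -- Error of the median

  above below within : ℚ → ℚ → ℚ
  above t x  = ⟦ t <? x ⟧
  below t x  = ⟦ t <? - x ⟧
  within t x = ⟦ ∣ x ∣ ≤? t ⟧

  ⟦⟧-idem : ∀ {P : Set} (d : Dec P) → ⟦ d ⟧ * ⟦ d ⟧ ≡ ⟦ d ⟧
  ⟦⟧-idem (yes _) = refl
  ⟦⟧-idem (no _)  = refl

  trichotomy : ∀ {t} → 0ℚ ≤ t → ∀ x → above t x + below t x + within t x ≡ 1ℚ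
  trichotomy {t} 0≤t x with t <? x | t <? - x | ∣ x ∣ ≤? t
  ... | yes a | yes b | _     = ⊥-elim (<-irrefl refl (<-trans x<0 0<x))
    where
    0<x : 0ℚ < x
    0<x = ≤-<-trans 0≤t a
    x<0 : x < 0ℚ
    x<0 = subst (_< 0ℚ) (neg-neg x) (neg-antimono-< (≤-<-trans 0≤t b))
  ... | yes a | no b  | yes c = ⊥-elim (<-irrefl refl (<-≤-trans a (≤-trans (x≤∣x∣ x) c)))
  ... | yes a | no b  | no c  = refl
  ... | no a  | yes b | yes c = ⊥-elim (<-irrefl refl (<-≤-trans b (≤-trans (-x≤∣x∣ x) c)))
  ... | no a  | yes b | no c  = refl
  ... | no a  | no b  | yes c = refl
  ... | no a  | no b  | no c  = ⊥-elim (c (∣∣-≤ (≮⇒≥ a) (≮⇒≥ b)))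

  ∑ᵛ-one : ∀ {A : Set} {k} (v : Vec A k) → ∑ᵛ (λ _ → 1ℚ) v ≡ ofℕ k
  ∑ᵛ-one Vec.[] = refl
  ∑ᵛ-one {k = suc k} (x Vec.∷ v) = trans (cong (1ℚ +_) (∑ᵛ-one v)) (sym (ofℕ-suc k))

  infix 9 _⁺
  _⁺ : ℚ → ℚ
  x ⁺ = x ⊔ 0ℚ

  ⁺-lub : ∀ {x y} → x ≤ y → 0ℚ ≤ y → x ⁺ ≤ y
  ⁺-lub = ⊔-lub

  x≤x⁺ : ∀ x → x ≤ x ⁺
  x≤x⁺ x = p≤p⊔q x 0ℚ

  0≤x⁺ : ∀ x → 0ℚ ≤ x ⁺
  0≤x⁺ x = p≤q⊔p x 0ℚ

  layer : ∀ x {a b} → a ≤ b → (x - a) ⁺ ≤ (b - a) * ⟦ a <? x ⟧ + (x - b) ⁺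
  layer x {a} {b} a≤b = by-cases (a <? x)
    where
    y = (x - b) ⁺
    alg₁ : ∀ x a b y → (b - a) * 1ℚ + y ≡ x - a + (y - (x - b))
    alg₁ = solve-∀ ring
    alg₀ : ∀ x a b y → (b - a) * 0ℚ + y ≡ x - a + (a - x + y)
    alg₀ = solve-∀ ring
    by-cases : (d : Dec (a < x)) → (x - a) ⁺ ≤ (b - a) * ⟦ d ⟧ + y
    by-cases (yes _)  = ⁺-lub (≤-by {x - a} {(b - a) * 1ℚ + y} {y - (x - b)} (alg₁ x a b y) (0≤- (x≤x⁺ (x - b))))
      (0≤- a≤b 0≤* 0≤1 0≤+ 0≤x⁺ (x - b))
    by-cases (no a≮x) = ⁺-lub (≤-by {x - a} {(b - a) * 0ℚ + y} {a - x + y} (alg₀ x a b y) (0≤- (≮⇒≥ a≮x) 0≤+ 0≤x⁺ (x - b)))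
      (0≤- a≤b 0≤* ≤-refl 0≤+ 0≤x⁺ (x - b))

  excess-≤-sq : ∀ x {T τ} → τ * T ≡ 1ℚ → 0ℚ ≤ τ → (x - T) ⁺ ≤ τ * (x * x)
  excess-≤-sq x {T} {τ} τT 0≤τ = ⁺-lub x-T≤ (0≤τ 0≤* 0≤sq x)
    where
    rest = τ * ((x - ½ * T) * (x - ½ * T) + (½ * ½ + ½) * (T * T))
    alg : ∀ x T τ → τ * (x * x) ≡ x * (τ * T) - T * (τ * T) + τ * ((x - ½ * T) * (x - ½ * T) + (½ * ½ + ½) * (T * T))
    alg = solve-∀ ring
    x-T≤ : x - T ≤ τ * (x * x)
    x-T≤ = ≤-by {x - T} {τ * (x * x)} {rest}
      (trans (alg x T τ) (cong (_+ rest) (trans (cong (λ o → x * o - T * o) τT) (cong₂ _-_ (*-identityʳ x) (*-identityʳ T)))))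
      (0≤τ 0≤* (0≤sq (x - ½ * T) 0≤+ nonNegative⁻¹ (½ * ½ + ½) 0≤* 0≤sq T))

  module MedianError (𝔼 : Mean ℚ) (symmetric : ∀ F → E 𝔼 (λ x → F (- x)) ≡ E 𝔼 F) (m : ℕ) (f : ℚ) where

    open Moments 𝔼

    k : ℕ
    k = suc (m ℕ.+ m)

    K k⁻ m′ : ℚ
    K  = ofℕ k
    k⁻ = inv k
    m′ = ofℕ m

    𝔼ᵏ : Mean (Vec ℚ k)
    𝔼ᵏ = power 𝔼 k

    error : Vec ℚ k → ℚ
    error v = ∣ deviation f v ∣

    K≡ : K ≡ 1ℚ + (m′ + m′)
    K≡ = trans (ofℕ-suc (m ℕ.+ m)) (cong (1ℚ +_) (ofℕ-+ m m))

    Kk⁻ : K * k⁻ ≡ 1ℚ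
    Kk⁻ = ofℕ*inv-suc (m ℕ.+ m)

    0≤K : 0ℚ ≤ K
    0≤K = 0≤ofℕ k

    0≤k⁻ : 0ℚ ≤ k⁻
    0≤k⁻ = 0≤inv k

    0≤m′ : 0ℚ ≤ m′
    0≤m′ = 0≤ofℕ m

    large-error : ∀ {t v} → t < error v → 1ℚ + m′ ≤ ∑ᵛ (above t) v ⊎ 1ℚ + m′ ≤ ∑ᵛ (below t) v
    large-error {t} {v} t<X = by-sign (∣p∣≡p∨∣p∣≡-p (deviation f v))
      where
      open Deviation m f v
      one : 1ℚ + m′ ≡ 1ℚ * ofℕ (suc m)
      one = trans (sym (ofℕ-suc m)) (sym (*-identityˡ (ofℕ (suc m))))
      by-sign : ∣ deviation f v ∣ ≡ deviation f v ⊎ ∣ deviation f v ∣ ≡ - deviation f v →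
        1ℚ + m′ ≤ ∑ᵛ (above t) v ⊎ 1ℚ + m′ ≤ ∑ᵛ (below t) v
      by-sign (inj₁ e) = inj₁ (≤-trans (≤-reflexive one) (∑-above {above t} {1ℚ} (λ x → 0≤⟦⟧ (t <? x))
        (λ x d≤x → ≤-reflexive (sym (⟦⟧-yes (t <? x) (<-≤-trans (subst (t <_) e t<X) d≤x))))))
      by-sign (inj₂ e) = inj₂ (≤-trans (≤-reflexive one) (∑-below {below t} {1ℚ} (λ x → 0≤⟦⟧ (t <? - x))
        (λ x x≤d → ≤-reflexive (sym (⟦⟧-yes (t <? - x) (<-≤-trans (subst (t <_) e t<X) (neg-antimono-≤ x≤d)))))))

    ∑-complement : ∀ {v : Vec ℚ k} {φ : ℚ → ℚ} → ofℕ (suc m) ≤ ∑ᵛ (λ x → 1ℚ - φ x) v → ∑ᵛ φ v ≤ m′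
    ∑-complement {v} {φ} h = ≤-by (alg (ofℕ (suc m)) m′ (∑ᵛ φ v) (ofℕ-suc m)) (0≤- (≤-trans h
        (≤-reflexive (trans (∑ᵛ-difference (λ _ → 1ℚ) φ v) (cong (_- ∑ᵛ φ v) (trans (∑ᵛ-one v) K≡))))))
      where
      alg₀ : ∀ m s → m ≡ s + (1ℚ + (m + m) - s - (1ℚ + m))
      alg₀ = solve-∀ ring
      alg : ∀ n m s → n ≡ 1ℚ + m → m ≡ s + (1ℚ + (m + m) - s - n)
      alg n m s e = trans (alg₀ m s) (cong (λ z → s + (1ℚ + (m + m) - s - z)) (sym e))

    small-error : ∀ {t v} → error v ≤ t → ∑ᵛ (above t) v ≤ m′ × ∑ᵛ (below t) v ≤ m′
    small-error {t} {v} X≤t =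
      ∑-complement {v} {above t} (≤-trans (≤-reflexive (sym (*-identityˡ (ofℕ (suc m)))))
        (∑-below {λ x → 1ℚ - above t x} {1ℚ} (λ x → 0≤- (⟦⟧≤1 (t <? x))) (λ x x≤d →
          one-minus (t <? x) (λ t<x → <-irrefl refl (<-≤-trans t<x (≤-trans x≤d (≤-trans (x≤∣x∣ d) X≤t))))))) ,
      ∑-complement {v} {below t} (≤-trans (≤-reflexive (sym (*-identityˡ (ofℕ (suc m)))))
        (∑-above {λ x → 1ℚ - below t x} {1ℚ} (λ x → 0≤- (⟦⟧≤1 (t <? - x))) (λ x d≤x →
          one-minus (t <? - x) (λ t<-x → <-irrefl refl (<-≤-trans t<-x (≤-trans (neg-antimono-≤ d≤x) (≤-trans (-x≤∣x∣ d) X≤t)))))))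
      where
      open Deviation m f v
      d = deviation f v
      one-minus : ∀ {P : Set} (D : Dec P) → ¬ P → 1ℚ ≤ 1ℚ - ⟦ D ⟧
      one-minus D ¬p = ≤-reflexive (cong (λ z → 1ℚ - z) (sym (⟦⟧-no D ¬p)))

    error-sq : ∀ v → error v * error v ≤ ∑ᵛ (λ x → x * x) v
    error-sq v = ≤-trans (≤-trans (≤-reflexive (∣∣-sq d)) (≤-trans (≤-reflexive (sym (*-identityʳ (d * d))))
        (*-monoˡ (0≤sq d) (ofℕ-mono {1} {suc m} (ℕ.s≤s ℕ.z≤n))))) (by-sign (≤-total 0ℚ d))
      where
      open Deviation m f v
      d = deviation f v
      by-sign : 0ℚ ≤ d ⊎ d ≤ 0ℚ → d * d * ofℕ (suc m) ≤ ∑ᵛ (λ x → x * x) v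
      by-sign (inj₁ 0≤d) = ∑-above {λ x → x * x} {d * d} 0≤sq (λ x → sq-mono 0≤d)
      by-sign (inj₂ d≤0) = ∑-below {λ x → x * x} {d * d} 0≤sq (λ x x≤d →
        subst₂ _≤_ (neg-sq d) (neg-sq x) (sq-mono (neg-antimono-≤ d≤0) (neg-antimono-≤ x≤d)))

    tail-prob : ℚ → ℚ
    tail-prob t = E 𝔼ᵏ (λ v → ⟦ t <? error v ⟧)

    exceed : ∀ {t v τ} (g : ℚ → ℚ) → 0ℚ ≤ τ → (∀ s → 0ℚ ≤ s → 1ℚ + m′ ≤ s → 1ℚ ≤ τ * g s) →
      0ℚ ≤ g (∑ᵛ (above t) v) → 0ℚ ≤ g (∑ᵛ (below t) v) →
      ⟦ t <? error v ⟧ ≤ τ * (g (∑ᵛ (above t) v) + g (∑ᵛ (below t) v))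
    exceed {t} {v} {τ} g 0≤τ h 0≤g₊ 0≤g₋ = by-cases (t <? error v)
      where
      S₊ = ∑ᵛ (above t) v
      S₋ = ∑ᵛ (below t) v
      alg₊ : ∀ τ a b o → τ * (a + b) ≡ o + (τ * a - o + τ * b)
      alg₊ = solve-∀ ring
      alg₋ : ∀ τ a b o → τ * (a + b) ≡ o + (τ * b - o + τ * a)
      alg₋ = solve-∀ ring
      by-cases : (d : Dec (t < error v)) → ⟦ d ⟧ ≤ τ * (g S₊ + g S₋)
      by-cases (no _) = 0≤τ 0≤* (0≤g₊ 0≤+ 0≤g₋)
      by-cases (yes t<X) = go (large-error {t} {v} t<X)
        where
        go : 1ℚ + m′ ≤ S₊ ⊎ 1ℚ + m′ ≤ S₋ → 1ℚ ≤ τ * (g S₊ + g S₋)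
        go (inj₁ e) = ≤-by (alg₊ τ (g S₊) (g S₋) 1ℚ) (0≤- (h S₊ (0≤∑ᵛ (λ x → 0≤⟦⟧ (t <? x)) v) e) 0≤+ 0≤τ 0≤* 0≤g₋)
        go (inj₂ e) = ≤-by (alg₋ τ (g S₊) (g S₋) 1ℚ) (0≤- (h S₋ (0≤∑ᵛ (λ x → 0≤⟦⟧ (t <? - x)) v) e) 0≤+ 0≤τ 0≤* 0≤g₊)

    E-both : ∀ τ (F G : Vec ℚ k → ℚ) → E 𝔼ᵏ (λ v → τ * (F v + G v)) ≡ τ * (E 𝔼ᵏ F + E 𝔼ᵏ G)
    E-both τ F G = trans (E-* 𝔼ᵏ τ (λ v → F v + G v)) (cong (τ *_) (E-+ 𝔼ᵏ F G))

    second-above : ∀ t → E 𝔼 (λ x → above t x * above t x) ≡ E 𝔼 (above t)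
    second-above t = E-cong 𝔼 (λ x → ⟦⟧-idem (t <? x))

    mean-below : ∀ t → E 𝔼 (below t) ≡ E 𝔼 (above t)
    mean-below t = symmetric (above t)

    second-below : ∀ t → E 𝔼 (λ x → below t x * below t x) ≡ E 𝔼 (above t)
    second-below t = trans (E-cong 𝔼 (λ x → ⟦⟧-idem (t <? - x))) (mean-below t)

    chebyshev : ∀ t {h τ} → 0ℚ ≤ h → 0ℚ ≤ τ → τ * (h * h) ≡ 1ℚ → K * E 𝔼 (above t) + h ≤ 1ℚ + m′ →
      tail-prob t ≤ τ * (K * E 𝔼 (above t) + K * E 𝔼 (above t))
    chebyshev t {h} {τ} 0≤h 0≤τ τh dev = ≤-trans
      (E-mono 𝔼ᵏ (λ v → exceed {t} {v} {τ} g 0≤τ hit (0≤sq (∑ᵛ (above t) v - K * μ)) (0≤sq (∑ᵛ (below t) v - K * μ))))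
      (≤-trans (≤-reflexive (E-both τ (λ v → g (∑ᵛ (above t) v)) (λ v → g (∑ᵛ (below t) v))))
        (*-monoˡ 0≤τ (+-mono-≤
          (≤-trans (≤-reflexive (variance k (above t))) (drop (second-above t) refl))
          (≤-trans (≤-reflexive (trans (E-cong 𝔼ᵏ (λ v → cong (λ μ → (∑ᵛ (below t) v - K * μ) * (∑ᵛ (below t) v - K * μ)) (sym (mean-below t))))
            (variance k (below t)))) (drop (second-below t) (mean-below t))))))
      where
      μ = E 𝔼 (above t)
      g : ℚ → ℚ
      g s = (s - K * μ) * (s - K * μ)
      alg : ∀ s a h → s - a ≡ h + (s - (a + h))
      alg = solve-∀ ring
      hit : ∀ s → 0ℚ ≤ s → 1ℚ + m′ ≤ s → 1ℚ ≤ τ * g s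
      hit s _ le = ≤-trans (≤-reflexive (sym τh)) (*-monoˡ 0≤τ (sq-mono 0≤h
        (≤-by (alg s (K * μ) h) (0≤- (≤-trans dev le)))))
      alg₂ : ∀ K x y → K * x ≡ K * (x - y) + K * y
      alg₂ = solve-∀ ring
      drop : ∀ {ν μ′} → ν ≡ μ → μ′ ≡ μ → K * (ν - μ′ * μ′) ≤ K * μ
      drop {ν} {μ′} e e′ = ≤-by (trans (cong (K *_) (sym e)) (alg₂ K ν (μ′ * μ′))) (0≤K 0≤* 0≤sq μ′)

    pairs : ∀ t {τ} → 0ℚ ≤ τ → τ * ((1ℚ + m′) * m′) ≡ 1ℚ →
      tail-prob t ≤ τ * (K * (K - 1ℚ)) * (E 𝔼 (above t) * E 𝔼 (above t) + E 𝔼 (above t) * E 𝔼 (above t))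
    pairs t {τ} 0≤τ τm = ≤-trans
      (E-mono 𝔼ᵏ (λ v → exceed {t} {v} {τ} g 0≤τ hit (∑ᵛ-integral (λ x → 0≤⟦⟧ (t <? x)) (λ x → ⟦⟧-idem (t <? x)) v)
        (∑ᵛ-integral (λ x → 0≤⟦⟧ (t <? - x)) (λ x → ⟦⟧-idem (t <? - x)) v)))
      (≤-reflexive (trans (E-both τ (λ v → g (∑ᵛ (above t) v)) (λ v → g (∑ᵛ (below t) v)))
        (trans (cong₂ (λ a b → τ * (a + b)) (moment (above t) (second-above t) refl) (moment (below t) (second-below t) (mean-below t)))
          (alg₃ τ K μ))))
      where
      μ = E 𝔼 (above t)
      g : ℚ → ℚ
      g s = s * s - s
      alg : ∀ s m → s * s - s ≡ (1ℚ + m) * m + (s - (1ℚ + m)) * (s + m)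
      alg = solve-∀ ring
      hit : ∀ s → 0ℚ ≤ s → 1ℚ + m′ ≤ s → 1ℚ ≤ τ * g s
      hit s 0≤s le = ≤-trans (≤-reflexive (sym τm)) (*-monoˡ 0≤τ (≤-by (alg s m′) (0≤- le 0≤* (0≤s 0≤+ 0≤m′))))
      alg₂ : ∀ K μ → K * μ * (K * μ) + K * (μ - μ * μ) - K * μ ≡ K * (K - 1ℚ) * (μ * μ)
      alg₂ = solve-∀ ring
      alg₃ : ∀ τ K μ → τ * (K * (K - 1ℚ) * (μ * μ) + K * (K - 1ℚ) * (μ * μ)) ≡ τ * (K * (K - 1ℚ)) * (μ * μ + μ * μ)
      alg₃ = solve-∀ ring
      neg1 : ∀ s → s * s - s ≡ 1ℚ * (s * s) + (- 1ℚ) * s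
      neg1 = solve-∀ ring
      neg2 : ∀ a b → 1ℚ * a + (- 1ℚ) * b ≡ a - b
      neg2 = solve-∀ ring
      moment : ∀ φ → E 𝔼 (λ x → φ x * φ x) ≡ μ → E 𝔼 φ ≡ μ → E 𝔼ᵏ (λ v → g (∑ᵛ φ v)) ≡ K * (K - 1ℚ) * (μ * μ)
      moment φ e e′ = trans (E-cong 𝔼ᵏ (λ v → neg1 (∑ᵛ φ v))) (trans (E-linear 𝔼ᵏ 1ℚ (- 1ℚ) (λ v → ∑ᵛ φ v * ∑ᵛ φ v) (∑ᵛ φ))
        (trans (neg2 (E 𝔼ᵏ (λ v → ∑ᵛ φ v * ∑ᵛ φ v)) (E 𝔼ᵏ (∑ᵛ φ))) (trans (cong₂ _-_ (trans (second k φ) (cong₂ (λ ν μ → K * μ * (K * μ) + K * (ν - μ * μ)) e e′))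
          (trans (E-∑ᵛ k φ) (cong (K *_) e′))) (alg₂ K μ))))

    excess : ℚ → ℚ
    excess t = E 𝔼ᵏ (λ v → (error v - t) ⁺)

    excess-layer : ∀ {a b} → a ≤ b → excess a ≤ (b - a) * tail-prob a + excess b
    excess-layer {a} {b} a≤b = ≤-trans (E-mono 𝔼ᵏ (λ v → layer (error v) {a} {b} a≤b))
      (≤-reflexive (trans (E-+ 𝔼ᵏ (λ v → (b - a) * ⟦ a <? error v ⟧) (λ v → (error v - b) ⁺))
        (cong (_+ excess b) (E-* 𝔼ᵏ (b - a) (λ v → ⟦ a <? error v ⟧)))))

    excess-second : ∀ {T τ} → 0ℚ ≤ τ → τ * T ≡ 1ℚ → excess T ≤ τ * (K * E 𝔼 (λ x → x * x))
    excess-second {T} {τ} 0≤τ τT = ≤-trans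
      (E-mono 𝔼ᵏ (λ v → ≤-trans (excess-≤-sq (error v) τT 0≤τ) (*-monoˡ 0≤τ (error-sq v))))
      (≤-reflexive (trans (E-* 𝔼ᵏ τ (∑ᵛ (λ x → x * x))) (cong (τ *_) (E-∑ᵛ k (λ x → x * x)))))

    error-≤-excess : ∀ t → E 𝔼ᵏ error ≤ t + excess t
    error-≤-excess t = ≤-trans (E-mono 𝔼ᵏ {error} {λ v → t + (error v - t) ⁺} (λ v → split (error v)))
      (≤-reflexive (trans (E-+ 𝔼ᵏ (λ _ → t) (λ v → (error v - t) ⁺)) (cong (_+ excess t) (E-const 𝔼ᵏ t))))
      where
      alg : ∀ x t y → t + y ≡ x + (y - (x - t))
      alg = solve-∀ ring
      split : ∀ x → x ≤ t + (x - t) ⁺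
      split x = ≤-by {x} {t + (x - t) ⁺} {(x - t) ⁺ - (x - t)} (alg x t ((x - t) ⁺)) (0≤- (x≤x⁺ (x - t)))

  -- Upper bound

  double half : ℕ → ℚ
  double a = ofℕ (2 ℕ.^ a)
  half a   = inv (2 ℕ.^ a)

  1≤2^ : ∀ a → 1 ℕ.≤ 2 ℕ.^ a
  1≤2^ a = ℕₚ.m^n>0 2 a

  double-suc : ∀ a → double (suc a) ≡ ofℕ 2 * double a
  double-suc a = ofℕ-* 2 (2 ℕ.^ a)

  half-suc : ∀ a → half (suc a) ≡ ½ * half a
  half-suc a = inv-* 2 (2 ℕ.^ a)

  double*half : ∀ a → double a * half a ≡ 1ℚ
  double*half a = ofℕ*inv (1≤2^ a)

  0≤half : ∀ a → 0ℚ ≤ half a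
  0≤half a = 0≤inv (2 ℕ.^ a)

  0≤double : ∀ a → 0ℚ ≤ double a
  0≤double a = 0≤ofℕ (2 ℕ.^ a)

  half≤1 : ∀ a → half a ≤ 1ℚ
  half≤1 a = inv-antitone {1} (ℕ.s≤s ℕ.z≤n) (1≤2^ a)

  n<2^n : ∀ n → suc n ℕ.≤ 2 ℕ.^ n
  n<2^n zero    = ℕ.s≤s ℕ.z≤n
  n<2^n (suc n) = ℕₚ.+-mono-≤ (1≤2^ n) (ℕₚ.≤-trans (n<2^n n) (ℕₚ.m≤m+n (2 ℕ.^ n) 0))

  half≤inv : ∀ n → 1 ℕ.≤ n → half n ≤ inv n
  half≤inv n 1≤n = inv-antitone 1≤n (ℕₚ.<⇒≤ (n<2^n n))

  half-+ : ∀ a b → half (a ℕ.+ b) ≡ half a * half b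
  half-+ a b = trans (cong inv (ℕₚ.^-distribˡ-+-* 2 a b)) (inv-* (2 ℕ.^ a) (2 ℕ.^ b))

  double*half*x≡x : ∀ a x → double a * half a * x ≡ x
  double*half*x≡x a x = trans (cong (_* x) (double*half a)) (*-identityˡ x)

  small-ball-deviation : ∀ {K m μ π x} → K ≡ 1ℚ + (m + m) → 0ℚ ≤ m → μ + μ + π ≡ 1ℚ → inv-suc 7 * x ≤ π →
    K * μ + K * (inv-suc 15 * x) ≤ 1ℚ + m
  small-ball-deviation {K} {m} {μ} {π} {x} refl 0≤m e h = ≤-by
    (trans (sym (trans (cong (λ z → (1ℚ + (m + m)) * (z * ½) + ½) e) (alg₁ m))) (alg₂ m μ π x))
    ((0≤1 0≤+ (0≤m 0≤+ 0≤m)) 0≤* (0≤- h 0≤* 0≤½) 0≤+ 0≤½)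
    where
    alg₁ : ∀ m → (1ℚ + (m + m)) * (1ℚ * ½) + ½ ≡ 1ℚ + m
    alg₁ = solve-∀ ring
    alg₂ : ∀ m μ π x → (1ℚ + (m + m)) * ((μ + μ + π) * ½) + ½ ≡
      (1ℚ + (m + m)) * μ + (1ℚ + (m + m)) * (inv-suc 15 * x) + ((1ℚ + (m + m)) * ((π - inv-suc 7 * x) * ½) + ½)
    alg₂ = solve-∀ ring

  module Levels (𝔼 : Mean ℚ) (symmetric : ∀ F → E 𝔼 (λ x → F (- x)) ≡ E 𝔼 F) (m : ℕ) (f : ℚ) where

    open MedianError 𝔼 symmetric m f public

    total-mass : ∀ {t} → 0ℚ ≤ t → E 𝔼 (above t) + E 𝔼 (above t) + E 𝔼 (within t) ≡ 1ℚ
    total-mass {t} 0≤t = trans (cong (λ z → E 𝔼 (above t) + z + E 𝔼 (within t)) (sym (mean-below t)))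
      (trans (cong (_+ E 𝔼 (within t)) (sym (E-+ 𝔼 (above t) (below t))))
      (trans (sym (E-+ 𝔼 (λ x → above t x + below t x) (within t)))
      (trans (E-cong 𝔼 (trichotomy 0≤t)) (E-const 𝔼 1ℚ))))

    0≤above : ∀ t → 0ℚ ≤ E 𝔼 (above t)
    0≤above t = ≤-E 𝔼 (λ x → 0≤⟦⟧ (t <? x))

    0≤within : ∀ t → 0ℚ ≤ E 𝔼 (within t)
    0≤within t = ≤-E 𝔼 (λ x → 0≤⟦⟧ (∣ x ∣ ≤? t))

    tail-prob-near : ∀ N {t} → 1 ℕ.≤ N → 0ℚ ≤ t → inv-suc 7 * inv N ≤ E 𝔼 (within t) →
      tail-prob t ≤ ofℕ 256 * (ofℕ N * ofℕ N) * k⁻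
    tail-prob-near N {t} 1≤N 0≤t h = ≤-trans
      (chebyshev t {K * (inv-suc 15 * x)} {τ} (0≤K 0≤* (0≤inv 16 0≤* 0≤inv N)) 0≤τ τh
        (small-ball-deviation {K} {m′} {μ} {π} {x} K≡ 0≤m′ (total-mass 0≤t) h))
      (≤-trans (≤-reflexive (alg₁ n k⁻ K μ)) (≤-trans (≤-reflexive (cong (λ z → ofℕ 256 * (n * n) * k⁻ * (z * (μ + μ))) Kk⁻))
        (≤-by (alg₂ (ofℕ 256 * (n * n) * k⁻) (μ + μ)) (0≤ofℕ 256 0≤* (0≤n 0≤* 0≤n) 0≤* 0≤k⁻ 0≤* 0≤- 2μ≤1))))
      where
      x = inv N
      n = ofℕ N
      0≤n = 0≤ofℕ N
      μ = E 𝔼 (above t)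
      π = E 𝔼 (within t)
      τ = ofℕ 256 * (n * n) * (k⁻ * k⁻)
      0≤τ = 0≤ofℕ 256 0≤* (0≤n 0≤* 0≤n) 0≤* (0≤k⁻ 0≤* 0≤k⁻)
      alg₀ : ∀ n k K x → ofℕ 256 * (n * n) * (k * k) * (K * (inv-suc 15 * x) * (K * (inv-suc 15 * x))) ≡ n * x * (n * x) * (K * k * (K * k))
      alg₀ = solve-∀ ring
      τh : τ * (K * (inv-suc 15 * x) * (K * (inv-suc 15 * x))) ≡ 1ℚ
      τh = trans (alg₀ n k⁻ K x) (cong₂ (λ a b → a * a * (b * b)) (ofℕ*inv 1≤N) Kk⁻)
      alg₁ : ∀ n k K μ → ofℕ 256 * (n * n) * (k * k) * (K * μ + K * μ) ≡ ofℕ 256 * (n * n) * k * (K * k * (μ + μ))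
      alg₁ = solve-∀ ring
      alg₂ : ∀ c μ → c ≡ c * (1ℚ * μ) + c * (1ℚ - μ)
      alg₂ = solve-∀ ring
      2μ≤1 : μ + μ ≤ 1ℚ
      2μ≤1 = ≤-by (sym (total-mass 0≤t)) (0≤within t)

    tail-prob-far : ∀ {t s r⁻ u} → 1 ℕ.≤ m → E 𝔼 (above t) ≤ ofℕ 3 * (inv-suc 15 * s) → s ≡ u * u → 0ℚ ≤ u → u ≤ 1ℚ → 0ℚ ≤ r⁻ → k⁻ ≤ r⁻ * r⁻ →
      tail-prob t ≤ ofℕ 6 * (s * (r⁻ * u))
    tail-prob-far {t} {s} {r⁻} {u} 1≤m hμ s≡ 0≤u u≤1 0≤r⁻ k⁻≤ = by-size (≤-total u r⁻)
      where
      μ = E 𝔼 (above t)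
      0≤μ = 0≤above t
      0≤s : 0ℚ ≤ s
      0≤s = subst (0ℚ ≤_) (sym s≡) (0≤u 0≤* 0≤u)
      s≤1 : s ≤ 1ℚ
      s≤1 = ≤-trans (≤-reflexive s≡) (*-mono 0≤u 0≤1 u≤1 u≤1)
      -- Chebyshev gains a factor 1/k, the pair bound a second factor s; both are needed to sum the levels.
      variance-bound : tail-prob t ≤ ofℕ 6 * (s * k⁻)
      variance-bound = ≤-trans (chebyshev t {K * inv-suc 3} {ofℕ 16 * (k⁻ * k⁻)} (0≤K 0≤* 0≤inv 4) (0≤ofℕ 16 0≤* (0≤k⁻ 0≤* 0≤k⁻))
          (trans (alg₀ k⁻ K) (cong (λ z → z * z) Kk⁻))
          (subst (λ K → K * μ + K * inv-suc 3 ≤ 1ℚ + m′) (sym K≡) (≤-by (alg₁ m′ μ s)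
            ((0≤1 0≤+ (0≤m′ 0≤+ 0≤m′)) 0≤* (0≤- hμ 0≤+ nonNegative⁻¹ (ofℕ 3 * inv-suc 15) 0≤* 0≤- s≤1 0≤+ nonNegative⁻¹ (inv-suc 15)) 0≤+ 0≤½))))
        (≤-trans (≤-reflexive (trans (alg₂ k⁻ K μ) (cong (λ z → ofℕ 32 * (z * (k⁻ * μ))) Kk⁻)))
          (≤-by (alg₃ k⁻ μ s) (0≤ofℕ 32 0≤* 0≤k⁻ 0≤* 0≤- hμ)))
        where
        alg₀ : ∀ k K → ofℕ 16 * (k * k) * (K * inv-suc 3 * (K * inv-suc 3)) ≡ K * k * (K * k)
        alg₀ = solve-∀ ring
        alg₁ : ∀ m μ s → 1ℚ + m ≡ (1ℚ + (m + m)) * μ + (1ℚ + (m + m)) * inv-suc 3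
          + ((1ℚ + (m + m)) * (ofℕ 3 * (inv-suc 15 * s) - μ + ofℕ 3 * inv-suc 15 * (1ℚ - s) + inv-suc 15) + ½)
        alg₁ = solve-∀ ring
        alg₂ : ∀ k K μ → ofℕ 16 * (k * k) * (K * μ + K * μ) ≡ ofℕ 32 * (K * k * (k * μ))
        alg₂ = solve-∀ ring
        alg₃ : ∀ k μ s → ofℕ 6 * (s * k) ≡ ofℕ 32 * (1ℚ * (k * μ)) + ofℕ 32 * k * (ofℕ 3 * (inv-suc 15 * s) - μ)
        alg₃ = solve-∀ ring
      pair-bound : tail-prob t ≤ ofℕ 6 * (s * s)
      pair-bound = ≤-trans (pairs t {τ} 0≤τ τm) (≤-trans (*-monoʳ (0≤μ² 0≤+ 0≤μ²) τK≤4)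
          (≤-trans (≤-reflexive (alg₂ (μ * μ))) (≤-trans (*-monoˡ (0≤ofℕ 8) (sq-mono 0≤μ hμ))
            (≤-by (alg₃ s) (nonNegative⁻¹ (ofℕ 6 - ofℕ 9 * inv-suc 31) 0≤* (0≤s 0≤* 0≤s))))))
        where
        0≤μ² = 0≤μ 0≤* 0≤μ
        τ = inv (suc m) * inv m
        0≤τ = 0≤inv (suc m) 0≤* 0≤inv m
        alg₀ : ∀ a b c d → a * b * (c * d) ≡ c * a * (d * b)
        alg₀ = solve-∀ ring
        τm : τ * ((1ℚ + m′) * m′) ≡ 1ℚ
        τm = trans (alg₀ (inv (suc m)) (inv m) (1ℚ + m′) m′)
          (cong₂ _*_ (trans (cong (_* inv (suc m)) (sym (ofℕ-suc m))) (ofℕ*inv-suc m)) (ofℕ*inv 1≤m))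
        alg₁ : ∀ τ m → ofℕ 4 * (τ * ((1ℚ + m) * m)) ≡ τ * ((1ℚ + (m + m)) * ((1ℚ + (m + m)) - 1ℚ)) + ofℕ 2 * (τ * m)
        alg₁ = solve-∀ ring
        τK≤4 : τ * (K * (K - 1ℚ)) ≤ ofℕ 4
        τK≤4 = subst (λ K → τ * (K * (K - 1ℚ)) ≤ ofℕ 4) (sym K≡)
          (≤-by (trans (cong (ofℕ 4 *_) (sym τm)) (alg₁ τ m′)) (0≤ofℕ 2 0≤* (0≤τ 0≤* 0≤m′)))
        alg₂ : ∀ x → ofℕ 4 * (x + x) ≡ ofℕ 8 * x
        alg₂ = solve-∀ ring
        alg₃ : ∀ s → ofℕ 6 * (s * s) ≡ ofℕ 8 * (ofℕ 3 * (inv-suc 15 * s) * (ofℕ 3 * (inv-suc 15 * s))) + (ofℕ 6 - ofℕ 9 * inv-suc 31) * (s * s)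
        alg₃ = solve-∀ ring
      by-size : u ≤ r⁻ ⊎ r⁻ ≤ u → tail-prob t ≤ ofℕ 6 * (s * (r⁻ * u))
      by-size (inj₁ u≤r⁻) = ≤-trans pair-bound (*-monoˡ (0≤ofℕ 6) (*-monoˡ 0≤s (≤-trans (≤-reflexive s≡) (*-monoʳ 0≤u u≤r⁻))))
      by-size (inj₂ r⁻≤u) = ≤-trans variance-bound (*-monoˡ (0≤ofℕ 6) (*-monoˡ 0≤s (≤-trans k⁻≤ (*-monoˡ 0≤r⁻ r⁻≤u))))

  -- With r = 2^A the square root of k up to a factor 2 and p = 1/B, the levels are (4/B)·2^{-a} for
  -- a = A, …, 0, followed by (16/B)·4^b.
  module UpperBound (𝔼 : Mean ℚ) (symmetric : ∀ F → E 𝔼 (λ x → F (- x)) ≡ E 𝔼 F) (m : ℕ) (f : ℚ) (1≤m : 1 ℕ.≤ m)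
    (B : ℕ) (1≤B : 1 ℕ.≤ B) (A : ℕ) (r²≤k : 2 ℕ.^ A ℕ.* 2 ℕ.^ A ℕ.≤ suc (m ℕ.+ m))
    (near : ∀ N {t} → 1 ℕ.≤ N → 0ℚ ≤ t → ofℕ N * t ≡ ofℕ 4 * inv B → inv-suc 7 * inv N ≤ E 𝔼 (within t))
    (far : ∀ N → 1 ℕ.≤ N → E 𝔼 (above (ofℕ N * inv B)) ≤ ofℕ 3 * inv N)
    (variance≤ : E 𝔼 (λ x → x * x) ≤ inv B + inv B) where

    open Levels 𝔼 symmetric m f public

    p b r⁻ : ℚ
    p  = inv B
    b  = ofℕ B
    r⁻ = half A

    0≤p : 0ℚ ≤ p
    0≤p = 0≤inv B

    bp : b * p ≡ 1ℚ
    bp = ofℕ*inv 1≤B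

    0≤r⁻ : 0ℚ ≤ r⁻
    0≤r⁻ = 0≤half A

    k⁻≤r⁻r⁻ : k⁻ ≤ r⁻ * r⁻
    k⁻≤r⁻r⁻ = ≤-trans (inv-antitone (ℕₚ.*-mono-≤ (1≤2^ A) (1≤2^ A)) r²≤k) (≤-reflexive (inv-* (2 ℕ.^ A) (2 ℕ.^ A)))

    fine : ℕ → ℚ
    fine a = ofℕ 4 * p * half a

    0≤fine : ∀ a → 0ℚ ≤ fine a
    0≤fine a = 0≤ofℕ 4 0≤* 0≤p 0≤* 0≤half a

    tail-fine : ∀ a → tail-prob (fine a) ≤ ofℕ 256 * (double a * double a) * k⁻
    tail-fine a = tail-prob-near (2 ℕ.^ a) (1≤2^ a) (0≤fine a) (near (2 ℕ.^ a) (1≤2^ a) (0≤fine a)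
      (trans (alg (double a) p (half a)) (double*half*x≡x a (ofℕ 4 * p))))
      where
      alg : ∀ d p h → d * (ofℕ 4 * p * h) ≡ d * h * (ofℕ 4 * p)
      alg = solve-∀ ring

    excess-fine : ∀ a → excess (fine a) ≤ ofℕ 2048 * (p * (double a * k⁻)) + excess (fine 0)
    excess-fine zero    = ≤-by (+-comm (ofℕ 2048 * (p * (1ℚ * k⁻))) (excess (fine 0))) (0≤ofℕ 2048 0≤* (0≤p 0≤* (0≤1 0≤* 0≤k⁻)))
    excess-fine (suc a) = ≤-trans (excess-layer (≤-by (double-fine a) (0≤fine (suc a))))
      (≤-trans (+-mono-≤ (≤-trans (≤-reflexive (cong (_* tail-prob (fine (suc a))) gap)) (*-monoˡ (0≤fine (suc a)) (tail-fine (suc a)))) (excess-fine a))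
        (≤-reflexive sum))
      where
      D = double (suc a)
      H = half (suc a)
      alg₁ : ∀ p h → ofℕ 4 * p * h ≡ ofℕ 4 * p * (½ * h) + ofℕ 4 * p * (½ * h)
      alg₁ = solve-∀ ring
      double-fine : ∀ a → fine a ≡ fine (suc a) + fine (suc a)
      double-fine a = trans (alg₁ p (half a)) (cong (λ h → ofℕ 4 * p * h + ofℕ 4 * p * h) (sym (half-suc a)))
      alg₂ : ∀ x → x + x - x ≡ x
      alg₂ = solve-∀ ring
      gap : fine a - fine (suc a) ≡ fine (suc a)
      gap = trans (cong (_- fine (suc a)) (double-fine a)) (alg₂ (fine (suc a)))
      alg₃ : ∀ p h D k d e → ofℕ 4 * p * h * (ofℕ 256 * (D * D) * k) + (ofℕ 2048 * (p * (d * k)) + e) ≡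
        ofℕ 1024 * (D * h * (D * (p * k))) + ofℕ 1024 * (p * (ofℕ 2 * d * k)) + e
      alg₃ = solve-∀ ring
      alg₄ : ∀ p D k e → ofℕ 1024 * (D * (p * k)) + ofℕ 1024 * (p * (D * k)) + e ≡ ofℕ 2048 * (p * (D * k)) + e
      alg₄ = solve-∀ ring
      sum : fine (suc a) * (ofℕ 256 * (D * D) * k⁻) + (ofℕ 2048 * (p * (double a * k⁻)) + excess (fine 0)) ≡
        ofℕ 2048 * (p * (D * k⁻)) + excess (fine 0)
      sum = trans (alg₃ p H D k⁻ (double a) (excess (fine 0)))
        (trans (cong₂ (λ x d → ofℕ 1024 * x + ofℕ 1024 * (p * (d * k⁻)) + excess (fine 0)) (double*half*x≡x (suc a) (D * (p * k⁻))) (sym (double-suc a)))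
          (alg₄ p D k⁻ (excess (fine 0))))

    coarse : ℕ → ℚ
    coarse b = ofℕ (16 ℕ.* (2 ℕ.^ b ℕ.* 2 ℕ.^ b)) * p

    coarse≡ : ∀ b → coarse b ≡ ofℕ 16 * (double b * double b) * p
    coarse≡ b = cong (_* p) (trans (ofℕ-* 16 (2 ℕ.^ b ℕ.* 2 ℕ.^ b)) (cong (ofℕ 16 *_) (ofℕ-* (2 ℕ.^ b) (2 ℕ.^ b))))

    1≤coarse : ∀ b → 1 ℕ.≤ 16 ℕ.* (2 ℕ.^ b ℕ.* 2 ℕ.^ b)
    1≤coarse b = ℕₚ.*-mono-≤ {1} {16} (ℕ.s≤s ℕ.z≤n) (ℕₚ.*-mono-≤ (1≤2^ b) (1≤2^ b))

    tail-coarse : ∀ b → tail-prob (coarse b) ≤ ofℕ 6 * (half b * half b * (r⁻ * half b))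
    tail-coarse b = tail-prob-far {coarse b} {half b * half b} {r⁻} {half b} 1≤m
      (≤-trans (far (16 ℕ.* (2 ℕ.^ b ℕ.* 2 ℕ.^ b)) (1≤coarse b)) (≤-reflexive (cong (ofℕ 3 *_)
        (trans (inv-* 16 (2 ℕ.^ b ℕ.* 2 ℕ.^ b)) (cong (inv-suc 15 *_) (inv-* (2 ℕ.^ b) (2 ℕ.^ b)))))))
      refl (0≤half b) (half≤1 b) 0≤r⁻ k⁻≤r⁻r⁻

    excess-coarse : ∀ M b → excess (coarse b) ≤ ofℕ 576 * (p * (r⁻ * half b)) + excess (coarse (M ℕ.+ b))
    excess-coarse zero b    = ≤-by (+-comm (ofℕ 576 * (p * (r⁻ * half b))) (excess (coarse b)))
      (0≤ofℕ 576 0≤* (0≤p 0≤* (0≤r⁻ 0≤* 0≤half b)))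
    excess-coarse (suc M) b = ≤-trans (excess-layer (≤-by (alg₀ (coarse b) (coarse (suc b))) (subst (0ℚ ≤_) (sym gap) 0≤gap)))
      (≤-trans (+-mono-≤ (≤-trans (≤-reflexive (cong (_* tail-prob (coarse b)) gap)) (*-monoˡ 0≤gap (tail-coarse b))) (excess-coarse M (suc b)))
        (≤-reflexive (trans (alg₂ D H p r⁻ _ e) (trans (cong₂ (λ x h → ofℕ 288 * (x * x * (p * (r⁻ * H))) + (ofℕ 576 * (p * (r⁻ * h)) + e)) (double*half b) (half-suc b))
          (trans (alg₃ p r⁻ H e) (cong (λ i → ofℕ 576 * (p * (r⁻ * H)) + excess (coarse i)) (ℕₚ.+-suc M b)))))))
      where
      D = double b
      H = half b
      e = excess (coarse (M ℕ.+ suc b))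
      0≤gap = 0≤ofℕ 48 0≤* (0≤double b 0≤* 0≤double b) 0≤* 0≤p
      alg₀ : ∀ x y → y ≡ x + (y - x)
      alg₀ = solve-∀ ring
      alg₁ : ∀ d p → ofℕ 16 * (ofℕ 2 * d * (ofℕ 2 * d)) * p - ofℕ 16 * (d * d) * p ≡ ofℕ 48 * (d * d) * p
      alg₁ = solve-∀ ring
      gap : coarse (suc b) - coarse b ≡ ofℕ 48 * (D * D) * p
      gap = trans (cong₂ _-_ (trans (coarse≡ (suc b)) (cong (λ d → ofℕ 16 * (d * d) * p) (double-suc b))) (coarse≡ b)) (alg₁ D p)
      alg₂ : ∀ D H p r h e → ofℕ 48 * (D * D) * p * (ofℕ 6 * (H * H * (r * H))) + (ofℕ 576 * (p * (r * h)) + e) ≡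
        ofℕ 288 * (D * H * (D * H) * (p * (r * H))) + (ofℕ 576 * (p * (r * h)) + e)
      alg₂ = solve-∀ ring
      alg₃ : ∀ p r H e → ofℕ 288 * (1ℚ * 1ℚ * (p * (r * H))) + (ofℕ 576 * (p * (r * (½ * H))) + e) ≡ ofℕ 576 * (p * (r * H)) + e
      alg₃ = solve-∀ ring

    last : ℕ
    last = k ℕ.+ (B ℕ.+ A)

    excess-last : excess (coarse last) ≤ p * r⁻
    excess-last = ≤-trans (excess-second {coarse last} {inv-suc 15 * (H * H) * b} (0≤inv 16 0≤* (0≤H 0≤* 0≤H) 0≤* 0≤b)
        (trans (cong (inv-suc 15 * (H * H) * b *_) (coarse≡ last)) (trans (alg₀ H b D p) (cong₂ (λ x y → x * x * y) (double*half last) bp))))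
      (≤-trans (*-monoˡ (0≤inv 16 0≤* (0≤H 0≤* 0≤H) 0≤* 0≤b) (*-monoˡ 0≤K variance≤))
      (≤-trans (≤-reflexive (trans (alg₁ H b K p) (cong (λ z → z * (inv-suc 7 * (H * (K * H)))) bp)))
      (≤-trans (*-monoˡ 0≤1 (≤-trans (*-monoˡ (0≤inv 8) (*-mono 0≤H 0≤pr (half≤1 last) KH≤)) (≤-by (alg₂ (p * r⁻)) (nonNegative⁻¹ (1ℚ - inv-suc 7) 0≤* 0≤pr))))
        (≤-reflexive (*-identityˡ (p * r⁻))))))
      where
      H = half last
      D = double last
      0≤H = 0≤half last
      0≤b = 0≤ofℕ B
      0≤pr = 0≤p 0≤* 0≤r⁻
      alg₀ : ∀ H b D p → inv-suc 15 * (H * H) * b * (ofℕ 16 * (D * D) * p) ≡ D * H * (D * H) * (b * p)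
      alg₀ = solve-∀ ring
      alg₁ : ∀ H b K p → inv-suc 15 * (H * H) * b * (K * (p + p)) ≡ b * p * (inv-suc 7 * (H * (K * H)))
      alg₁ = solve-∀ ring
      alg₂ : ∀ x → x ≡ inv-suc 7 * (1ℚ * x) + (1ℚ - inv-suc 7) * x
      alg₂ = solve-∀ ring
      alg₃ : ∀ K a b c → K * (a * (b * c)) ≡ K * a * (b * c)
      alg₃ = solve-∀ ring
      KH≤ : K * H ≤ p * r⁻
      KH≤ = ≤-trans (≤-reflexive (trans (cong (K *_) (trans (half-+ k (B ℕ.+ A)) (cong (half k *_) (half-+ B A)))) (alg₃ K (half k) (half B) r⁻)))
        (≤-trans (*-mono (0≤K 0≤* 0≤half k) 0≤pr
            (≤-trans (*-monoˡ 0≤K (half≤inv k (ℕ.s≤s ℕ.z≤n))) (≤-reflexive Kk⁻))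
            (*-monoʳ 0≤r⁻ (half≤inv B 1≤B)))
          (≤-reflexive (*-identityˡ (p * r⁻))))

    upper-bound : E 𝔼ᵏ error ≤ ofℕ 5701 * (p * r⁻)
    upper-bound = ≤-trans (error-≤-excess (fine A))
      (≤-trans (+-monoʳ-≤ (fine A) (≤-trans (excess-fine A) (+-mono-≤
          (*-monoˡ (0≤ofℕ 2048) (*-monoˡ 0≤p rk⁻≤r⁻))
          (≤-trans (excess-layer {fine 0} {coarse 0} (≤-by (alg₀ p) (0≤ofℕ 12 0≤* 0≤p))) (+-mono-≤
            (*-mono (subst (0ℚ ≤_) (alg₀′ p) (0≤ofℕ 12 0≤* 0≤p)) (0≤ofℕ 256 0≤* 0≤r⁻) ≤-refl (≤-trans (tail-fine 0) (*-monoˡ (0≤ofℕ 256) k⁻≤r⁻)))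
            (≤-trans (excess-coarse last 0) (+-monoʳ-≤ (ofℕ 576 * (p * (r⁻ * 1ℚ))) (subst (λ i → excess (coarse i) ≤ p * r⁻) (sym (ℕₚ.+-identityʳ last)) excess-last))))))))
        (≤-reflexive (alg₁ p r⁻)))
      where
      alg₀ : ∀ p → ofℕ 16 * p ≡ ofℕ 4 * p * 1ℚ + ofℕ 12 * p
      alg₀ = solve-∀ ring
      alg₀′ : ∀ p → ofℕ 12 * p ≡ ofℕ 16 * p - ofℕ 4 * p * 1ℚ
      alg₀′ = solve-∀ ring
      alg₁ : ∀ p r → ofℕ 4 * p * r + (ofℕ 2048 * (p * r) + ((ofℕ 16 * p - ofℕ 4 * p * 1ℚ) * (ofℕ 256 * r) + (ofℕ 576 * (p * (r * 1ℚ)) + p * r)))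
        ≡ ofℕ 5701 * (p * r)
      alg₁ = solve-∀ ring
      alg₂ : ∀ D r → D * (r * r) ≡ D * r * r
      alg₂ = solve-∀ ring
      rk⁻≤r⁻ : double A * k⁻ ≤ r⁻
      rk⁻≤r⁻ = ≤-trans (*-monoˡ (0≤double A) k⁻≤r⁻r⁻) (≤-reflexive (trans (alg₂ (double A) r⁻) (double*half*x≡x A r⁻)))
      k⁻≤r⁻ : k⁻ ≤ r⁻
      k⁻≤r⁻ = ≤-trans k⁻≤r⁻r⁻ (≤-trans (*-monoˡ 0≤r⁻ (half≤1 A)) (≤-reflexive (*-identityʳ r⁻)))

  -- Lower bound

  sign : ℚ → ℚ → ℚ
  sign t x = above t x - below t x

  above*below : ∀ {t} → 0ℚ ≤ t → ∀ x → above t x * below t x ≡ 0ℚ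
  above*below {t} 0≤t x with t <? x | t <? - x
  ... | yes a | yes b = ⊥-elim (<-irrefl refl (<-≤-trans (≤-<-trans 0≤t b) (neg-antimono-≤ (<⇒≤ (≤-<-trans 0≤t a)))))
  ... | yes a | no b  = refl
  ... | no a  | yes b = refl
  ... | no a  | no b  = refl

  sign-sq : ∀ {t} → 0ℚ ≤ t → ∀ x → sign t x * sign t x ≡ above t x + below t x
  sign-sq {t} 0≤t x = trans (alg (above t x) (below t x))
    (trans (cong₂ _-_ (cong₂ _+_ (⟦⟧-idem (t <? x)) (⟦⟧-idem (t <? - x))) (cong (λ z → z + z) (above*below 0≤t x))) (alg₂ (above t x + below t x)))
    where
    alg : ∀ a b → (a - b) * (a - b) ≡ a * a + b * b - (a * b + a * b)
    alg = solve-∀ ring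
    alg₂ : ∀ a → a - (0ℚ + 0ℚ) ≡ a
    alg₂ = solve-∀ ring

  sign-cube : ∀ {t} → 0ℚ ≤ t → ∀ x → sign t x * sign t x * sign t x ≡ sign t x
  sign-cube {t} 0≤t x = trans (cong (_* sign t x) (sign-sq 0≤t x))
    (trans (alg (above t x) (below t x)) (cong₂ _-_ (⟦⟧-idem (t <? x)) (⟦⟧-idem (t <? - x))))
    where
    alg : ∀ a b → (a + b) * (a - b) ≡ a * a - b * b
    alg = solve-∀ ring

  -- Replaces the indicator of S² > k/4 by a quadratic in y = S², so that the second and fourth moments
  -- of S suffice.
  window-poly : ℚ → ℚ → ℚ
  window-poly K y = (y - inv-suc 3 * K) * (ofℕ 25 * inv-suc 3 * K - y)

  window-poly-max : ∀ K y → window-poly K y ≤ ofℕ 9 * (K * K)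
  window-poly-max K y = ≤-by (alg K y) (0≤sq (y - ofℕ 13 * inv-suc 3 * K))
    where
    alg : ∀ K y → ofℕ 9 * (K * K) ≡ (y - inv-suc 3 * K) * (ofℕ 25 * inv-suc 3 * K - y) + (y - ofℕ 13 * inv-suc 3 * K) * (y - ofℕ 13 * inv-suc 3 * K)
    alg = solve-∀ ring

  window-poly-small : ∀ {K y z} → 0ℚ ≤ K → 0ℚ ≤ y → y ≤ z → window-poly K y ≤ ofℕ 36 * (K * z)
  window-poly-small {K} {y} {z} 0≤K 0≤y y≤z = by-cases (≤-total y (inv-suc 3 * K))
    where
    alg₁ : ∀ K y z → ofℕ 36 * (K * z) ≡ (y - inv-suc 3 * K) * (ofℕ 25 * inv-suc 3 * K - y) +
      ((inv-suc 3 * K - y) * (inv-suc 3 * K - y + ofℕ 6 * K) + ofℕ 36 * (K * (y + (z - y))))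
    alg₁ = solve-∀ ring
    alg₂ : ∀ K y z → ofℕ 36 * (K * z) ≡ ofℕ 9 * (K * K) + ofℕ 36 * (K * (y - inv-suc 3 * K + (z - y)))
    alg₂ = solve-∀ ring
    by-cases : y ≤ inv-suc 3 * K ⊎ inv-suc 3 * K ≤ y → window-poly K y ≤ ofℕ 36 * (K * z)
    by-cases (inj₁ h) = ≤-by (alg₁ K y z) (0≤- h 0≤* (0≤- h 0≤+ 0≤ofℕ 6 0≤* 0≤K) 0≤+ 0≤ofℕ 36 0≤* (0≤K 0≤* (0≤y 0≤+ 0≤- y≤z)))
    by-cases (inj₂ h) = ≤-trans (window-poly-max K y) (≤-by (alg₂ K y z) (0≤ofℕ 36 0≤* (0≤K 0≤* (0≤- h 0≤+ 0≤- y≤z))))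

  module LowerBound (𝔼 : Mean ℚ) (symmetric : ∀ F → E 𝔼 (λ x → F (- x)) ≡ E 𝔼 F) (m : ℕ) (f : ℚ) where

    open Levels 𝔼 symmetric m f public
    open Moments 𝔼

    balanced : ∀ {t v} → 0ℚ ≤ t → error v ≤ t →
      1ℚ ≤ ∑ᵛ (within t) v - (∑ᵛ (above t) v - ∑ᵛ (below t) v) × 1ℚ ≤ ∑ᵛ (within t) v + (∑ᵛ (above t) v - ∑ᵛ (below t) v)
    balanced {t} {v} 0≤t X≤t =
      ≤-by (trans (alg₁ P Q N) (trans (cong (_- (P + P)) total) (alg₃ m′ P))) (0≤P 0≤+ 0≤P) ,
      ≤-by (trans (alg₂ P Q N) (trans (cong (_- (Q + Q)) total) (alg₃ m′ Q))) (0≤Q 0≤+ 0≤Q)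
      where
      P = ∑ᵛ (above t) v
      Q = ∑ᵛ (below t) v
      N = ∑ᵛ (within t) v
      0≤P = 0≤- (proj₁ (small-error {t} {v} X≤t))
      0≤Q = 0≤- (proj₂ (small-error {t} {v} X≤t))
      total : P + Q + N ≡ 1ℚ + (m′ + m′)
      total = trans (∑ᵛ-partition (trichotomy 0≤t) v) K≡
      alg₁ : ∀ P Q N → N - (P - Q) ≡ P + Q + N - (P + P)
      alg₁ = solve-∀ ring
      alg₂ : ∀ P Q N → N + (P - Q) ≡ P + Q + N - (Q + Q)
      alg₂ = solve-∀ ring
      alg₃ : ∀ m P → 1ℚ + (m + m) - (P + P) ≡ 1ℚ + (m - P + (m - P))
      alg₃ = solve-∀ ring

    sign-mean : ∀ t → E 𝔼 (sign t) ≡ 0ℚ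
    sign-mean t = trans (E-cong 𝔼 (λ x → alg₁ (above t x) (below t x)))
      (trans (E-linear 𝔼 1ℚ (- 1ℚ) (above t) (below t)) (trans (cong (λ z → 1ℚ * E 𝔼 (above t) + (- 1ℚ) * z) (mean-below t)) (alg₂ (E 𝔼 (above t)))))
      where
      alg₁ : ∀ a b → a - b ≡ 1ℚ * a + (- 1ℚ) * b
      alg₁ = solve-∀ ring
      alg₂ : ∀ a → 1ℚ * a + (- 1ℚ) * a ≡ 0ℚ
      alg₂ = solve-∀ ring

    sign-var : ∀ {t} → 0ℚ ≤ t → E 𝔼 (λ x → sign t x * sign t x) ≡ 1ℚ - E 𝔼 (within t)
    sign-var {t} 0≤t = trans (E-cong 𝔼 (sign-sq 0≤t)) (trans (E-+ 𝔼 (above t) (below t))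
      (trans (cong (E 𝔼 (above t) +_) (mean-below t)) (trans (alg (E 𝔼 (above t)) (E 𝔼 (within t))) (cong (_- E 𝔼 (within t)) (total-mass 0≤t)))))
      where
      alg : ∀ a w → a + a ≡ a + a + w - w
      alg = solve-∀ ring

    -- If the error is at most t then |S| ≤ N, where S is the sum of the signs and N the number of
    -- rows within t; S is of order √k with constant probability, and N is smaller on average.
    escape-pointwise : ∀ {t} → 0ℚ ≤ t → ∀ v →
      window-poly K (∑ᵛ (sign t) v * ∑ᵛ (sign t) v) ≤
      ofℕ 9 * (K * K) * ⟦ t <? error v ⟧ + ofℕ 36 * (K * (∑ᵛ (within t) v * ∑ᵛ (within t) v))
    escape-pointwise {t} 0≤t v = by-cases (t <? error v)
      where
      S = ∑ᵛ (sign t) v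
      N = ∑ᵛ (within t) v
      S≡ : S ≡ ∑ᵛ (above t) v - ∑ᵛ (below t) v
      S≡ = ∑ᵛ-difference (above t) (below t) v
      0≤KN = 0≤ofℕ 36 0≤* (0≤K 0≤* 0≤sq N)
      alg₁ : ∀ c z → c * 1ℚ + z ≡ c + z
      alg₁ = solve-∀ ring
      alg₀ : ∀ c z → z ≡ c * 0ℚ + z
      alg₀ = solve-∀ ring
      alg₂ : ∀ S N → N * N ≡ S * S + (N - S) * (N + S)
      alg₂ = solve-∀ ring
      by-cases : (d : Dec (t < error v)) → window-poly K (S * S) ≤ ofℕ 9 * (K * K) * ⟦ d ⟧ + ofℕ 36 * (K * (N * N))
      by-cases (yes _)  = ≤-trans (window-poly-max K (S * S)) (≤-by (alg₁ (ofℕ 9 * (K * K)) (ofℕ 36 * (K * (N * N)))) 0≤KN)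
      by-cases (no t≮X) = ≤-trans (window-poly-small 0≤K (0≤sq S) S²≤N²) (≤-reflexive (alg₀ (ofℕ 9 * (K * K)) (ofℕ 36 * (K * (N * N)))))
        where
        bal = balanced {t} {v} 0≤t (≮⇒≥ t≮X)
        S²≤N² : S * S ≤ N * N
        S²≤N² = ≤-by (alg₂ S N) (≤-trans 0≤1 (subst (λ s → 1ℚ ≤ N - s) (sym S≡) (proj₁ bal)) 0≤* ≤-trans 0≤1 (subst (λ s → 1ℚ ≤ N + s) (sym S≡) (proj₂ bal)))

    window-mean : ∀ {t} → 0ℚ ≤ t →
      K * K * (ofℕ 31 * inv-suc 15 - ofℕ 13 * ½ * E 𝔼 (within t)) ≤ E 𝔼ᵏ (λ v → window-poly K (∑ᵛ (sign t) v * ∑ᵛ (sign t) v))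
    window-mean {t} 0≤t = ≤-trans (≤-by (alg₂ K π M₄) (0≤- M₄≤)) (≤-reflexive (sym moments))
      where
      π = E 𝔼 (within t)
      S² : Vec ℚ k → ℚ
      S² v = ∑ᵛ (sign t) v * ∑ᵛ (sign t) v
      M₄ = E 𝔼ᵏ (λ v → S² v * S² v)
      c = ofℕ 25 * (inv-suc 3 * inv-suc 3)
      alg₁ : ∀ K y → (y - inv-suc 3 * K) * (ofℕ 25 * inv-suc 3 * K - y) ≡
        - (ofℕ 25 * (inv-suc 3 * inv-suc 3) * (K * K)) + ofℕ 13 * ½ * K * y + (- 1ℚ) * (y * y)
      alg₁ = solve-∀ ring
      M₂ : E 𝔼ᵏ S² ≡ K * (1ℚ - π)
      M₂ = trans (second k (sign t)) (trans (cong₂ (λ μ ν → K * μ * (K * μ) + K * (ν - μ * μ)) (sign-mean t) (sign-var 0≤t)) (alg K (1ℚ - π)))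
        where
        alg : ∀ K ν → K * 0ℚ * (K * 0ℚ) + K * (ν - 0ℚ * 0ℚ) ≡ K * ν
        alg = solve-∀ ring
      moments : E 𝔼ᵏ (λ v → window-poly K (S² v)) ≡ - (c * (K * K)) + ofℕ 13 * ½ * K * (K * (1ℚ - π)) + (- 1ℚ) * M₄
      moments = trans (E-cong 𝔼ᵏ (λ v → alg₁ K (S² v))) (trans (E-quadratic 𝔼ᵏ (- (c * (K * K))) (ofℕ 13 * ½ * K) (- 1ℚ) S²)
        (cong (λ z → - (c * (K * K)) + ofℕ 13 * ½ * K * z + (- 1ℚ) * M₄) M₂))
      M₄≤ : M₄ ≤ ofℕ 3 * (K * K)
      M₄≤ = ≤-trans (≤-reflexive (E-cong 𝔼ᵏ (λ v → alg (∑ᵛ (sign t) v))))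
        (≤-trans (fourth k (sign t) (sign-mean t) var≤1 (sign-cube 0≤t) 0ℚ) (≤-reflexive (alg′ K)))
        where
        alg : ∀ s → s * s * (s * s) ≡ (0ℚ + s) * (0ℚ + s) * ((0ℚ + s) * (0ℚ + s))
        alg = solve-∀ ring
        alg′ : ∀ K → 0ℚ * 0ℚ * (0ℚ * 0ℚ) + ofℕ 6 * K * (0ℚ * 0ℚ) + ofℕ 3 * (K * K) ≡ ofℕ 3 * (K * K)
        alg′ = solve-∀ ring
        alg″ : ∀ w → 1ℚ ≡ 1ℚ - w + w
        alg″ = solve-∀ ring
        var≤1 : E 𝔼 (λ x → sign t x * sign t x) ≤ 1ℚ
        var≤1 = ≤-trans (≤-reflexive (sign-var 0≤t)) (≤-by (alg″ π) (0≤within t))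
      alg₂ : ∀ K π M → - (ofℕ 25 * (inv-suc 3 * inv-suc 3) * (K * K)) + ofℕ 13 * ½ * K * (K * (1ℚ - π)) + (- 1ℚ) * M ≡
        K * K * (ofℕ 31 * inv-suc 15 - ofℕ 13 * ½ * π) + (ofℕ 3 * (K * K) - M)
      alg₂ = solve-∀ ring

    within-second : ∀ t → E 𝔼ᵏ (λ v → ∑ᵛ (within t) v * ∑ᵛ (within t) v) ≤ K * (K * (E 𝔼 (within t) * E 𝔼 (within t)) + E 𝔼 (within t))
    within-second t = ≤-trans (≤-reflexive (trans (second k (within t)) (cong (λ ν → K * π * (K * π) + K * (ν - π * π)) (E-cong 𝔼 (λ x → ⟦⟧-idem (∣ x ∣ ≤? t))))))
      (≤-by (alg K π) (0≤K 0≤* 0≤sq π))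
      where
      π = E 𝔼 (within t)
      alg : ∀ K π → K * (K * (π * π) + π) ≡ K * π * (K * π) + K * (π - π * π) + K * (π * π)
      alg = solve-∀ ring

    escape-many : ∀ {t} → 0ℚ ≤ t → E 𝔼 (within t) ≤ inv-suc 99 → K * (E 𝔼 (within t) * E 𝔼 (within t)) ≤ inv-suc 2499 →
      inv-suc 7 ≤ tail-prob t
    escape-many {t} 0≤t π≤ Kπ²≤ = *-cancel (0<* (0<ofℕ-suc 8) (0<* 0<K 0<K)) (≤-by (alg₁ K π (tail-prob t) (K * (π * π)))
      (0≤- chain 0≤+ (0≤K 0≤* 0≤K) 0≤* (nonNegative⁻¹ (ofℕ 85 * ½) 0≤* 0≤- π≤ 0≤+ 0≤ofℕ 36 0≤* 0≤- Kπ²≤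
        0≤+ nonNegative⁻¹ (ofℕ 31 * inv-suc 15 - ofℕ 9 * inv-suc 7 - ofℕ 85 * ½ * inv-suc 99 - ofℕ 36 * inv-suc 2499))))
      where
      π = E 𝔼 (within t)
      0<K : 0ℚ < K
      0<K = 0<ofℕ-suc (m ℕ.+ m)
      S² N² : Vec ℚ k → ℚ
      S² v = ∑ᵛ (sign t) v * ∑ᵛ (sign t) v
      N² v = ∑ᵛ (within t) v * ∑ᵛ (within t) v
      chain : K * K * (ofℕ 31 * inv-suc 15 - ofℕ 13 * ½ * π) ≤ ofℕ 9 * (K * K) * tail-prob t + ofℕ 36 * (K * (K * (K * (π * π) + π)))
      chain = ≤-trans (window-mean 0≤t) (≤-trans (E-mono 𝔼ᵏ (escape-pointwise 0≤t))
        (≤-trans (≤-reflexive (trans (E-+ 𝔼ᵏ (λ v → ofℕ 9 * (K * K) * ⟦ t <? error v ⟧) (λ v → ofℕ 36 * (K * N² v)))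
            (cong₂ _+_ (E-* 𝔼ᵏ (ofℕ 9 * (K * K)) (λ v → ⟦ t <? error v ⟧)) (trans (E-* 𝔼ᵏ (ofℕ 36) (λ v → K * N² v)) (cong (ofℕ 36 *_) (E-* 𝔼ᵏ K N²))))))
          (+-monoʳ-≤ (ofℕ 9 * (K * K) * tail-prob t) (*-monoˡ (0≤ofℕ 36) (*-monoˡ 0≤K (within-second t))))))
      alg₁ : ∀ K π T y → ofℕ 9 * (K * K) * T ≡ ofℕ 9 * (K * K) * inv-suc 7 +
        (ofℕ 9 * (K * K) * T + ofℕ 36 * (K * (K * (y + π))) - K * K * (ofℕ 31 * inv-suc 15 - ofℕ 13 * ½ * π)
         + K * K * (ofℕ 85 * ½ * (inv-suc 99 - π) + ofℕ 36 * (inv-suc 2499 - y)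
           + (ofℕ 31 * inv-suc 15 - ofℕ 9 * inv-suc 7 - ofℕ 85 * ½ * inv-suc 99 - ofℕ 36 * inv-suc 2499)))
      alg₁ = solve-∀ ring

    escape-few : ∀ {t} → 0ℚ ≤ t → (1ℚ - E 𝔼 (within t)) ^ k ≤ tail-prob t
    escape-few {t} 0≤t = ≤-trans (≤-reflexive (trans (cong (_^ k) (sym out-mean)) (sym (E-∏ᵛ k out)))) (E-mono 𝔼ᵏ pointwise)
      where
      out : ℚ → ℚ
      out x = 1ℚ - within t x
      out-mean : E 𝔼 out ≡ 1ℚ - E 𝔼 (within t)
      out-mean = trans (E-cong 𝔼 (λ x → alg₁ (within t x))) (trans (E-linear 𝔼 1ℚ (- 1ℚ) (λ _ → 1ℚ) (within t))
        (trans (cong (λ z → 1ℚ * z + (- 1ℚ) * E 𝔼 (within t)) (E-const 𝔼 1ℚ)) (alg₂ (E 𝔼 (within t)))))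
        where
        alg₁ : ∀ x → 1ℚ - x ≡ 1ℚ * 1ℚ + (- 1ℚ) * x
        alg₁ = solve-∀ ring
        alg₂ : ∀ x → 1ℚ * 1ℚ + (- 1ℚ) * x ≡ 1ℚ - x
        alg₂ = solve-∀ ring
      0≤out : ∀ x → 0ℚ ≤ out x
      0≤out x = 0≤- (⟦⟧≤1 (∣ x ∣ ≤? t))
      alg₃ : ∀ w → 1ℚ ≡ 1ℚ - w + w
      alg₃ = solve-∀ ring
      out≤1 : ∀ x → out x ≤ 1ℚ
      out≤1 x = ≤-by (alg₃ (within t x)) (0≤⟦⟧ (∣ x ∣ ≤? t))
      out*within : ∀ x → out x * within t x ≡ 0ℚ
      out*within x = trans (alg (within t x)) (trans (cong (λ z → within t x - z) (⟦⟧-idem (∣ x ∣ ≤? t))) (+-inverseʳ (within t x)))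
        where
        alg : ∀ w → (1ℚ - w) * w ≡ w - w * w
        alg = solve-∀ ring
      pointwise : ∀ v → ∏ᵛ out v ≤ ⟦ t <? error v ⟧
      pointwise v = by-cases (t <? error v)
        where
        P = ∑ᵛ (above t) v - ∑ᵛ (below t) v
        N = ∑ᵛ (within t) v
        alg : ∀ N P → N ≡ 1ℚ + ½ * (N - P - 1ℚ + (N + P - 1ℚ))
        alg = solve-∀ ring
        by-cases : (d : Dec (t < error v)) → ∏ᵛ out v ≤ ⟦ d ⟧
        by-cases (yes _)  = ∏ᵛ≤1 0≤out out≤1 v
        by-cases (no t≮X) = ≤-trans (≤-reflexive (sym (*-identityʳ (∏ᵛ out v)))) (≤-trans (*-monoˡ (0≤∏ᵛ 0≤out v) 1≤N) (≤-reflexive (∏ᵛ*∑ᵛ≡0 out*within v)))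
          where
          bal = balanced {t} {v} 0≤t (≮⇒≥ t≮X)
          1≤N : 1ℚ ≤ N
          1≤N = ≤-by (alg N P) (0≤½ 0≤* (0≤- (proj₁ bal) 0≤+ 0≤- (proj₂ bal)))

    markov : ∀ {t} → 0ℚ ≤ t → t * tail-prob t ≤ E 𝔼ᵏ error
    markov {t} 0≤t = ≤-trans (≤-reflexive (sym (E-* 𝔼ᵏ t (λ v → ⟦ t <? error v ⟧)))) (E-mono 𝔼ᵏ (λ v → by-cases v (t <? error v)))
      where
      by-cases : ∀ v → (d : Dec (t < error v)) → t * ⟦ d ⟧ ≤ error v
      by-cases v (yes t<X) = ≤-trans (≤-reflexive (*-identityʳ t)) (<⇒≤ t<X)
      by-cases v (no _)    = ≤-trans (≤-reflexive (*-zeroʳ t)) (0≤∣p∣ (deviation f v))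

  -- The sample space of the sketch

  total : ∀ {A : Set} → (A → ℚ) → List A → ℚ
  total F []       = 0ℚ
  total F (x ∷ xs) = F x + total F xs

  uniform : ∀ {A : Set} → List A → (A → ℚ) → ℚ
  uniform xs F = total F xs * inv (length xs)

  total-cong : ∀ {A : Set} {F G : A → ℚ} → (∀ a → F a ≡ G a) → ∀ xs → total F xs ≡ total G xs
  total-cong eq []       = refl
  total-cong eq (x ∷ xs) = cong₂ _+_ (eq x) (total-cong eq xs)

  total-+ : ∀ {A : Set} (F G : A → ℚ) xs → total (λ a → F a + G a) xs ≡ total F xs + total G xs
  total-+ F G []       = refl
  total-+ F G (x ∷ xs) = trans (cong (F x + G x +_) (total-+ F G xs)) (alg (F x) (G x) (total F xs) (total G xs))
    where
    alg : ∀ a b c d → a + b + (c + d) ≡ a + c + (b + d)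
    alg = solve-∀ ring

  total-* : ∀ {A : Set} (F : A → ℚ) c xs → total (λ a → F a * c) xs ≡ total F xs * c
  total-* F c []       = sym (*-zeroˡ c)
  total-* F c (x ∷ xs) = trans (cong (F x * c +_) (total-* F c xs)) (sym (*-distribʳ-+ c (F x) (total F xs)))

  total-++ : ∀ {A : Set} (F : A → ℚ) xs ys → total F (xs ++ ys) ≡ total F xs + total F ys
  total-++ F [] ys       = sym (+-identityˡ (total F ys))
  total-++ F (x ∷ xs) ys = trans (cong (F x +_) (total-++ F xs ys)) (sym (+-assoc (F x) (total F xs) (total F ys)))

  total-map : ∀ {A C : Set} (F : C → ℚ) (g : A → C) xs → total F (map g xs) ≡ total (F ∘ g) xs
  total-map F g []       = refl
  total-map F g (x ∷ xs) = cong (F (g x) +_) (total-map F g xs)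

  total-swap : ∀ {A C : Set} (F : A → C → ℚ) xs ys → total (λ a → total (F a) ys) xs ≡ total (λ b → total (λ a → F a b) xs) ys
  total-swap F [] []       = refl
  total-swap F [] (y ∷ ys) = trans (total-swap F [] ys) (sym (+-identityˡ (total (λ _ → 0ℚ) ys)))
  total-swap F (x ∷ xs) ys = trans (cong (total (F x) ys +_) (total-swap F xs ys)) (sym (total-+ (F x) (λ b → total (λ a → F a b) xs) ys))

  uniform-cong : ∀ {A : Set} xs {F G : A → ℚ} → (∀ a → F a ≡ G a) → uniform xs F ≡ uniform xs G
  uniform-cong xs eq = cong (_* inv (length xs)) (total-cong eq xs)

  uniform-swap : ∀ {A C : Set} xs ys (F : A → C → ℚ) →
    uniform xs (λ a → uniform ys (F a)) ≡ uniform ys (λ b → uniform xs (λ a → F a b))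
  uniform-swap xs ys F = trans (cong (_* inv (length xs)) (total-* (λ a → total (F a) ys) (inv (length ys)) xs))
    (trans (cong (λ t → t * inv (length ys) * inv (length xs)) (total-swap F xs ys))
    (trans (alg (total (λ b → total (λ a → F a b) xs) ys) (inv (length ys)) (inv (length xs)))
      (cong (_* inv (length ys)) (sym (total-* (λ b → total (λ a → F a b) xs) (inv (length xs)) ys)))))
    where
    alg : ∀ t a b → t * a * b ≡ t * b * a
    alg = solve-∀ ring

  uniform-concatMap : ∀ {A C D : Set} (xs : List A) (ys : List C) (g : A → C → D) (F : D → ℚ) →
    uniform (concatMap (λ a → map (g a) ys) xs) F ≡ uniform xs (λ a → uniform ys (λ b → F (g a b)))
  uniform-concatMap xs ys g F = trans (cong₂ _*_ (sum xs) (trans (cong inv (len xs)) (inv-* (length xs) (length ys))))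
    (trans (alg (total (λ a → total (F ∘ g a) ys) xs) (inv (length xs)) (inv (length ys)))
      (cong (_* inv (length xs)) (sym (total-* (λ a → total (F ∘ g a) ys) (inv (length ys)) xs))))
    where
    alg : ∀ t a b → t * (a * b) ≡ t * b * a
    alg = solve-∀ ring
    len : ∀ xs → length (concatMap (λ a → map (g a) ys) xs) ≡ length xs ℕ.* length ys
    len []       = refl
    len (x ∷ xs) = trans (length-++ (map (g x) ys)) (cong₂ ℕ._+_ (length-map (g x) ys) (len xs))
    sum : ∀ xs → total F (concatMap (λ a → map (g a) ys) xs) ≡ total (λ a → total (F ∘ g a) ys) xs
    sum []       = refl
    sum (x ∷ xs) = trans (total-++ F (map (g x) ys) (concatMap (λ a → map (g a) ys) xs)) (cong₂ _+_ (total-map F (g x) ys) (sum xs))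

  average-map : ∀ {A : Set} (F : A → ℚ) xs → average (map F xs) ≡ uniform xs F
  average-map F []       = refl
  average-map F (x ∷ xs) = cong₂ (λ s l → (F x + s) * inv-suc l) (sum xs) (length-map F xs)
    where
    sum : ∀ xs → sumℚ (map F xs) ≡ total F xs
    sum []       = refl
    sum (x ∷ xs) = cong (F x +_) (sum xs)

  uniform-const : ∀ {A : Set} (xs : List A) x → 1 ℕ.≤ length xs → uniform xs (λ _ → x) ≡ x
  uniform-const xs x 1≤len = trans (cong (_* inv (length xs)) (sum xs))
    (trans (alg (ofℕ (length xs)) (inv (length xs)) x) (trans (cong (_* x) (ofℕ*inv 1≤len)) (*-identityˡ x)))
    where
    alg : ∀ b p x → b * x * p ≡ b * p * x
    alg = solve-∀ ring
    alg₂ : ∀ x n → x + n * x ≡ (1ℚ + n) * x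
    alg₂ = solve-∀ ring
    sum : ∀ xs → total (λ _ → x) xs ≡ ofℕ (length xs) * x
    sum []       = sym (*-zeroˡ x)
    sum (_ ∷ xs) = trans (cong (x +_) (sum xs)) (trans (alg₂ x (ofℕ (length xs))) (cong (_* x) (sym (ofℕ-suc (length xs)))))

  total-tabulate : ∀ {A : Set} n (F : A → ℚ) (g : Fin n → A) → total F (toList (tabulate g)) ≡ Σℚ n (F ∘ g)
  total-tabulate zero F g    = refl
  total-tabulate (suc n) F g = cong (F (g Fin.zero) +_) (total-tabulate n F (g ∘ Fin.suc))

  Σℚ-const : ∀ n c → Σℚ n (λ _ → c) ≡ ofℕ n * c
  Σℚ-const zero c    = sym (*-zeroˡ c)
  Σℚ-const (suc n) c = trans (cong (c +_) (Σℚ-const n c)) (trans (alg c (ofℕ n)) (cong (_* c) (sym (ofℕ-suc n))))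
    where
    alg : ∀ c n → c + n * c ≡ (1ℚ + n) * c
    alg = solve-∀ ring

  Σℚ-iverson : ∀ {B} (b : Fin B) (g : ℚ → ℚ) → Σℚ B (λ a → g (iverson a b)) ≡ g 1ℚ + (ofℕ B - 1ℚ) * g 0ℚ
  Σℚ-iverson {suc B} Fin.zero g = cong (g 1ℚ +_) (trans (Σℚ-const B (g 0ℚ))
    (cong (_* g 0ℚ) (trans (alg (ofℕ B)) (cong (_- 1ℚ) (sym (ofℕ-suc B))))))
    where
    alg : ∀ x → x ≡ 1ℚ + x - 1ℚ
    alg = solve-∀ ring
  Σℚ-iverson {suc B} (Fin.suc b) g = trans (cong (g 0ℚ +_) (Σℚ-iverson b g))
    (trans (alg (g 0ℚ) (g 1ℚ) (ofℕ B)) (cong (λ x → g 1ℚ + (x - 1ℚ) * g 0ℚ) (sym (ofℕ-suc B))))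
    where
    alg : ∀ x y b → x + (y + (b - 1ℚ) * x) ≡ y + (1ℚ + b - 1ℚ) * x
    alg = solve-∀ ring

  iverson-refl : ∀ {B} (b : Fin B) → iverson b b ≡ 1ℚ
  iverson-refl Fin.zero    = refl
  iverson-refl (Fin.suc b) = iverson-refl b

  Σℚ-cong : ∀ n {g h : Fin n → ℚ} → (∀ j → g j ≡ h j) → Σℚ n g ≡ Σℚ n h
  Σℚ-cong zero eq    = refl
  Σℚ-cong (suc n) eq = cong₂ _+_ (eq Fin.zero) (Σℚ-cong n (eq ∘ Fin.suc))

  uniform-allFuns-suc : ∀ {A : Set} (xs : List A) n (F : (Fin (suc n) → A) → ℚ) →
    (∀ {h h′} → (∀ j → h j ≡ h′ j) → F h ≡ F h′) →
    uniform (allFuns xs (suc n)) F ≡ uniform xs (λ a → uniform (allFuns xs n) (λ g → F (a ◂ g)))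
  uniform-allFuns-suc xs n F ext = trans (uniform-concatMap xs (allFuns xs n) _ F)
    (uniform-cong xs (λ a → uniform-cong (allFuns xs n) (λ g → ext (λ { Fin.zero → refl ; (Fin.suc j) → refl }))))

  module Sketch (B : ℕ) (1≤B : 1 ℕ.≤ B) (0≤p : 0ℚ ≤ inv B) (2p≤1 : inv B + inv B ≤ 1ℚ) where

    open RandomWalk (inv B) 0≤p 2p≤1

    buckets : List (Fin B)
    buckets = allFin B

    uniform-buckets : ∀ b (g : ℚ → ℚ) → uniform buckets (λ a → g (iverson a b)) ≡ q * g 0ℚ + inv B * g 1ℚ
    uniform-buckets b g = trans (cong₂ _*_ (trans (total-tabulate B (λ a → g (iverson a b)) (λ a → a)) (Σℚ-iverson b g)) (cong inv (length-toList (tabulate (λ (a : Fin B) → a)))))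
      (trans (alg₁ (g 0ℚ) (g 1ℚ) (ofℕ B) (inv B)) (trans (cong (λ z → inv B * g 1ℚ + (z - inv B) * g 0ℚ) (ofℕ*inv 1≤B)) (+-comm (inv B * g 1ℚ) (q * g 0ℚ))))
      where
      alg₁ : ∀ x y b p → (y + (b - 1ℚ) * x) * p ≡ p * y + (b * p - p) * x
      alg₁ = solve-∀ ring

    uniform-signs : ∀ (g : Bool → ℚ) → uniform allBool g ≡ ½ * (g true + g false)
    uniform-signs g = alg (g true) (g false)
      where
      alg : ∀ x y → (x + (y + 0ℚ)) * ½ ≡ ½ * (x + y)
      alg = solve-∀ ring

    uniform-step : ∀ b c (G : ℚ → ℚ) y →
      uniform buckets (λ a → uniform allBool (λ σ → G (y + iverson a b * sgn σ * c))) ≡ step c G y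
    uniform-step b c G y = trans (uniform-buckets b (λ x → uniform allBool (λ σ → G (y + x * sgn σ * c))))
      (cong₂ (λ u v → q * u + inv B * v)
        (trans (uniform-signs (λ σ → G (y + 0ℚ * sgn σ * c))) (trans (cong₂ (λ u v → ½ * (G u + G v)) (alg₀ y 1ℚ c) (alg₀ y (- 1ℚ) c)) (½-double (G y))))
        (trans (uniform-signs (λ σ → G (y + 1ℚ * sgn σ * c))) (cong₂ (λ u v → ½ * (G u + G v)) (alg₊ y c) (alg₋ y c))))
      where
      alg₀ : ∀ y s c → y + 0ℚ * s * c ≡ y
      alg₀ = solve-∀ ring
      alg₊ : ∀ y c → y + 1ℚ * 1ℚ * c ≡ y + c
      alg₊ = solve-∀ ring
      alg₋ : ∀ y c → y + 1ℚ * (- 1ℚ) * c ≡ y - c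
      alg₋ = solve-∀ ring

    hashes : ∀ n → List (Fin n → Fin B)
    hashes n = allFuns buckets n

    signings : ∀ n → List (Fin n → Bool)
    signings n = allFuns allBool n

    bucketSum : ∀ n → (ℕ → ℚ) → Fin B → (Fin n → Fin B) → (Fin n → Bool) → ℚ
    bucketSum n c b h s = Σℚ n (λ j → iverson (h j) b * sgn (s j) * c (toℕ j))

    Extensional : ∀ {n} → ((Fin n → Fin B) → (Fin n → Bool) → ℚ) → Set
    Extensional {n} F = ∀ {h h′ s s′} → (∀ j → h j ≡ h′ j) → (∀ j → s j ≡ s′ j) → F h s ≡ F h′ s′

    uniform-row : ∀ n → ((Fin n → Fin B) → (Fin n → Bool) → ℚ) → ℚ
    uniform-row n F = uniform (hashes n) (λ h → uniform (signings n) (F h))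

    uniform-row-cong : ∀ n {F G : (Fin n → Fin B) → (Fin n → Bool) → ℚ} → (∀ h s → F h s ≡ G h s) → uniform-row n F ≡ uniform-row n G
    uniform-row-cong n eq = uniform-cong (hashes n) (λ h → uniform-cong (signings n) (eq h))

    uniform-row-suc : ∀ n (F : (Fin (suc n) → Fin B) → (Fin (suc n) → Bool) → ℚ) → Extensional F →
      uniform-row (suc n) F ≡ uniform buckets (λ a → uniform allBool (λ σ → uniform-row n (λ h s → F (a ◂ h) (σ ◂ s))))
    uniform-row-suc n F ext =
      trans (uniform-allFuns-suc buckets n (λ h → uniform (signings (suc n)) (F h)) (λ h≗ → uniform-cong (signings (suc n)) (λ s → ext h≗ (λ _ → refl))))
        (uniform-cong buckets (λ a →
          trans (uniform-cong (hashes n) (λ h → uniform-allFuns-suc allBool n (F (a ◂ h)) (λ s≗ → ext (λ _ → refl) s≗)))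
                (uniform-swap (hashes n) allBool (λ h σ → uniform (signings n) (λ s → F (a ◂ h) (σ ◂ s))))))

    uniform-row-zero : ∀ (F : (Fin 0 → Fin B) → (Fin 0 → Bool) → ℚ) {x} → (∀ h s → F h s ≡ x) → uniform-row 0 F ≡ x
    uniform-row-zero F {x} eq = trans (uniform-row-cong 0 eq)
      (trans (uniform-const (hashes 0) (uniform (signings 0) (λ _ → x)) ℕₚ.≤-refl) (uniform-const (signings 0) x ℕₚ.≤-refl))

    bucketSum-cong : ∀ n c {b b′ h h′ s s′} → b ≡ b′ → (∀ j → h j ≡ h′ j) → (∀ j → s j ≡ s′ j) → bucketSum n c b h s ≡ bucketSum n c b′ h′ s′
    bucketSum-cong n c refl h≗ s≗ = Σℚ-cong n (λ j → cong₂ (λ u v → iverson u _ * sgn v * c (toℕ j)) (h≗ j) (s≗ j))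

    noise-law : ∀ n c b Φ y → uniform-row n (λ h s → Φ (y + bucketSum n c b h s)) ≡ walk c n Φ y
    noise-law zero c b Φ y    = uniform-row-zero _ (λ h s → cong Φ (+-identityʳ y))
    noise-law (suc n) c b Φ y = trans (uniform-row-suc n (λ h s → Φ (y + bucketSum (suc n) c b h s))
        (λ h≗ s≗ → cong (λ z → Φ (y + z)) (bucketSum-cong (suc n) c {b} refl h≗ s≗)))
      (trans (uniform-cong buckets (λ a → uniform-cong allBool (λ σ → trans
          (uniform-row-cong n (λ h s → cong Φ (sym (+-assoc y (iverson a b * sgn σ * c 0) (bucketSum n (c ∘ suc) b h s)))))
          (noise-law n (c ∘ suc) b Φ (y + iverson a b * sgn σ * c 0)))))
        (uniform-step b (c 0) (walk (c ∘ suc) n Φ) y))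

    step-zero : ∀ {w} F y → w ≡ 0ℚ → step w F y ≡ F y
    step-zero {w} F y refl = trans (cong₂ (λ u v → q * F y + inv B * (½ * (F u + F v))) (+-identityʳ y) (+-identityʳ y)) (alg (inv B) (F y))
      where
      alg : ∀ p x → (1ℚ - p) * x + p * (½ * (x + x)) ≡ x
      alg = solve-∀ ring

    query-law : ∀ n (i : Fin n) (c w : ℕ → ℚ) → w (toℕ i) ≡ 0ℚ → (∀ j → j ≢ toℕ i → w j ≡ c j) →
      ∀ (Ψ : Fin B → Bool → ℚ → ℚ) y →
      uniform-row n (λ h s → Ψ (h i) (s i) (y + bucketSum n c (h i) h s)) ≡
      uniform buckets (λ b → uniform allBool (λ τ → walk w n (Ψ b τ) (y + sgn τ * c (toℕ i))))
    query-law (suc n) Fin.zero c w w₀ w≡c Ψ y =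
      trans (uniform-row-suc n (λ h s → Ψ (h Fin.zero) (s Fin.zero) (y + bucketSum (suc n) c (h Fin.zero) h s))
        (λ {h} {h′} {s} {s′} h≗ s≗ → cong₂ (λ f z → f (y + z)) (cong₂ Ψ (h≗ Fin.zero) (s≗ Fin.zero)) (bucketSum-cong (suc n) c (h≗ Fin.zero) h≗ s≗)))
      (uniform-cong buckets (λ b → uniform-cong allBool (λ τ → trans
        (uniform-row-cong n (λ h s → cong (Ψ b τ) (trans (sym (+-assoc y (iverson b b * sgn τ * c 0) (bucketSum n (c ∘ suc) b h s)))
          (cong (λ x → y + x + bucketSum n (c ∘ suc) b h s) (trans (cong (λ x → x * sgn τ * c 0) (iverson-refl b)) (alg (sgn τ) (c 0)))))))
        (trans (noise-law n (c ∘ suc) b (Ψ b τ) (y + sgn τ * c 0))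
          (trans (walk-weights n (λ j → sym (w≡c (suc j) (λ ()))) (Ψ b τ) (y + sgn τ * c 0))
            (sym (step-zero (walk (w ∘ suc) n (Ψ b τ)) (y + sgn τ * c 0) w₀)))))))
      where
      alg : ∀ s c → 1ℚ * s * c ≡ s * c
      alg = solve-∀ ring
    query-law (suc n) (Fin.suc i) c w wᵢ w≡c Ψ y =
      trans (uniform-row-suc n (λ h s → Ψ (h (Fin.suc i)) (s (Fin.suc i)) (y + bucketSum (suc n) c (h (Fin.suc i)) h s))
        (λ {h} {h′} {s} {s′} h≗ s≗ → cong₂ (λ f z → f (y + z)) (cong₂ Ψ (h≗ (Fin.suc i)) (s≗ (Fin.suc i))) (bucketSum-cong (suc n) c (h≗ (Fin.suc i)) h≗ s≗)))
      (trans (uniform-cong buckets (λ a → uniform-cong allBool (λ σ → trans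
          (uniform-row-cong n (λ h s → cong (Ψ (h i) (s i)) (rotate y (iverson a (h i) * sgn σ * c 0) (bucketSum n (c ∘ suc) (h i) h s))))
          (trans (query-law n i (c ∘ suc) (w ∘ suc) wᵢ (λ j j≢i → w≡c (suc j) (j≢i ∘ ℕₚ.suc-injective)) (λ b τ z → Ψ b τ (z + iverson a b * sgn σ * c 0)) y)
            (uniform-cong buckets (λ b → uniform-cong allBool (λ τ → walk-shift (w ∘ suc) n (Ψ b τ) (iverson a b * sgn σ * c 0) (y′ τ))))))))
      (trans (uniform-cong buckets (λ a → uniform-swap allBool buckets (λ σ b → uniform allBool (H a σ b))))
      (trans (uniform-swap buckets buckets (λ a b → uniform allBool (λ σ → uniform allBool (H a σ b))))
      (uniform-cong buckets (λ b → trans (uniform-cong buckets (λ a → uniform-swap allBool allBool (λ σ τ → H a σ b τ)))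
        (trans (uniform-swap buckets allBool (λ a τ → uniform allBool (λ σ → H a σ b τ)))
          (uniform-cong allBool (λ τ → trans (uniform-step b (c 0) (walk (w ∘ suc) n (Ψ b τ)) (y′ τ))
            (cong (λ v → step v (walk (w ∘ suc) n (Ψ b τ)) (y′ τ)) (sym (w≡c 0 (λ ()))))))))))))
      where
      y′ : Bool → ℚ
      y′ τ = y + sgn τ * c (suc (toℕ i))
      H : Fin B → Bool → Fin B → Bool → ℚ
      H a σ b τ = walk (w ∘ suc) n (Ψ b τ) (y′ τ + iverson a b * sgn σ * c 0)
      rotate : ∀ y u r → y + (u + r) ≡ y + r + u
      rotate = solve-∀ ring

    rowEstimate : ∀ {n} → Fin n → (Fin n → Fin B) → (Fin n → Bool) → ℚ
    rowEstimate {n} i h s = sgn (s i) * Σℚ n (λ j → iverson (h j) (h i) * sgn (s j) * f j)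

    row-law : ∀ n (i : Fin n) (w : ℕ → ℚ) → w (toℕ i) ≡ 0ℚ → (∀ j → j ≢ toℕ i → w j ≡ inv-suc j) → ∀ Φ →
      uniform-row n (λ h s → Φ (rowEstimate i h s)) ≡ walk w n (λ x → Φ (f i + x)) 0ℚ
    row-law n i w wᵢ w≡ Φ =
      trans (uniform-row-cong n (λ h s → cong (λ z → Φ (sgn (s i) * z)) (sym (+-identityˡ (bucketSum n inv-suc (h i) h s)))))
      (trans (query-law n i inv-suc w wᵢ w≡ (λ b τ z → Φ (sgn τ * z)) 0ℚ)
      (trans (uniform-cong buckets (λ b → trans (uniform-signs G)
          (trans (cong₂ (λ u v → ½ * (u + v)) plus minus) (½-double (walk w n Φ (f i))))))
      (trans (uniform-const buckets (walk w n Φ (f i)) (subst (1 ℕ.≤_) (sym (length-toList (tabulate (λ (a : Fin B) → a)))) 1≤B))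
        (trans (cong (walk w n Φ) (sym (+-identityˡ (f i))))
        (trans (sym (walk-shift w n Φ (f i) 0ℚ)) (walk-cong w n (λ x → cong Φ (+-comm x (f i))) 0ℚ))))))
      where
      G : Bool → ℚ
      G τ = walk w n (λ z → Φ (sgn τ * z)) (0ℚ + sgn τ * f i)
      algₚ : ∀ f → 0ℚ + 1ℚ * f ≡ f
      algₚ = solve-∀ ring
      algₘ : ∀ f → - (0ℚ + (- 1ℚ) * f) ≡ f
      algₘ = solve-∀ ring
      alg₋ : ∀ z → (- 1ℚ) * z ≡ - z
      alg₋ = solve-∀ ring
      plus : walk w n (λ z → Φ (1ℚ * z)) (0ℚ + 1ℚ * f i) ≡ walk w n Φ (f i)
      plus = trans (walk-cong w n (λ z → cong Φ (*-identityˡ z)) (0ℚ + 1ℚ * f i)) (cong (walk w n Φ) (algₚ (f i)))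
      minus : walk w n (λ z → Φ ((- 1ℚ) * z)) (0ℚ + (- 1ℚ) * f i) ≡ walk w n Φ (f i)
      minus = trans (walk-cong w n (λ z → cong Φ (alg₋ z)) (0ℚ + (- 1ℚ) * f i))
        (trans (walk-neg w n Φ (0ℚ + (- 1ℚ) * f i)) (cong (walk w n Φ) (algₘ (f i))))

    walkMean : (w : ℕ → ℚ) (n : ℕ) → Mean ℚ
    walkMean w n = record
      { E        = λ F → walk w n F 0ℚ
      ; E-mono   = λ h → walk-mono w n h 0ℚ
      ; E-linear = λ a b F G → walk-linear w n a b F G 0ℚ
      ; E-const  = λ c → walk-const w n c 0ℚ
      }

    rows-law : ∀ {n} (i : Fin n) w → w (toℕ i) ≡ 0ℚ → (∀ j → j ≢ toℕ i → w j ≡ inv-suc j) → ∀ k (Φ : Vec ℚ k → ℚ) →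
      uniform (allVecs (hashes n) k) (λ hs → uniform (allVecs (signings n) k) (λ ss →
        Φ (tabulate (λ ℓ → rowEstimate i (lookup hs ℓ) (lookup ss ℓ))))) ≡
      E (power (walkMean w n) k) (λ v → Φ (Vec.map (f i +_) v))
    rows-law {n} i w wᵢ w≡ zero Φ    = trans (uniform-const (allVecs (hashes n) 0) (uniform (allVecs (signings n) 0) (λ _ → Φ [])) ℕₚ.≤-refl)
      (uniform-const (allVecs (signings n) 0) (Φ []) ℕₚ.≤-refl)
    rows-law {n} i w wᵢ w≡ (suc k) Φ =
      trans (uniform-concatMap (hashes n) (allVecs (hashes n) k) _∷_ (λ hs → uniform (allVecs (signings n) (suc k)) (G hs)))
      (trans (uniform-cong (hashes n) (λ h → trans
          (uniform-cong (allVecs (hashes n) k) (λ hs → uniform-concatMap (signings n) (allVecs (signings n) k) _∷_ (G (h ∷ hs))))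
          (trans (uniform-swap (allVecs (hashes n) k) (signings n) (λ hs s → uniform (allVecs (signings n) k) (λ ss → G (h ∷ hs) (s ∷ ss))))
            (uniform-cong (signings n) (λ s → rows-law i w wᵢ w≡ k (λ v → Φ (rowEstimate i h s ∷ v)))))))
        (row-law n i w wᵢ w≡ (λ x → E (power (walkMean w n) k) (λ v → Φ (x ∷ Vec.map (f i +_) v)))))
      where
      G : Vec (Fin n → Fin B) (suc k) → Vec (Fin n → Bool) (suc k) → ℚ
      G hs ss = Φ (tabulate (λ ℓ → rowEstimate i (lookup hs ℓ) (lookup ss ℓ)))

    expectedError-law : ∀ {n} (i : Fin n) w → w (toℕ i) ≡ 0ℚ → (∀ j → j ≢ toℕ i → w j ≡ inv-suc j) → ∀ k →
      expectedError n B k i ≡ E (power (walkMean w n) k) (λ v → ∣ deviation (f i) v ∣)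
    expectedError-law {n} i w wᵢ w≡ k = trans (average-map _ (Ω n B k))
      (trans (uniform-concatMap (allVecs (hashes n) k) (allVecs (signings n) k) _,_ _)
        (rows-law i w wᵢ w≡ k (λ v → ∣ median v - f i ∣)))

  -- Assembly

  ^-antitone : ∀ {x m n} → 0ℚ ≤ x → x ≤ 1ℚ → m ℕ.≤ n → x ^ n ≤ x ^ m
  ^-antitone {x} {zero} {zero} 0≤x x≤1 _        = ≤-refl
  ^-antitone {x} {zero} {suc n} 0≤x x≤1 _       = *-mono 0≤x 0≤1 x≤1 (^-antitone {x} {zero} {n} 0≤x x≤1 ℕ.z≤n)
  ^-antitone {x} {suc m} {suc n} 0≤x x≤1 (ℕ.s≤s h) = *-monoˡ 0≤x (^-antitone 0≤x x≤1 h)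

  ^-mono : ∀ {x y} n → 0ℚ ≤ x → x ≤ y → x ^ n ≤ y ^ n
  ^-mono zero 0≤x x≤y    = ≤-refl
  ^-mono (suc n) 0≤x x≤y = *-mono 0≤x (0≤^ n (≤-trans 0≤x x≤y)) x≤y (^-mono n 0≤x x≤y)

  0<^ : ∀ {x} n → 0ℚ < x → 0ℚ < x ^ n
  0<^ zero h    = positive⁻¹ 1ℚ
  0<^ (suc n) h = 0<* h (0<^ n h)

  halve : ∀ n → Σ ℕ λ h → h ℕ.+ h ℕ.≤ n × n ℕ.≤ suc (h ℕ.+ h)
  halve zero          = 0 , ℕ.z≤n , ℕ.z≤n
  halve (suc zero)    = 0 , ℕ.z≤n , ℕ.s≤s ℕ.z≤n
  halve (suc (suc n)) with halve n
  ... | h , l , u = suc h , ℕ.s≤s (subst (ℕ._≤ suc n) (sym (ℕₚ.+-suc h h)) (ℕ.s≤s l)) ,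
    ℕ.s≤s (ℕ.s≤s (subst (n ℕ.≤_) (sym (ℕₚ.+-suc h h)) u))

  odd-form : ∀ k → ¬ (2 ∣ k) → Σ ℕ λ m → k ≡ suc (m ℕ.+ m)
  odd-form k odd with halve k
  ... | h , l , u with ℕₚ.m≤n⇒m<n∨m≡n l
  ...   | inj₁ lt = h , ℕₚ.≤-antisym u lt
  ...   | inj₂ eq = ⊥-elim (odd (divides h (trans (sym eq) (trans (cong (h ℕ.+_) (sym (ℕₚ.+-identityʳ h))) (ℕₚ.*-comm 2 h)))))

  square : ℕ → ℕ
  square A = 2 ℕ.^ A ℕ.* 2 ℕ.^ A

  square-suc : ∀ A → square (suc A) ≡ 4 ℕ.* square A
  square-suc A = trans (ℕₚ.*-assoc 2 x (2 ℕ.* x)) (trans (cong (2 ℕ.*_) (trans (sym (ℕₚ.*-assoc x 2 x)) (trans (cong (ℕ._* x) (ℕₚ.*-comm x 2)) (ℕₚ.*-assoc 2 x x)))) (sym (ℕₚ.*-assoc 2 2 (x ℕ.* x))))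
    where x = 2 ℕ.^ A

  square-mono : ∀ {A A′} → A ℕ.≤ A′ → square A ℕ.≤ square A′
  square-mono h = ℕₚ.*-mono-≤ (ℕₚ.^-monoʳ-≤ 2 h) (ℕₚ.^-monoʳ-≤ 2 h)

  log₄ : ∀ k → 1 ℕ.≤ k → Σ ℕ λ A → square A ℕ.≤ k × k ℕ.≤ 4 ℕ.* square A
  log₄ k 1≤k = search k 0 1≤k (subst (λ e → k ℕ.≤ square e) (sym (ℕₚ.+-identityʳ k))
    (ℕₚ.≤-trans (ℕₚ.<⇒≤ (n<2^n k)) (ℕₚ.m≤m*n (2 ℕ.^ k) (2 ℕ.^ k) {{ℕ.>-nonZero (1≤2^ k)}})))
    where
    search : ∀ fuel A → square A ℕ.≤ k → k ℕ.≤ square (fuel ℕ.+ A) → Σ ℕ λ A → square A ℕ.≤ k × k ℕ.≤ 4 ℕ.* square A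
    search zero A l u = A , l , ℕₚ.≤-trans u (ℕₚ.m≤n*m (square A) 4)
    search (suc fuel) A l u with square (suc A) ℕ.≤? k
    ... | yes l′ = search fuel (suc A) l′ (subst (λ e → k ℕ.≤ square e) (sym (ℕₚ.+-suc fuel A)) u)
    ... | no ¬l′ = A , l , ℕₚ.≤-trans (ℕₚ.<⇒≤ (ℕₚ.≰⇒> ¬l′)) (ℕₚ.≤-reflexive (square-suc A))

  weight : ℕ → ℕ → ℚ
  weight i j with j ℕ.≟ i
  ... | yes _ = 0ℚ
  ... | no _  = inv-suc j

  weight-self : ∀ i → weight i i ≡ 0ℚ
  weight-self i with i ℕ.≟ i
  ... | yes _ = refl
  ... | no h  = ⊥-elim (h refl)

  weight-other : ∀ i j → j ≢ i → weight i j ≡ inv-suc j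
  weight-other i j h with j ℕ.≟ i
  ... | yes e = ⊥-elim (h e)
  ... | no _  = refl

  above-markov : ∀ {b x t} → 0ℚ ≤ t → b * x * t ≡ 1ℚ → ∀ z → above t z ≤ b * x * (b * x) * (z * z)
  above-markov {b} {x} {t} 0≤t bxt z = by-cases (t <? z)
    where
    alg : ∀ c t → c * c * (t * t) ≡ c * t * (c * t)
    alg = solve-∀ ring
    by-cases : (d : Dec (t < z)) → ⟦ d ⟧ ≤ b * x * (b * x) * (z * z)
    by-cases (yes t<z) = ≤-trans (≤-reflexive (sym (trans (alg (b * x) t) (cong₂ _*_ bxt bxt)))) (*-monoˡ (0≤sq (b * x)) (sq-mono 0≤t (<⇒≤ t<z)))
    by-cases (no _)    = 0≤sq (b * x) 0≤* 0≤sq z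

  exponential-small : ∀ {K k⁻ x} → 0ℚ ≤ K → 0ℚ ≤ k⁻ → 0ℚ ≤ x → K * k⁻ ≡ 1ℚ → (1ℚ + (K + K) * (ofℕ 2 * inv-suc 8)) * x ≤ 1ℚ → x ≤ ofℕ 3 * k⁻
  exponential-small {K} {k⁻} {x} 0≤K 0≤k⁻ 0≤x Kk⁻ h = ≤-trans
    (≤-reflexive (trans (sym (*-identityˡ x)) (trans (cong (_* x) (sym Kk⁻)) (alg₁ K k⁻ x))))
    (*-monoʳ 0≤k⁻ (≤-by {K * x} {ofℕ 3} (alg₂ K x) (0≤ofℕ 3 0≤* 0≤- h 0≤+ 0≤ofℕ 3 0≤* 0≤x 0≤+ 0≤inv 3 0≤* (0≤K 0≤* 0≤x))))
    where
    alg₁ : ∀ K k x → K * k * x ≡ K * x * k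
    alg₁ = solve-∀ ring
    alg₂ : ∀ K x → ofℕ 3 ≡ K * x + (ofℕ 3 * (1ℚ - (1ℚ + (K + K) * (ofℕ 2 * inv-suc 8)) * x) + ofℕ 3 * x + inv-suc 2 * (K * x))
    alg₂ = solve-∀ ring

  constant : ℕ → ℚ
  constant a = inv-suc 2399999 * inv-suc 3 ^ (4 ℕ.* square a)

  0<constant : ∀ a → 0ℚ < constant a
  0<constant a = 0<* (0<inv-suc 2399999) (0<^ (4 ℕ.* square a) (0<inv-suc 3))

  ¼≤1 : inv-suc 3 ≤ 1ℚ
  ¼≤1 = inv-antitone {1} {4} (ℕ.s≤s ℕ.z≤n) (ℕ.s≤s ℕ.z≤n)

  pow≤1 : ∀ n → inv-suc 3 ^ n ≤ 1ℚ
  pow≤1 n = ^-antitone {inv-suc 3} {0} {n} (0≤inv 4) ¼≤1 ℕ.z≤n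

  Bounds : (a k n B A : ℕ) → Fin n → Set
  Bounds a k n B A i = constant a * (inv B * half A) ≤ expectedError n B k i × expectedError n B k i ≤ ofℕ 5701 * (inv B * half A)

  -- The choice δ = 1/(300000 B√k) turns anti-concentration into the bound 1/(100√k) on the
  -- probability of a row within δ, which is what escape-many can tolerate; it needs k ≥ 4¹².
  module Analysis (m n B L A : ℕ) (i : Fin n) (1≤m : 1 ℕ.≤ m) (2≤B : 2 ℕ.≤ B) (1≤L : 1 ℕ.≤ L) (2L≤B : L ℕ.+ L ℕ.≤ B)
    (B≤2L+1 : B ℕ.≤ suc (L ℕ.+ L)) (2B≤n : B ℕ.+ B ℕ.≤ n) (kB≤n : suc (m ℕ.+ m) ℕ.* B ℕ.≤ n) (k≤B : suc (m ℕ.+ m) ℕ.≤ B)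
    (r²≤k : square A ℕ.≤ suc (m ℕ.+ m)) (k≤4r² : suc (m ℕ.+ m) ℕ.≤ 4 ℕ.* square A) where

    w : ℕ → ℚ
    w = weight (toℕ i)

    open Noise B L 2≤B 1≤L 2L≤B B≤2L+1 w (toℕ i) (weight-self (toℕ i)) (weight-other (toℕ i))
    open Sketch B 1≤B 0≤p 2p≤1 using (walkMean; expectedError-law)

    𝔼 : Mean ℚ
    𝔼 = walkMean w n

    symmetric : ∀ F → E 𝔼 (λ x → F (- x)) ≡ E 𝔼 F
    symmetric F = walk-neg w n F 0ℚ

    open LowerBound 𝔼 symmetric m (f i)

    Err : ℚ
    Err = E 𝔼ᵏ error

    expectedError≡ : expectedError n B (suc (m ℕ.+ m)) i ≡ Err
    expectedError≡ = expectedError-law i w (weight-self (toℕ i)) (weight-other (toℕ i)) (suc (m ℕ.+ m))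

    B≤n : B ℕ.≤ n
    B≤n = ℕₚ.≤-trans (ℕₚ.m≤m+n B B) 2B≤n

    L≤n : L ℕ.≤ n
    L≤n = ℕₚ.≤-trans (ℕₚ.≤-trans (ℕₚ.m≤m+n L L) 2L≤B) B≤n

    near : ∀ N {t} → 1 ℕ.≤ N → 0ℚ ≤ t → ofℕ N * t ≡ ofℕ 4 * inv B → inv-suc 7 * inv N ≤ E 𝔼 (within t)
    near N {t} 1≤N 0≤t Nt = small-ball-tail N {t} {within t} 1≤N 0≤t Nt (λ x → 0≤⟦⟧ (∣ x ∣ ≤? t)) (λ x → ⟦⟧≤1 (∣ x ∣ ≤? t))
      (λ x h → ≤-reflexive (sym (⟦⟧-yes (∣ x ∣ ≤? t) h))) n L≤n

    far : ∀ N → 1 ℕ.≤ N → E 𝔼 (above (ofℕ N * inv B)) ≤ ofℕ 3 * inv N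
    far N 1≤N = tail-bound N {above T} 1≤N (λ x → 0≤⟦⟧ (T <? x)) (λ x → ⟦⟧≤1 (T <? x))
      (above-markov {b} {inv N} {T} (0≤ofℕ N 0≤* 0≤p) (trans (alg b (inv N) (ofℕ N) p) (cong₂ _*_ (ofℕ*inv 1≤N) bp))) n B≤n
      where
      T = ofℕ N * inv B
      alg : ∀ b x N p → b * x * (N * p) ≡ N * x * (b * p)
      alg = solve-∀ ring

    upper-bound : Err ≤ ofℕ 5701 * (p * half A)
    upper-bound = UpperBound.upper-bound 𝔼 symmetric m (f i) 1≤m B 1≤B A r²≤k near far (second-moment n)

    within-support : ∀ δ x → ∣ x ∣ ≤ δ ⊎ within δ x ≤ 0ℚ
    within-support δ x = by-cases (∣ x ∣ ≤? δ)
      where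
      by-cases : (d : Dec (∣ x ∣ ≤ δ)) → ∣ x ∣ ≤ δ ⊎ ⟦ d ⟧ ≤ 0ℚ
      by-cases (yes h) = inj₁ h
      by-cases (no _)  = inj₂ ≤-refl

    r⁻ : ℚ
    r⁻ = half A

    0≤r⁻ : 0ℚ ≤ r⁻
    0≤r⁻ = 0≤half A

    k⁻≤r⁻r⁻ : k⁻ ≤ r⁻ * r⁻
    k⁻≤r⁻r⁻ = ≤-trans (inv-antitone (ℕₚ.*-mono-≤ (1≤2^ A) (1≤2^ A)) r²≤k) (≤-reflexive (inv-* (2 ℕ.^ A) (2 ℕ.^ A)))

    Kr⁻r⁻≤4 : K * (r⁻ * r⁻) ≤ ofℕ 4
    Kr⁻r⁻≤4 = ≤-trans (*-monoʳ (0≤r⁻ 0≤* 0≤r⁻) (≤-trans (ofℕ-mono k≤4r²) (≤-reflexive (trans (ofℕ-* 4 (square A)) (cong (ofℕ 4 *_) (ofℕ-* (2 ℕ.^ A) (2 ℕ.^ A)))))))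
      (≤-reflexive (trans (alg (double A) r⁻) (cong (λ z → ofℕ 4 * (z * z)) (double*half A))))
      where
      alg : ∀ d h → ofℕ 4 * (d * d) * (h * h) ≡ ofℕ 4 * (d * h * (d * h))
      alg = solve-∀ ring

    δ : ℚ
    δ = inv-suc 299999 * (p * r⁻)

    0≤δ : 0ℚ ≤ δ
    0≤δ = 0≤inv 300000 0≤* (0≤p 0≤* 0≤r⁻)

    within-δ : 12 ℕ.≤ A → E 𝔼 (within δ) ≤ inv-suc 99 * r⁻
    within-δ 12≤A = ≤-trans (anti-concentration {δ} {within δ} 0≤δ (λ x → 0≤⟦⟧ (∣ x ∣ ≤? δ)) (λ x → ⟦⟧≤1 (∣ x ∣ ≤? δ)) (within-support δ) (k ℕ.+ k) n blocks 0ℚ)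
      (≤-trans (+-mono-≤ (+-mono-≤ (≤-reflexive (cong (ofℕ 1458 *_) δb)) (*-monoˡ (0≤ofℕ 9) p≤)) (≤-trans ρ≤ (*-monoˡ (0≤ofℕ 3) k⁻≤)))
        (≤-by (alg₂ r⁻) (nonNegative⁻¹ slack 0≤* 0≤r⁻)))
      where
      slack = inv-suc 99 - ofℕ 1458 * inv-suc 299999 - ofℕ 12 * inv-suc 4095
      blocks : (k ℕ.+ k) ℕ.* L ℕ.≤ n
      blocks = ℕₚ.≤-trans (ℕₚ.≤-reflexive (trans (ℕₚ.*-distribʳ-+ L k k) (sym (ℕₚ.*-distribˡ-+ k L L))))
        (ℕₚ.≤-trans (ℕₚ.*-monoʳ-≤ k 2L≤B) kB≤n)
      alg₀ : ∀ c p r b → c * (p * r) * b ≡ c * r * (b * p)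
      alg₀ = solve-∀ ring
      δb : δ * b ≡ inv-suc 299999 * r⁻
      δb = trans (alg₀ (inv-suc 299999) p r⁻ b) (trans (cong (inv-suc 299999 * r⁻ *_) bp) (*-identityʳ (inv-suc 299999 * r⁻)))
      k⁻≤ : k⁻ ≤ r⁻ * inv-suc 4095
      k⁻≤ = ≤-trans k⁻≤r⁻r⁻ (*-monoˡ 0≤r⁻ (inv-antitone (1≤2^ 12) (ℕₚ.^-monoʳ-≤ 2 12≤A)))
      p≤ : p ≤ r⁻ * inv-suc 4095
      p≤ = ≤-trans (inv-antitone (ℕ.s≤s ℕ.z≤n) k≤B) k⁻≤
      ρ≤ : ρ ^ (k ℕ.+ k) ≤ ofℕ 3 * k⁻
      ρ≤ = exponential-small 0≤K 0≤k⁻ (0≤^ (k ℕ.+ k) (nonNegative⁻¹ ρ)) Kk⁻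
        (subst (λ z → (1ℚ + z * (ofℕ 2 * inv-suc 8)) * ρ ^ (k ℕ.+ k) ≤ 1ℚ) (ofℕ-+ k k)
          (^-decay {ofℕ 2 * inv-suc 8} (k ℕ.+ k) (nonNegative⁻¹ (ofℕ 2 * inv-suc 8)) (≤-by {ofℕ 2 * inv-suc 8} {1ℚ} {ρ} refl (nonNegative⁻¹ ρ))))
      alg₂ : ∀ r → inv-suc 99 * r ≡ ofℕ 1458 * (inv-suc 299999 * r) + ofℕ 9 * (r * inv-suc 4095) + ofℕ 3 * (r * inv-suc 4095)
        + (inv-suc 99 - ofℕ 1458 * inv-suc 299999 - ofℕ 12 * inv-suc 4095) * r
      alg₂ = solve-∀ ring

    lower-large-k : 12 ℕ.≤ A → inv-suc 2399999 * (p * r⁻) ≤ Err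
    lower-large-k 12≤A = ≤-trans (≤-reflexive (alg (p * r⁻))) (≤-trans (*-monoˡ 0≤δ (escape-many 0≤δ π≤ Kπ²≤)) (markov 0≤δ))
      where
      π = E 𝔼 (within δ)
      0≤π : 0ℚ ≤ π
      0≤π = 0≤within δ
      π≤r : π ≤ inv-suc 99 * r⁻
      π≤r = within-δ 12≤A
      alg : ∀ x → inv-suc 2399999 * x ≡ inv-suc 299999 * x * inv-suc 7
      alg = solve-∀ ring
      π≤ : π ≤ inv-suc 99
      π≤ = ≤-trans π≤r (≤-trans (*-monoˡ (0≤inv 100) (half≤1 A)) (≤-reflexive (*-identityʳ (inv-suc 99))))
      alg₂ : ∀ K r → K * (inv-suc 99 * r * (inv-suc 99 * r)) ≡ inv-suc 9999 * (K * (r * r))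
      alg₂ = solve-∀ ring
      Kπ²≤ : K * (π * π) ≤ inv-suc 2499
      Kπ²≤ = ≤-trans (*-monoˡ 0≤K (sq-mono 0≤π π≤r)) (≤-trans (≤-reflexive (alg₂ K r⁻)) (*-monoˡ (0≤inv 10000) Kr⁻r⁻≤4))

    lower-small-k : inv-suc 3 * p * inv-suc 3 ^ k ≤ Err
    lower-small-k = ≤-trans (*-monoˡ 0≤t (≤-trans (^-mono k (0≤inv 4) ¼≤) (escape-few 0≤t))) (markov 0≤t)
      where
      t = inv-suc 3 * p
      0≤t : 0ℚ ≤ t
      0≤t = 0≤inv 4 0≤* 0≤p
      alg : ∀ p → ½ * p ≡ inv-suc 3 * p + inv-suc 3 * p
      alg = solve-∀ ring
      inv-2B : inv (B ℕ.+ B) ≡ ½ * p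
      inv-2B = trans (cong inv (cong (B ℕ.+_) (sym (ℕₚ.+-identityʳ B)))) (inv-* 2 B)
      t< : t < inv (B ℕ.+ B)
      t< = subst₂ _<_ (+-identityʳ t) (sym (trans inv-2B (alg p))) (+-monoʳ-< t (0<* (0<inv-suc 3) (0<inv 1≤B)))
      alg₂ : ∀ π → 1ℚ - π ≡ inv-suc 3 + (½ + inv-suc 3 - π)
      alg₂ = solve-∀ ring
      ¼≤ : inv-suc 3 ≤ 1ℚ - E 𝔼 (within t)
      ¼≤ = ≤-by (alg₂ (E 𝔼 (within t))) (0≤- (escape {t} {within t} t< (λ x → ⟦⟧≤1 (∣ x ∣ ≤? t)) (within-support t) n 2B≤n 0ℚ))

    bounds : ∀ a → 12 ℕ.≤ a → Bounds a (suc (m ℕ.+ m)) n B A i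
    bounds a 12≤a = ≤-trans (by-size (12 ℕ.≤? A)) (≤-reflexive (sym expectedError≡)) , ≤-trans (≤-reflexive expectedError≡) upper-bound
      where
      c κ : ℚ
      c = inv-suc 2399999
      κ = inv-suc 3 ^ (4 ℕ.* square a)
      0≤κ : 0ℚ ≤ κ
      0≤κ = 0≤^ (4 ℕ.* square a) (0≤inv 4)
      alg : ∀ c κ p r → c * κ * (p * r) ≡ c * p * κ * r
      alg = solve-∀ ring
      by-size : Dec (12 ℕ.≤ A) → c * κ * (p * r⁻) ≤ Err
      by-size (yes 12≤A) = ≤-trans (*-monoʳ (0≤p 0≤* 0≤r⁻) (≤-trans (*-monoˡ (0≤inv 2400000) (pow≤1 (4 ℕ.* square a))) (≤-reflexive (*-identityʳ c))))
        (lower-large-k 12≤A)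
      by-size (no A<12) = ≤-trans (≤-reflexive (alg c κ p r⁻))
        (≤-trans (≤-trans (*-monoˡ (0≤inv 2400000 0≤* 0≤p 0≤* 0≤κ) (half≤1 A)) (≤-reflexive (*-identityʳ (c * p * κ))))
        (≤-trans (*-mono (0≤inv 2400000 0≤* 0≤p) (0≤^ k (0≤inv 4)) (*-monoʳ 0≤p c≤¼)
          (^-antitone (0≤inv 4) ¼≤1 k≤)) lower-small-k))
        where
        c≤¼ : c ≤ inv-suc 3
        c≤¼ = ≤-by {c} {inv-suc 3} {inv-suc 3 - c} refl (nonNegative⁻¹ (inv-suc 3 - c))
        k≤ : k ℕ.≤ 4 ℕ.* square a
        k≤ = ℕₚ.≤-trans k≤4r² (ℕₚ.*-monoʳ-≤ 4 (square-mono (ℕₚ.≤-trans (ℕₚ.<⇒≤ (ℕₚ.≰⇒> A<12)) 12≤a)))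

  squared-lower : ∀ {E b p r⁻ c l K} → 0ℚ ≤ c → 0ℚ ≤ r⁻ → 0ℚ ≤ E → 0ℚ ≤ b → 0ℚ ≤ K → b * p ≡ 1ℚ → 1ℚ ≤ l → 1ℚ ≤ K * (r⁻ * r⁻) → c * (p * r⁻) ≤ E →
    c * c ≤ E * b * l * (E * b * l) * K
  squared-lower {E} {b} {p} {r⁻} {c} {l} {K} 0≤c 0≤r⁻ 0≤E 0≤b 0≤K bp 1≤l 1≤K h =
    ≤-trans (≤-trans (≤-reflexive (sym (*-identityʳ (c * c)))) (*-monoˡ (0≤c 0≤* 0≤c) 1≤K))
    (≤-trans (≤-reflexive (alg₁ c r⁻ K)) (*-monoʳ 0≤K (sq-mono (0≤c 0≤* 0≤r⁻) cr≤)))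
    where
    alg₁ : ∀ c r K → c * c * (K * (r * r)) ≡ c * r * (c * r) * K
    alg₁ = solve-∀ ring
    alg₂ : ∀ c p r b → c * (p * r) * b ≡ b * p * (c * r)
    alg₂ = solve-∀ ring
    cr≤ : c * r⁻ ≤ E * b * l
    cr≤ = ≤-trans (≤-reflexive (sym (trans (alg₂ c p r⁻ b) (trans (cong (_* (c * r⁻)) bp) (*-identityˡ (c * r⁻))))))
      (≤-trans (*-monoʳ 0≤b h) (≤-trans (≤-reflexive (sym (*-identityʳ (E * b)))) (*-monoˡ (0≤E 0≤* 0≤b) 1≤l)))

  squared-upper : ∀ {E b p r⁻ C K} → 0ℚ ≤ E → 0ℚ ≤ b → 0ℚ ≤ K → b * p ≡ 1ℚ → K * (r⁻ * r⁻) ≤ ofℕ 4 → E ≤ C * (p * r⁻) →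
    E * b * (E * b) * K ≤ ofℕ 2 * C * (ofℕ 2 * C)
  squared-upper {E} {b} {p} {r⁻} {C} {K} 0≤E 0≤b 0≤K bp K≤ h =
    ≤-trans (*-monoʳ 0≤K (sq-mono (0≤E 0≤* 0≤b) Eb≤)) (≤-trans (≤-reflexive (alg₁ C r⁻ K)) (≤-trans (*-monoˡ (0≤sq C) K≤) (≤-reflexive (alg₃ C))))
    where
    alg₁ : ∀ C r K → C * r * (C * r) * K ≡ C * C * (K * (r * r))
    alg₁ = solve-∀ ring
    alg₂ : ∀ c p r b → c * (p * r) * b ≡ b * p * (c * r)
    alg₂ = solve-∀ ring
    alg₃ : ∀ C → C * C * ofℕ 4 ≡ ofℕ 2 * C * (ofℕ 2 * C)
    alg₃ = solve-∀ ring
    Eb≤ : E * b ≤ C * r⁻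
    Eb≤ = ≤-trans (*-monoʳ 0≤b h) (≤-reflexive (trans (alg₂ C p r⁻ b) (trans (cong (_* (C * r⁻)) bp) (*-identityˡ (C * r⁻)))))

  Conclusion : ℚ → ℚ → (k n B : ℕ) → Fin n → Set
  Conclusion c C k n B i =
    (c * c ≤ (expectedError n B k i * ofℕ B * ofℕ ⌊log₂ k ⌋) * (expectedError n B k i * ofℕ B * ofℕ ⌊log₂ k ⌋) * ofℕ k)
    × ((expectedError n B k i * ofℕ B) * (expectedError n B k i * ofℕ B) * ofℕ k ≤ C * C)

  conclude : ∀ a k n B A (i : Fin n) → 3 ℕ.≤ k → k ℕ.≤ B → square A ℕ.≤ k → k ℕ.≤ 4 ℕ.* square A → Bounds a k n B A i →
    Conclusion (constant a) (ofℕ 2 * ofℕ 5701) k n B i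
  conclude a k n B A i 3≤k k≤B r²≤k k≤4r² bounds =
    squared-lower {err} {ofℕ B} {inv B} {half A} {constant a} {ofℕ ⌊log₂ k ⌋} {ofℕ k} (<⇒≤ (0<constant a)) (0≤half A) 0≤err (0≤ofℕ B) (0≤ofℕ k) bp
      (ofℕ-mono {1} {⌊log₂ k ⌋} (⌊log₂⌋-mono-≤ 3≤k)) 1≤Krr (proj₁ bounds) ,
    squared-upper {err} {ofℕ B} {inv B} {half A} {ofℕ 5701} {ofℕ k} 0≤err (0≤ofℕ B) (0≤ofℕ k) bp Krr≤4 (proj₂ bounds)
    where
    err : ℚ
    err = expectedError n B k i
    bp : ofℕ B * inv B ≡ 1ℚ
    bp = ofℕ*inv (ℕₚ.≤-trans (ℕ.s≤s ℕ.z≤n) (ℕₚ.≤-trans 3≤k k≤B))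
    0≤err : 0ℚ ≤ err
    0≤err = ≤-trans (<⇒≤ (0<constant a) 0≤* (0≤inv B 0≤* 0≤half A)) (proj₁ bounds)
    rr≡ : ofℕ (square A) * (half A * half A) ≡ 1ℚ
    rr≡ = trans (cong (_* (half A * half A)) (ofℕ-* (2 ℕ.^ A) (2 ℕ.^ A))) (trans (alg (double A) (half A)) (cong (λ z → z * z) (double*half A)))
      where
      alg : ∀ d h → d * d * (h * h) ≡ d * h * (d * h)
      alg = solve-∀ ring
    0≤rr : 0ℚ ≤ half A * half A
    0≤rr = 0≤half A 0≤* 0≤half A
    1≤Krr : 1ℚ ≤ ofℕ k * (half A * half A)
    1≤Krr = ≤-trans (≤-reflexive (sym rr≡)) (*-monoʳ 0≤rr (ofℕ-mono r²≤k))
    Krr≤4 : ofℕ k * (half A * half A) ≤ ofℕ 4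
    Krr≤4 = ≤-trans (*-monoʳ 0≤rr (ofℕ-mono k≤4r²)) (≤-reflexive (trans (cong (_* (half A * half A)) (ofℕ-* 4 (square A)))
      (trans (*-assoc (ofℕ 4) (ofℕ (square A)) (half A * half A)) (trans (cong (ofℕ 4 *_) rr≡) (*-identityʳ (ofℕ 4))))))

  uniform-bounds : ∀ a → 12 ℕ.≤ a → (k n B : ℕ) → 3 ℕ.≤ k → ¬ (2 ∣ k) → k ℕ.* B ℕ.≤ n → k ℕ.≤ B → (i : Fin n) →
    Conclusion (constant a) (ofℕ 2 * ofℕ 5701) k n B i
  uniform-bounds a 12≤a k n B 3≤k odd kB≤n k≤B i = from-forms (odd-form k odd) (log₄ k (ℕₚ.≤-trans (ℕ.s≤s ℕ.z≤n) 3≤k)) (halve B)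
    where
    3≤B : 3 ℕ.≤ B
    3≤B = ℕₚ.≤-trans 3≤k k≤B
    2≤3 : 2 ℕ.≤ 3
    2≤3 = ℕ.s≤s (ℕ.s≤s ℕ.z≤n)
    positive-half : ∀ {h n} → 3 ℕ.≤ n → n ℕ.≤ suc (h ℕ.+ h) → 1 ℕ.≤ h
    positive-half {zero} 3≤n u  = ⊥-elim (ℕₚ.<⇒≱ (ℕₚ.≤-trans 2≤3 3≤n) u)
    positive-half {suc h} 3≤n u = ℕ.s≤s ℕ.z≤n
    2B≤n : B ℕ.+ B ℕ.≤ n
    2B≤n = ℕₚ.≤-trans (ℕₚ.≤-reflexive (cong (B ℕ.+_) (sym (ℕₚ.+-identityʳ B)))) (ℕₚ.≤-trans (ℕₚ.*-monoˡ-≤ B (ℕₚ.≤-trans 2≤3 3≤k)) kB≤n)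
    from-forms : Σ ℕ (λ m → k ≡ suc (m ℕ.+ m)) → Σ ℕ (λ A → square A ℕ.≤ k × k ℕ.≤ 4 ℕ.* square A) →
      Σ ℕ (λ L → L ℕ.+ L ℕ.≤ B × B ℕ.≤ suc (L ℕ.+ L)) → Conclusion (constant a) (ofℕ 2 * ofℕ 5701) k n B i
    from-forms (m , refl) (A , r²≤k , k≤4r²) (L , 2L≤B , B≤2L+1) = conclude a k n B A i 3≤k k≤B r²≤k k≤4r²
      (Analysis.bounds m n B L A i (positive-half 3≤k ℕₚ.≤-refl) (ℕₚ.≤-trans 2≤3 3≤B) (positive-half 3≤B B≤2L+1) 2L≤B B≤2L+1 2B≤n kB≤n k≤B r²≤k k≤4r² a 12≤a)

open import Data.Nat using (ℕ; _≤_; _*_)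
open import Data.Nat.Logarithm using (⌊log₂_⌋)
open import Data.Nat.Divisibility using (_∣_)
open import Data.Fin using (Fin)
open import Data.Product using (Σ; _×_)
open import Relation.Nullary using (¬_)
open import Data.Rational as ℚ using (ℚ; 0ℚ; _<_)
open import Data.Nat.Properties using (≤-refl)
open import Data.Product using (_,_)
open import Data.Rational.Properties using (positive⁻¹)
open CountSketch using (constant; 0<constant; uniform-bounds)

theorem10 : Σ ℚ λ c → Σ ℚ λ C → (0ℚ < c) × (0ℚ < C) ×
    ((k n B : ℕ) → 3 ≤ k → ¬ (2 ∣ k) → k * B ≤ n → k ≤ B → (i : Fin n) →
    (c ℚ.* c ℚ.≤ (expectedError n B k i ℚ.* ofℕ B ℚ.* ofℕ ⌊log₂ k ⌋) ℚ.* (expectedError n B k i ℚ.* ofℕ B ℚ.* ofℕ ⌊log₂ k ⌋) ℚ.* ofℕ k)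
    × ((expectedError n B k i ℚ.* ofℕ B) ℚ.* (expectedError n B k i ℚ.* ofℕ B) ℚ.* ofℕ k ℚ.≤ C ℚ.* C))
theorem10 = constant 12 , ofℕ 2 ℚ.* ofℕ 5701 , 0<constant 12 , positive⁻¹ (ofℕ 2 ℚ.* ofℕ 5701) , uniform-bounds 12 ≤-refl
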